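{- Let $G$ be a countable graph such that every countable planar graph is a topological minor of $G$. Then: (1) $G$ contains the countably infinite complete graph $K_{\aleph_0}$ as a minor; (2) for every $k \in \mathbb N$, $G$ contains the complete graph $K_k$ as a topological minor.
   Context: Graphs may be infinite. A graph is planar if it has a plane embedding: vertices are mapped to distinct points of $\mathbb R^2$ and edges to polygonal arcs joining the images of their endpoints, such that distinct arcs are internally disjoint and no arc passes through the image of a vertex other than its endpoints (accumulation points are allowed). $H$ is a topological minor of $G$ if $G$ contains a subdivision of $H$ as a subgraph, i.e. there is an injective map $\iota$ from $V(H)$ to $V(G)$ together with an assignment of an $\iota(u)$--$\iota(v)$-path in $G$ to each edge $uv$ of $H$, such that these paths are internally disjoint and avoid $\iota(V(H))$ in their interiors. Minor is the usual (possibly infinite) minor relation: there are disjoint connected subgraphs (branch sets) of $G$ indexed by the vertices of the minor, with an edge of $G$ between the branch sets of any two adjacent vertices. -}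

module Defs where

open import Level using (0ℓ)
open import Data.Nat using (ℕ; suc)
open import Data.Fin using (Fin; zero; suc; toℕ; inject₁; fromℕ)
open import Data.Product using (Σ; ∃; _×_; _,_)
open import Data.Sum using (_⊎_)
open import Data.Empty using (⊥)
open import Data.List using (List; []; _∷_; _++_; [_]; reverse)
open import Data.List.Relation.Unary.Linked using (Linked)
open import Data.List.Relation.Unary.All using (All)
open import Data.List.Relation.Unary.Unique.Propositional using (Unique)
open import Data.List.Membership.Propositional using (_∈_)
open import Relation.Nullary using (¬_)
open import Relation.Binary.PropositionalEquality using (_≡_; _≢_)
open import Function.Definitions using (Injective)

record Graph : Set₁ where
  field
    V      : Set
    Adj    : V → V → Set
    sym    : ∀ {u v} → Adj u v → Adj v u
    irrefl : ∀ {v} → ¬ Adj v v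
open Graph public

Countable : Graph → Set
Countable G = Σ (V G → ℕ) λ f → Injective _≡_ _≡_ f

Kℵ₀ : Graph
Kℵ₀ = record { V = ℕ ; Adj = λ m n → m ≢ n ; sym = λ p q → p (Relation.Binary.PropositionalEquality.sym q) ; irrefl = λ p → p Relation.Binary.PropositionalEquality.refl }

K : ℕ → Graph
K k = record { V = Fin k ; Adj = λ m n → m ≢ n ; sym = λ p q → p (Relation.Binary.PropositionalEquality.sym q) ; irrefl = λ p → p Relation.Binary.PropositionalEquality.refl }

record Path (G : Graph) (a b : V G) : Set where
  field
    interior : List (V G)
    linked   : Linked (Adj G) (a ∷ interior ++ [ b ])
    distinct : Unique (a ∷ interior ++ [ b ])
open Path public

record TopMinor (H G : Graph) : Set where
  field
    ι        : V H → V G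
    ι-inj    : Injective _≡_ _≡_ ι
    path     : ∀ u v → Adj H u v → Path G (ι u) (ι v)
    -- the edge uv of H gets one path (independent of orientation / proof)
    coherent : ∀ u v (e : Adj H u v) (e' : Adj H v u) →
               interior (path v u e') ≡ reverse (interior (path u v e))
    disjoint : ∀ u v u' v' (e : Adj H u v) (e' : Adj H u' v') →
               ¬ (u ≡ u' × v ≡ v') → ¬ (u ≡ v' × v ≡ u') →
               ∀ x → x ∈ interior (path u v e) → x ∈ interior (path u' v' e') → ⊥
    avoid    : ∀ u v (e : Adj H u v) w → ι w ∈ interior (path u v e) → ⊥

record Minor (H G : Graph) : Set₁ where
  field
    B         : V H → V G → Set
    disjoint  : ∀ u v x → B u x → B v x → u ≡ v
    nonempty  : ∀ u → ∃ λ x → B u x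
    connected : ∀ u x y → B u x → B u y →
                Σ (List (V G)) λ l → All (B u) l × Linked (Adj G) (x ∷ l ++ [ y ])
    edges     : ∀ u v → Adj H u v →
                Σ (V G) λ x → Σ (V G) λ y → B u x × B v y × Adj G x y

record CompleteOrderedField : Set₁ where
  infixl 6 _+_
  infixl 7 _*_
  infix 4 _≤_
  field
    ℝ    : Set
    0r 1r : ℝ
    _+_ _*_ : ℝ → ℝ → ℝ
    -_   : ℝ → ℝ
    _≤_  : ℝ → ℝ → Set
    +-assoc : ∀ x y z → (x + y) + z ≡ x + (y + z)
    +-comm  : ∀ x y → x + y ≡ y + x
    +-idʳ   : ∀ x → x + 0r ≡ x
    +-invʳ  : ∀ x → x + (- x) ≡ 0r
    *-assoc : ∀ x y z → (x * y) * z ≡ x * (y * z)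
    *-comm  : ∀ x y → x * y ≡ y * x
    *-idʳ   : ∀ x → x * 1r ≡ x
    *-inv   : ∀ x → x ≢ 0r → ∃ λ y → x * y ≡ 1r
    distrib : ∀ x y z → x * (y + z) ≡ x * y + x * z
    0≢1     : 0r ≢ 1r
    ≤-refl  : ∀ x → x ≤ x
    ≤-trans : ∀ {x y z} → x ≤ y → y ≤ z → x ≤ z
    ≤-antisym : ∀ {x y} → x ≤ y → y ≤ x → x ≡ y
    ≤-total : ∀ x y → x ≤ y ⊎ y ≤ x
    +-mono  : ∀ {x y} z → x ≤ y → x + z ≤ y + z
    *-pos   : ∀ {x y} → 0r ≤ x → 0r ≤ y → 0r ≤ x * y
    sup     : (S : ℝ → Set) → (∃ λ x → S x) → (∃ λ b → ∀ x → S x → x ≤ b) →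
              ∃ λ s → (∀ x → S x → x ≤ s) × (∀ b → (∀ x → S x → x ≤ b) → s ≤ b)

module Plane (R : CompleteOrderedField) where
  open CompleteOrderedField R

  Point : Set
  Point = ℝ × ℝ

  _-ᵣ_ : ℝ → ℝ → ℝ
  x -ᵣ y = x + (- y)

  OnSeg : Point → Point → Point → Set
  OnSeg (a₁ , a₂) (b₁ , b₂) (x₁ , x₂) =
    Σ ℝ λ t → 0r ≤ t × t ≤ 1r ×
      x₁ ≡ a₁ + t * (b₁ -ᵣ a₁) × x₂ ≡ a₂ + t * (b₂ -ᵣ a₂)

  -- a polygonal arc from p to q: breakpoints pts 0 = p, …, pts (n+1) = q,
  -- segments i = [pts i, pts (i+1)] for i ≤ n; simplicity: segments are
  -- non-degenerate, consecutive segments meet only in their common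
  -- breakpoint, non-consecutive segments are disjoint.
  record PolyArc (p q : Point) : Set where
    field
      n     : ℕ
      pts   : Fin (suc (suc n)) → Point
      start : pts zero ≡ p
      end   : pts (fromℕ (suc n)) ≡ q
      nondeg : ∀ (i : Fin (suc n)) → pts (inject₁ i) ≢ pts (suc i)
      consec : ∀ (i j : Fin (suc n)) → toℕ j ≡ suc (toℕ i) → ∀ x →
               OnSeg (pts (inject₁ i)) (pts (suc i)) x →
               OnSeg (pts (inject₁ j)) (pts (suc j)) x → x ≡ pts (suc i)
      apart  : ∀ (i j : Fin (suc n)) → toℕ j ≢ toℕ i → toℕ j ≢ suc (toℕ i) →
               toℕ i ≢ suc (toℕ j) → ∀ x →
               OnSeg (pts (inject₁ i)) (pts (suc i)) x →
               OnSeg (pts (inject₁ j)) (pts (suc j)) x → ⊥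

  OnArc : ∀ {p q} → PolyArc p q → Point → Set
  OnArc A x = Σ (Fin (suc (PolyArc.n A))) λ i →
    OnSeg (PolyArc.pts A (inject₁ i)) (PolyArc.pts A (suc i)) x

  record PlaneEmbedding (H : Graph) : Set where
    field
      pos      : V H → Point
      pos-inj  : Injective _≡_ _≡_ pos
      arc      : ∀ u v → Adj H u v → PolyArc (pos u) (pos v)
      -- one arc per edge (independent of orientation / proof)
      coherent : ∀ u v (e : Adj H u v) (e' : Adj H v u) x →
                 OnArc (arc u v e) x → OnArc (arc v u e') x
      disjoint : ∀ u v u' v' (e : Adj H u v) (e' : Adj H u' v') →
                 ¬ (u ≡ u' × v ≡ v') → ¬ (u ≡ v' × v ≡ u') →
                 ∀ x → OnArc (arc u v e) x → OnArc (arc u' v' e') x →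
                 (x ≡ pos u ⊎ x ≡ pos v) × (x ≡ pos u' ⊎ x ≡ pos v')
      avoid    : ∀ u v (e : Adj H u v) w → OnArc (arc u v e) (pos w) →
                 w ≡ u ⊎ w ≡ v

  Planar : Graph → Set
  Planar H = PlaneEmbedding H

-- The real numbers enter twice.  Completeness yields the weak law of excluded middle, and it makes
-- subsets b of ℕ into real numbers, on which functions are automatically extensional.
--
-- For every b there is a planar graph H b, drawn on the vertical lines x = 0, 1, 2, …, that consists of
-- infinitely many tracks, of cells between consecutive tracks that are infinite triangulated ladders,
-- the bit b m deciding the diagonal of the square 2m of every ladder, and of hubs, each joined to the
-- beginnings of k + 1 consecutive tracks.  Each edge of H b is replaced by infinitely many parallel paths, so that in
-- G an edge can be realised outside any given finite set.
--
-- By a diagonal argument (Zermelo's explicit form of Cantor's theorem) one finds a subset W and, for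
-- every j, a subset B such that the copies of H W and H B in G agree on the first j × j vertices of the
-- tracks although W and B differ in a known bit.  Two triangulated ladders with the same feet and hubs
-- but different diagonals contain two crossing disjoint routes, so in every cell of this large box two
-- lines running along the tracks of H W can cross each other outside the tracks.
--
-- Lines now run along the tracks from left to right.  Whenever a line x should meet the line y above
-- it, x climbs to the track below y and uses a rung; after that the two lines are to be exchanged.  The
-- paths of a crossing may run into the tracks far to the right, where they are in the way of the other
-- lines.  Therefore 2k columns of lanes are tested first.  If the paths avoid the lanes, the crossing
-- is carried out and all lines spread to rows that are never touched by the crossing; otherwise y
-- follows its path only up to the first lane vertex hit, where it joins the other lines above or below
-- all of them.  In either case x is below the line that used to be above y, so it can go on.
--
-- A new line entering at the bottom that meets all others, again and again, gives the infinite
-- complete minor.  For the topological minor there are k hubs with k + 1 lines each; all pairs of lines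
-- meet, and the hubs a and b are joined through the lines (a , b) and (b , a).

module Submission where

open import Defs hiding (sym)
open import Data.Nat using (ℕ; zero; suc)
open import Data.Nat.Base using (z≤n; s≤s) renaming (_<_ to _<ℕ_; _≤_ to _≤ℕ_; _+_ to _+ℕ_)
open import Data.Nat.Properties using (suc-injective) renaming (<-cmp to <ℕ-cmp; ≤-refl to ≤ℕ-refl; ≤⇒≤′ to ≤ℕ⇒≤′; m≤n⇒m<n∨m≡n to ≤ℕ⇒<∨≡)
open import Data.Bool using (Bool; true; false; if_then_else_)
import Data.Bool.Properties as Bool
open import Data.List using (List; []; _∷_; length)
open import Data.Product using (Σ; ∃; _×_; _,_; proj₁; proj₂; swap)
open import Data.Sum using (_⊎_; inj₁; inj₂)
import Data.Sum as Sum
open import Data.Empty using (⊥; ⊥-elim)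
open import Function using (_∘_)
open import Function.Definitions using (Injective)
open import Relation.Nullary using (¬_; Dec; yes; no)
open import Relation.Nullary.Decidable using (decidable-stable; map′; True; toWitness)
open import Relation.Binary.Definitions using (DecidableEquality; Tri; tri<; tri≈; tri>)
open import Relation.Binary.PropositionalEquality using (_≡_; _≢_; refl; sym; trans; cong; cong₂; subst; subst₂; isEquivalence; _≗_)
open import Algebra.Bundles using (CommutativeSemiring)
open import Algebra.Structures.Biased using (isCommutativeSemiringˡ)
import Algebra.Solver.Ring.NaturalCoefficients.Default as NatSolver

-- Ordered fields, the weak law of excluded middle, and lexicographic heights

-- One host graph gives only a planar subgraph of `G`, so every crossing must come from two
-- overlapping copies. There are uncountably many subsets, but only countably many ways to place the
-- first `j` × `j` track vertices in `G`; hence some two copies share them. The tower is run for all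
-- `j` at once because the lines of the construction live in one copy, whereas each new crossing
-- needs a larger box. The box causes a circularity. It must be fixed before a crossing is drawn,
-- but the number of rows that the lines need in order to get around the crossing depends on the
-- length of the crossing. So a crossing can be kept out of the low rows only. If it runs into the
-- high rows of the lanes, it is not carried out: it then serves as a way for `y` past the other
-- lines. The logic stays weak: statements about the tower are double negated, and they return to
-- the constructive part through decidable equality of finite lists of labels. From there on, pieces
-- are finite lists of vertices with decidable membership.

module OrderedField (R : CompleteOrderedField) where
  open CompleteOrderedField R public

  +-idˡ : ∀ x → 0r + x ≡ x
  +-idˡ x = trans (+-comm 0r x) (+-idʳ x)

  +-cancelʳ : ∀ x y z → x + z ≡ y + z → x ≡ y
  +-cancelʳ x y z e = trans (lem x) (trans (cong (_+ (- z)) e) (sym (lem y)))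
    where
    lem : ∀ u → u ≡ (u + z) + (- z)
    lem u = sym (trans (+-assoc u z (- z)) (trans (cong (u +_) (+-invʳ z)) (+-idʳ u)))

  zeroˡ : ∀ x → 0r * x ≡ 0r
  zeroˡ x = trans (*-comm 0r x) (+-cancelʳ (x * 0r) 0r (x * 0r)
    (trans (sym (distrib x 0r 0r)) (trans (cong (x *_) (+-idʳ 0r)) (sym (+-idˡ (x * 0r))))))

  commutativeSemiring : CommutativeSemiring _ _
  commutativeSemiring = record
    { Carrier = ℝ ; _≈_ = _≡_ ; _+_ = _+_ ; _*_ = _*_ ; 0# = 0r ; 1# = 1r
    ; isCommutativeSemiring = isCommutativeSemiringˡ record
      { +-isCommutativeMonoid = record
        { isMonoid = record
          { isSemigroup = record
            { isMagma = record { isEquivalence = isEquivalence ; ∙-cong = cong₂ _+_ }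
            ; assoc = +-assoc }
          ; identity = +-idˡ , +-idʳ }
        ; comm = +-comm }
      ; *-isCommutativeMonoid = record
        { isMonoid = record
          { isSemigroup = record
            { isMagma = record { isEquivalence = isEquivalence ; ∙-cong = cong₂ _*_ }
            ; assoc = *-assoc }
          ; identity = (λ x → trans (*-comm 1r x) (*-idʳ x)) , *-idʳ }
        ; comm = *-comm }
      ; distribʳ = λ z x y → trans (*-comm (x + y) z) (trans (distrib z x y) (cong₂ _+_ (*-comm z x) (*-comm z y)))
      ; zeroˡ = zeroˡ } }

  open NatSolver commutativeSemiring using (solve; _:+_; _:*_; _:=_; con) public

  +-monoˡ : ∀ z {x y} → x ≤ y → z + x ≤ z + y
  +-monoˡ z {x} {y} p = subst₂ _≤_ (+-comm x z) (+-comm y z) (+-mono z p)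

  +-mono₂ : ∀ {x y u v} → x ≤ y → u ≤ v → x + u ≤ y + v
  +-mono₂ {y = y} {u} p q = ≤-trans (+-mono u p) (+-monoˡ y q)

  ≤-reflexive : ∀ {x y} → x ≡ y → x ≤ y
  ≤-reflexive {x} refl = ≤-refl x

  +-cancel-≤ : ∀ z {x y} → x + z ≤ y + z → x ≤ y
  +-cancel-≤ z {x} {y} p = subst₂ _≤_ (lem x) (lem y) (+-mono (- z) p)
    where
    lem : ∀ u → (u + z) + (- z) ≡ u
    lem u = trans (+-assoc u z (- z)) (trans (cong (u +_) (+-invʳ z)) (+-idʳ u))

  gap : ∀ x y → Σ ℝ λ d → x + d ≡ y
  gap x y = (- x) + y , trans (sym (+-assoc x (- x) y)) (trans (cong (_+ y) (+-invʳ x)) (+-idˡ y))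

  gap-nonneg : ∀ {x y d} → x + d ≡ y → x ≤ y → 0r ≤ d
  gap-nonneg {x} {y} {d} e p = +-cancel-≤ x (subst₂ _≤_ (sym (+-idˡ x)) (trans (sym e) (+-comm x d)) p)

  -- (−1)(−1) = 1 makes 1 nonnegative even if 1 ≤ 0.
  0≤1 : 0r ≤ 1r
  0≤1 with ≤-total 0r 1r
  ... | inj₁ p = p
  ... | inj₂ p = ≤-trans (*-pos 0≤m 0≤m) (≤-reflexive m²≡1)
    where
    m : ℝ
    m = - 1r
    0≤m : 0r ≤ m
    0≤m = gap-nonneg (+-invʳ 1r) p
    m²≡1 : m * m ≡ 1r
    m²≡1 = +-cancelʳ (m * m) 1r m
      (trans (cong (m * m +_) (sym (*-idʳ m)))
      (trans (sym (distrib m m 1r))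
      (trans (cong (m *_) (trans (+-comm m 1r) (+-invʳ 1r)))
      (trans (*-comm m 0r) (trans (zeroˡ m) (sym (+-invʳ 1r)))))))

  infix 4 _<_
  _<_ : ℝ → ℝ → Set
  x < y = ¬ (y ≤ x)

  <⇒≤ : ∀ {x y} → x < y → x ≤ y
  <⇒≤ {x} {y} p with ≤-total x y
  ... | inj₁ q = q
  ... | inj₂ q = ⊥-elim (p q)

  <-≤-trans : ∀ {x y z} → x < y → y ≤ z → x < z
  <-≤-trans p q r = p (≤-trans q r)

  ≤-<-trans : ∀ {x y z} → x ≤ y → y < z → x < z
  ≤-<-trans p q r = q (≤-trans r p)

  0<1 : 0r < 1r
  0<1 p = 0≢1 (≤-antisym 0≤1 p)

  +-monoˡ-< : ∀ z {x y} → x < y → z + x < z + y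
  +-monoˡ-< z {x} {y} p q = p (+-cancel-≤ z (subst₂ _≤_ (+-comm z y) (+-comm z x) q))

  1<2 : 1r < 1r + 1r
  1<2 p = +-monoˡ-< 1r 0<1 (≤-trans p (≤-reflexive (sym (+-idʳ 1r))))

  half-exists : Σ ℝ λ h → h + h ≡ 1r
  half-exists with *-inv (1r + 1r) (λ e → 1<2 (≤-trans (≤-reflexive e) 0≤1))
  ... | h , e = h , trans (solve 1 (λ h → h :+ h := (con 1 :+ con 1) :* h) refl h) e

  h : ℝ
  h = proj₁ half-exists

  h+h : h + h ≡ 1r
  h+h = proj₂ half-exists

  halves : ∀ x → h * x + h * x ≡ x
  halves x = trans (solve 2 (λ h x → h :* x :+ h :* x := (h :+ h) :* x) refl h x)
             (trans (cong (_* x) h+h) (trans (*-comm 1r x) (*-idʳ x)))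

  h*-cancel-≤ : ∀ {x y} → h * x ≤ h * y → x ≤ y
  h*-cancel-≤ {x} {y} p = subst₂ _≤_ (halves x) (halves y) (+-mono₂ p p)

  h*-mono-< : ∀ {x y} → x < y → h * x < h * y
  h*-mono-< p q = p (h*-cancel-≤ q)

  h≡h*1 : h * 1r ≡ h
  h≡h*1 = *-idʳ h

  h*0 : h * 0r ≡ 0r
  h*0 = trans (*-comm h 0r) (zeroˡ h)

  0<h : 0r < h
  0<h = subst₂ _<_ h*0 h≡h*1 (h*-mono-< 0<1)

  h<1 : h < 1r
  h<1 = subst₂ _<_ (+-idʳ h) h+h (+-monoˡ-< h 0<h)

  -- Completeness yields the weak law of excluded middle: compare the supremum of
  -- {0} ∪ {1 ∣ P} with 1/2.
  wlem : (P : Set) → ¬ P ⊎ ¬ ¬ P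
  wlem P = decide (sup S (0r , inj₁ refl) (1r , bounded))
    where
    S : ℝ → Set
    S x = (x ≡ 0r) ⊎ (x ≡ 1r × P)
    bounded : ∀ x → S x → x ≤ 1r
    bounded x (inj₁ refl) = 0≤1
    bounded x (inj₂ (refl , _)) = ≤-refl 1r
    decide : (∃ λ s → (∀ x → S x → x ≤ s) × (∀ b → (∀ x → S x → x ≤ b) → s ≤ b)) → ¬ P ⊎ ¬ ¬ P
    decide (s , ub , lub) with ≤-total s h
    ... | inj₁ s≤h = inj₁ λ p → h<1 (≤-trans (ub 1r (inj₂ (refl , p))) s≤h)
    ... | inj₂ h≤s = inj₂ λ np → 0<h (≤-trans h≤s (lub 0r λ { x (inj₁ refl) → ≤-refl 0r ; x (inj₂ (_ , p)) → ⊥-elim (np p) }))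

  lo hi : ℝ → ℝ
  lo x = h * x
  hi x = h + h * x

  Unit : ℝ → Set
  Unit x = 0r ≤ x × x < 1r

  lo-unit : ∀ {x} → Unit x → Unit (lo x)
  lo-unit {x} (p , q) = subst (_≤ h * x) h*0 (nonneg p) , λ r → <-≤-trans (h*-mono-< q) (≤-trans (≤-reflexive h≡h*1) (<⇒≤ h<1)) r
    where
    nonneg : 0r ≤ x → h * 0r ≤ h * x
    nonneg p with ≤-total (h * 0r) (h * x)
    ... | inj₁ r = r
    ... | inj₂ r = ≤-reflexive (cong (h *_) (≤-antisym p (h*-cancel-≤ r)))

  hi-unit : ∀ {x} → Unit x → Unit (hi x)
  hi-unit {x} u@(p , q) = subst (_≤ hi x) (+-idʳ 0r) (+-mono₂ (<⇒≤ 0<h) (proj₁ (lo-unit u)))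
                    , subst (hi x <_) (trans (cong (h +_) h≡h*1) h+h) (+-monoˡ-< h (h*-mono-< q))

  lo<hi : ∀ {x y} → Unit x → Unit y → lo x < hi y
  lo<hi {x} {y} (_ , q) u = <-≤-trans (subst (lo x <_) h≡h*1 (h*-mono-< q))
    (subst (_≤ hi y) (+-idʳ h) (+-monoˡ h (proj₁ (lo-unit u))))

  digit : ℕ → ℝ → ℝ
  digit zero    x = lo x
  digit (suc k) x = hi (digit k x)

  digit-unit : ∀ k {x} → Unit x → Unit (digit k x)
  digit-unit zero    u = lo-unit u
  digit-unit (suc k) u = hi-unit (digit-unit k u)

  digit-< : ∀ {k l x y} → k <ℕ l → Unit x → Unit y → digit k x < digit l y
  digit-< {zero}  {suc l} _ u v = lo<hi u (digit-unit l v)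
  digit-< {suc k} {suc l} (s≤s p) u v = +-monoˡ-< h (h*-mono-< (digit-< p u v))

  digit-mono : ∀ k {x y} → x < y → digit k x < digit k y
  digit-mono zero p = h*-mono-< p
  digit-mono (suc k) p = +-monoˡ-< h (h*-mono-< (digit-mono k p))

  -- The digit k is written in unary (k halvings upwards, then one downwards), so that
  -- lexicographically ordered lists get increasing heights in [0,1).
  height : List ℕ → ℝ
  height []      = 0r
  height (k ∷ l) = digit k (height l)

  height-unit : ∀ l → Unit (height l)
  height-unit []      = ≤-refl 0r , 0<1
  height-unit (k ∷ l) = digit-unit k (height-unit l)

  data _≺_ : List ℕ → List ℕ → Set where
    here  : ∀ {k l xs ys} → k <ℕ l → (k ∷ xs) ≺ (l ∷ ys)
    there : ∀ {k xs ys} → xs ≺ ys → (k ∷ xs) ≺ (k ∷ ys)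

  height-< : ∀ {xs ys} → xs ≺ ys → height xs < height ys
  height-< {_ ∷ xs} {_ ∷ ys} (here p)  = digit-< p (height-unit xs) (height-unit ys)
  height-< {k ∷ _} (there p) = digit-mono k (height-< p)

-- Boolean truth values, and subsets of ℕ as real numbers

Subset : Set
Subset = ℕ → Bool

module Truth (wlem : (P : Set) → ¬ P ⊎ ¬ ¬ P) where

  -- The value is `true` exactly if `P` cannot be refuted. Subsets and families built from it are
  -- stable under double negation, so proofs about them may argue classically whenever the goal is
  -- stable.
  truth : Set → Bool
  truth P with wlem P
  ... | inj₁ _ = false
  ... | inj₂ _ = true

  truth⁺ : ∀ {P} → ¬ ¬ P → truth P ≡ true
  truth⁺ {P} nnp with wlem P
  ... | inj₁ np = ⊥-elim (nnp np)
  ... | inj₂ _  = refl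

  truth⁻ : ∀ {P} → truth P ≡ true → ¬ ¬ P
  truth⁻ {P} e with wlem P
  ... | inj₂ nnp = nnp

module Encoding (R : CompleteOrderedField) where
  open OrderedField R
  open Truth wlem

  digit-mono-≤ : ∀ k {x y} → x ≤ y → digit k x ≤ digit k y
  digit-mono-≤ zero    p = ≤-lo p
    where
    ≤-lo : ∀ {x y} → x ≤ y → lo x ≤ lo y
    ≤-lo {x} {y} p with ≤-total (lo x) (lo y)
    ... | inj₁ r = r
    ... | inj₂ r = ≤-reflexive (cong lo (≤-antisym p (h*-cancel-≤ r)))
  digit-mono-≤ (suc k) p with ≤-total (digit (suc k) _) (digit (suc k) _)
  ... | inj₁ r = r
  ... | inj₂ r = ≤-reflexive (cong hi (≤-antisym (digit-mono-≤ k p)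
                   (h*-cancel-≤ (+-cancel-≤ h (subst₂ _≤_ (+-comm h _) (+-comm h _) r)))))

  bit : Bool → ℕ
  bit false = 0
  bit true  = 1

  prefix : ℕ → Subset → List ℕ
  prefix zero    f = []
  prefix (suc m) f = bit (f 0) ∷ prefix m (f ∘ suc)

  prefix-cong : ∀ m {f g} → f ≗ g → prefix m f ≡ prefix m g
  prefix-cong zero    e = refl
  prefix-cong (suc m) e = cong₂ (λ b l → bit b ∷ l) (e 0) (prefix-cong m (e ∘ suc))

  Approx : Subset → ℝ → Set
  Approx f x = ∃ λ m → x ≡ height (prefix m f)

  enc-sup : ∀ f → ∃ λ s → (∀ x → Approx f x → x ≤ s) × (∀ b → (∀ x → Approx f x → x ≤ b) → s ≤ b)
  enc-sup f = sup (Approx f) (0r , 0 , refl) (1r , λ { x (m , refl) → <⇒≤ (proj₂ (height-unit (prefix m f))) })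

  enc : Subset → ℝ
  enc f = proj₁ (enc-sup f)

  prefix≤enc : ∀ m f → height (prefix m f) ≤ enc f
  prefix≤enc m f = proj₁ (proj₂ (enc-sup f)) _ (m , refl)

  enc≤ : ∀ f b → (∀ m → height (prefix m f) ≤ b) → enc f ≤ b
  enc≤ f b p = proj₂ (proj₂ (enc-sup f)) b λ { x (m , refl) → p m }

  -- Real numbers, unlike functions, are extensional: this is the point of encoding subsets by reals.
  enc-cong : ∀ {f g} → f ≗ g → enc f ≡ enc g
  enc-cong {f} {g} e = ≤-antisym
    (enc≤ f _ λ m → subst (λ l → height l ≤ enc g) (sym (prefix-cong m e)) (prefix≤enc m g))
    (enc≤ g _ λ m → subst (λ l → height l ≤ enc f) (prefix-cong m e) (prefix≤enc m f))

  -- The digit 2 occurs in no `prefix`. Placed after the digit 0 it exceeds every continuation by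
  -- bits, while the leading 0 keeps the list below the digit 1. The gap between subsets without and
  -- with `m` therefore survives the passage to the supremum.
  cut : ℕ → Subset → List ℕ
  cut zero    f = 0 ∷ 2 ∷ []
  cut (suc m) f = bit (f 0) ∷ cut m (f ∘ suc)

  prefix≤cut : ∀ m M f → f m ≡ false → height (prefix M f) ≤ height (cut m f)
  prefix≤cut m zero f e = proj₁ (height-unit (cut m f))
  prefix≤cut zero (suc M) f e rewrite e = digit-mono-≤ 0 (tail≤ M (f ∘ suc))
    where
    bit<2 : ∀ b → bit b <ℕ 2
    bit<2 false = s≤s z≤n
    bit<2 true  = s≤s (s≤s z≤n)
    tail≤ : ∀ M f → height (prefix M f) ≤ height (2 ∷ [])
    tail≤ zero    f = proj₁ (height-unit (2 ∷ []))
    tail≤ (suc M) f = <⇒≤ (height-< {prefix (suc M) f} {2 ∷ []} (here (bit<2 (f 0))))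
  prefix≤cut (suc m) (suc M) f e = digit-mono-≤ (bit (f 0)) (prefix≤cut m M (f ∘ suc) e)

  cut≺prefix : ∀ m f g → (∀ i → i <ℕ m → f i ≡ g i) → g m ≡ true → cut m f ≺ prefix (suc m) g
  cut≺prefix zero f g a e rewrite e = here (s≤s z≤n)
  cut≺prefix (suc m) f g a e rewrite a 0 (s≤s z≤n) = there (cut≺prefix m (f ∘ suc) (g ∘ suc) (λ i i<m → a (suc i) (s≤s i<m)) e)

  first-difference-< : ∀ m f g → (∀ i → i <ℕ m → f i ≡ g i) → f m ≡ false → g m ≡ true → enc f ≢ enc g
  first-difference-< m f g a p q e =
    <-≤-trans (≤-<-trans (enc≤ f _ λ M → prefix≤cut m M f p) (height-< (cut≺prefix m f g a q))) (prefix≤enc (suc m) g) (≤-reflexive (sym e))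

  agree-upto : ∀ f g → enc f ≡ enc g → ∀ m i → i <ℕ m → f i ≡ g i
  agree-upto f g e (suc m) i (s≤s i≤m) with <ℕ-cmp i m
  ... | tri< i<m _ _ = agree-upto f g e m i i<m
  ... | tri> _ _ m<i = ⊥-elim (1+n≰n (≤ℕ-trans m<i i≤m))
    where open import Data.Nat.Properties using (1+n≰n) renaming (≤-trans to ≤ℕ-trans)
  ... | tri≈ _ refl _ with f i in p | g i in q
  ...   | true  | true  = refl
  ...   | false | false = refl
  ...   | false | true  = ⊥-elim (first-difference-< i f g (agree-upto f g e i) p q e)
  ...   | true  | false = ⊥-elim (first-difference-< i g f (λ k k<i → sym (agree-upto f g e i k k<i)) q p (sym e))

  enc-injective : ∀ {f g} → enc f ≡ enc g → f ≗ g
  enc-injective {f} {g} e n = agree-upto f g e (suc n) n (s≤s (≤ℕ-refl))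
    where open import Data.Nat.Properties using () renaming (≤-refl to ≤ℕ-refl)

  -- A preimage under `enc` cannot be selected, but its bits can be read off: by injectivity all
  -- preimages of `r` agree at `n`, so the existence statement already decides the bit.
  dec : ℝ → Subset
  dec r n = truth (∃ λ f → enc f ≡ r × f n ≡ true)

  dec-enc : ∀ f → dec (enc f) ≗ f
  dec-enc f n with f n in e
  ... | true  = truth⁺ λ k → k (f , refl , e)
  ... | false with dec (enc f) n in d
  ...   | false = refl
  ...   | true  = ⊥-elim (truth⁻ d λ { (g , eq , gn) → contradict (trans (sym gn) (trans (enc-injective eq n) e)) })
    where
    contradict : true ≢ false
    contradict ()

  ≺-cmp : ∀ xs ys → length xs ≡ length ys → (xs ≺ ys) ⊎ (xs ≡ ys) ⊎ (ys ≺ xs)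
  ≺-cmp [] [] _ = inj₂ (inj₁ refl)
  ≺-cmp (x ∷ xs) (y ∷ ys) e with <ℕ-cmp x y
  ... | tri< x<y _ _ = inj₁ (here x<y)
  ... | tri> _ _ y<x = inj₂ (inj₂ (here y<x))
  ... | tri≈ _ refl _ with ≺-cmp xs ys (suc-injective e)
  ...   | inj₁ p = inj₁ (there p)
  ...   | inj₂ (inj₁ refl) = inj₂ (inj₁ refl)
  ...   | inj₂ (inj₂ p) = inj₂ (inj₂ (there p))

  height-injective : ∀ xs ys → length xs ≡ length ys → height xs ≡ height ys → xs ≡ ys
  height-injective xs ys l e with ≺-cmp xs ys l
  ... | inj₁ p = ⊥-elim (height-< p (≤-reflexive (sym e)))
  ... | inj₂ (inj₁ q) = q
  ... | inj₂ (inj₂ p) = ⊥-elim (height-< p (≤-reflexive e))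

-- A constructive form of Cantor's theorem

-- Zermelo's explicit counterexample to an injection of the subsets of ℕ into ℕ, for a whole
-- sequence N of maps: W is the union of the tower of iterates of Φ f = f ∪ {N i f}, and
-- B is the stage of the tower at which N j W enters.
module Tower (wlem : (P : Set) → ¬ P ⊎ ¬ ¬ P) (N : ℕ → Subset → ℕ)
             (N-ext : ∀ i {f g} → f ≗ g → N i f ≡ N i g) where

  open Truth wlem

  bool-stable : ∀ {b} → ¬ ¬ (b ≡ true) → b ≡ true
  bool-stable {b} = decidable-stable (b Bool.≟ true)

  infix 4 _⊆_
  _⊆_ : Subset → Subset → Set
  f ⊆ g = ∀ n → f n ≡ true → g n ≡ true

  ⊆-stable : ∀ {f g} → ¬ ¬ (f ⊆ g) → f ⊆ g
  ⊆-stable nn n e = bool-stable λ k → nn λ p → k (p n e)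

  ⊆-antisym : ∀ {f g} → f ⊆ g → g ⊆ f → f ≗ g
  ⊆-antisym {f} {g} p q n with f n in e | g n in d
  ... | true  | true  = refl
  ... | false | false = refl
  ... | true  | false = trans (sym (p n e)) d
  ... | false | true  = trans (sym e) (q n d)

  ⊆-trans : ∀ {f g k} → f ⊆ g → g ⊆ k → f ⊆ k
  ⊆-trans p q n e = q n (p n e)

  Φ : Subset → Subset
  Φ f n = truth (f n ≡ true ⊎ ∃ λ i → N i f ≡ n)

  Φ-infl : ∀ f → f ⊆ Φ f
  Φ-infl f n e = truth⁺ λ k → k (inj₁ e)

  Φ-cong : ∀ {f g} → f ⊆ g → g ⊆ f → Φ f ⊆ Φ g
  Φ-cong p q n e = truth⁺ λ k → truth⁻ e λ
    { (inj₁ fn) → k (inj₁ (p n fn))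
    ; (inj₂ (i , eq)) → k (inj₂ (i , trans (N-ext i (⊆-antisym q p)) eq)) }

  ⋃ : (Subset → Bool) → Subset
  ⋃ D n = truth (∃ λ f → D f ≡ true × f n ≡ true)

  ⋃-upper : ∀ D {f} → D f ≡ true → f ⊆ ⋃ D
  ⋃-upper D d n e = truth⁺ λ k → k (_ , d , e)

  ⋃-least : ∀ D g → (∀ f → D f ≡ true → f ⊆ g) → ⋃ D ⊆ g
  ⋃-least D g p n e = bool-stable λ k → truth⁻ e λ { (f , d , fn) → k (p f d n fn) }

  -- The smallest family closed under `Φ` and unions, as an intersection of families. Taking these
  -- Boolean keeps the impredicative definition in `Set` and makes membership stable.
  T : Subset → Set
  T t = (C : Subset → Bool) → (∀ f → C f ≡ true → C (Φ f) ≡ true) →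
        (∀ D → (∀ f → D f ≡ true → C f ≡ true) → C (⋃ D) ≡ true) → C t ≡ true

  T-stable : ∀ {t} → ¬ ¬ T t → T t
  T-stable nn C s u = bool-stable λ k → nn λ t → k (t C s u)

  T-Φ : ∀ {t} → T t → T (Φ t)
  T-Φ t C s u = s _ (t C s u)

  T-⋃ : ∀ D → (∀ f → D f ≡ true → T f) → T (⋃ D)
  T-⋃ D p C s u = u D λ f d → p f d C s u

  -- The predicate becomes a Boolean family by `truth`, hence the demand that `Q` be stable.
  -- Membership in `T` is carried along in that family, so that both steps may use it.
  T-ind : (Q : Subset → Set) → (∀ f → ¬ ¬ Q f → Q f) → (∀ f → T f → Q f → Q (Φ f)) →
          (∀ D → (∀ f → D f ≡ true → T f) → (∀ f → D f ≡ true → Q f) → Q (⋃ D)) → ∀ {t} → T t → Q t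
  T-ind Q st s u {t} tt = st t λ k → truth⁻ (tt C s′ u′) λ p → k (proj₂ p)
    where
    C : Subset → Bool
    C f = truth (T f × Q f)
    s′ : ∀ f → C f ≡ true → C (Φ f) ≡ true
    s′ f e = truth⁺ λ k → truth⁻ e λ { (a , b) → k (T-Φ a , s f a b) }
    u′ : ∀ D → (∀ f → D f ≡ true → C f ≡ true) → C (⋃ D) ≡ true
    u′ D p = truth⁺ λ k → k (T-⋃ D pT , u D pT λ f d → st f λ k → truth⁻ (p f d) (λ x → k (proj₂ x)))
      where
      pT : ∀ f → D f ≡ true → T f
      pT f d = T-stable λ k → truth⁻ (p f d) (λ x → k (proj₁ x))

  infixr 3 _∨_
  -- Weak disjunction suffices because comparability in the tower is only ever used to prove stable
  -- statements.
  _∨_ : Set → Set → Set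
  A ∨ B = ¬ (¬ A × ¬ B)

  ∨-elim : ∀ {A B X : Set} → (¬ ¬ X → X) → A ∨ B → (A → X) → (B → X) → X
  ∨-elim st o f g = st λ k → o ((λ a → k (f a)) , λ b → k (g b))

  ∨-stable : ∀ {A B} → ¬ ¬ (A ∨ B) → A ∨ B
  ∨-stable nn p = nn λ o → o p

  left : ∀ {A B} → A → A ∨ B
  left a (na , _) = na a

  right : ∀ {A B} → B → A ∨ B
  right b (_ , nb) = nb b

  -- The notion from Zermelo's proof of the well-ordering theorem. Together, `compare` and `extreme`
  -- show that the tower is a chain in which nothing lies strictly between a stage and its
  -- successor.
  Extreme : Subset → Set
  Extreme s = ∀ t → T t → t ⊆ s → s ⊆ t ∨ Φ t ⊆ s

  compare : ∀ {s} → Extreme s → ∀ {t} → T t → t ⊆ s ∨ Φ s ⊆ t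
  compare {s} ex = T-ind (λ t → t ⊆ s ∨ Φ s ⊆ t) (λ _ → ∨-stable) step union
    where
    step : ∀ t → T t → t ⊆ s ∨ Φ s ⊆ t → Φ t ⊆ s ∨ Φ s ⊆ Φ t
    step t tt o = ∨-elim ∨-stable o
      (λ p → ∨-elim ∨-stable (ex t tt p) (λ q → right (Φ-cong q p)) left)
      (λ p → right (⊆-trans p (Φ-infl t)))
    union : ∀ D → (∀ f → D f ≡ true → T f) → (∀ f → D f ≡ true → f ⊆ s ∨ Φ s ⊆ f) → ⋃ D ⊆ s ∨ Φ s ⊆ ⋃ D
    union D _ q (n₁ , n₂) = n₁ (⋃-least D s λ f d → ∨-elim ⊆-stable (q f d) (λ p → p)
                              (λ p → ⊥-elim (n₂ (⊆-trans p (⋃-upper D d)))))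

  extreme : ∀ {s} → T s → Extreme s
  extreme = T-ind Extreme (λ s nn t tt p → ∨-stable λ k → nn λ ex → k (ex t tt p)) step union
    where
    step : ∀ s → T s → Extreme s → Extreme (Φ s)
    step s ts ex t tt p = ∨-elim ∨-stable (compare ex tt)
      (λ q → ∨-elim ∨-stable (ex t tt q) (λ r → right (Φ-cong q r)) (λ r → right (⊆-trans r (Φ-infl s))))
      left
    union : ∀ D → (∀ f → D f ≡ true → T f) → (∀ f → D f ≡ true → Extreme f) → Extreme (⋃ D)
    union D dT q t tt p (n₁ , n₂) = n₁ (⋃-least D t λ d dd → ∨-elim ⊆-stable (compare (q d dd) tt)
      (λ t⊆d → ∨-elim ⊆-stable (q d dd t tt t⊆d) (λ r → r) (λ r → ⊥-elim (n₂ (⊆-trans r (⋃-upper D dd)))))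
      (λ r → ⊆-trans (Φ-infl d) r))

  W : Subset
  W = ⋃ λ f → truth (T f)

  T-W : T W
  T-W = T-⋃ _ λ f e → T-stable (truth⁻ e)

  N-W : ∀ j → W (N j W) ≡ true
  N-W j = ⋃-upper (λ f → truth (T f)) (truth⁺ λ k → k (T-Φ T-W)) _ (truth⁺ λ k → k (inj₂ (j , refl)))

  module Stage (j : ℕ) where
    x : ℕ
    x = N j W

    D : Subset → Bool
    D f = truth (T f × f x ≡ false)

    B : Subset
    B = ⋃ D

    T-B : T B
    T-B = T-⋃ D λ f e → T-stable λ k → truth⁻ e (λ p → k (proj₁ p))

    B-x : B x ≡ false
    B-x with B x in e
    ... | false = refl
    ... | true  = ⊥-elim (truth⁻ e λ { (f , d , fx) → truth⁻ d λ p → clash (trans (sym fx) (proj₂ p)) })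
      where
      clash : true ≢ false
      clash ()

    -- If no `N i` produced `x` at the stage `B`, then `Φ B` would still lack `x` and so be
    -- contained in `B`. A stage closed under `Φ` contains the whole tower by comparability, hence
    -- also `W`, which has `x` as an element.
    entered : ¬ ¬ (∃ λ i → N i B ≡ x)
    entered k = Bx≢true (proj₁ big x (N-W j))
      where
      Bx≢true : B x ≢ true
      Bx≢true e with trans (sym e) B-x
      ... | ()
      ΦBx : Φ B x ≡ false
      ΦBx with Φ B x in e
      ... | false = refl
      ... | true  = ⊥-elim (truth⁻ e λ { (inj₁ p) → Bx≢true p ; (inj₂ p) → k p })
      ΦB⊆B : Φ B ⊆ B
      ΦB⊆B = ⋃-upper D (truth⁺ λ k → k (T-Φ T-B , ΦBx))
      below : ∀ {t} → T t → t ⊆ B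
      below = T-ind (_⊆ B) (λ _ → ⊆-stable)
        (λ t tt p → ∨-elim ⊆-stable (extreme T-B t tt p) (λ q → ⊆-trans (Φ-cong p q) ΦB⊆B) (λ q → q))
        (λ D _ q → ⋃-least D B q)
      big : (W ⊆ B) × (B ⊆ B)
      big = below T-W , λ n e → e

-- Levelled drawings

module Geometry (R : CompleteOrderedField) where
  open import Data.Fin using (Fin; zero; suc)
  open OrderedField R
  open Encoding R
  open Plane R

  ν : ℕ → ℝ
  ν zero    = 0r
  ν (suc c) = ν c + 1r

  ν-step : ∀ c → ν c < ν (suc c)
  ν-step c = subst (_< ν c + 1r) (+-idʳ (ν c)) (+-monoˡ-< (ν c) 0<1)

  ν-mono : ∀ {c d} → c ≤ℕ d → ν c ≤ ν d
  ν-mono {c} {zero}  z≤n = ≤-refl _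
  ν-mono {c} {suc d} p with ≤ℕ⇒<∨≡ p
  ... | inj₁ (s≤s q) = ≤-trans (ν-mono q) (<⇒≤ (ν-step d))
  ... | inj₂ refl    = ≤-refl _

  ν-< : ∀ {c d} → c <ℕ d → ν c < ν d
  ν-< {c} p = <-≤-trans (ν-step c) (ν-mono p)

  ν-injective : ∀ {c d} → ν c ≡ ν d → c ≡ d
  ν-injective {c} {d} e with <ℕ-cmp c d
  ... | tri< p _ _ = ⊥-elim (ν-< p (≤-reflexive (sym e)))
  ... | tri≈ _ q _ = q
  ... | tri> _ _ p = ⊥-elim (ν-< p (≤-reflexive e))

  -- Points of the segment in the form s a + t b with s + t = 1, s, t ≥ 0.
  record Convex (t a b x : ℝ) : Set where
    field
      s     : ℝ
      0≤s   : 0r ≤ s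
      s+t   : s + t ≡ 1r
      value : x ≡ s * a + t * b

  convex : ∀ {t a b x} → t ≤ 1r → x ≡ a + t * (b -ᵣ a) → Convex t a b x
  convex {t} {a} {b} {x} t≤1 e = record
    { s = s ; 0≤s = gap-nonneg (proj₂ (gap t 1r)) t≤1 ; s+t = s+t ; value = trans e (sym eq) }
    where
    s : ℝ
    s = proj₁ (gap t 1r)
    s+t : s + t ≡ 1r
    s+t = trans (+-comm s t) (proj₂ (gap t 1r))
    a+u : a + (b -ᵣ a) ≡ b
    a+u = trans (cong (a +_) (+-comm b (- a))) (trans (sym (+-assoc a (- a) b)) (trans (cong (_+ b) (+-invʳ a)) (+-idˡ b)))
    eq : s * a + t * b ≡ a + t * (b -ᵣ a)
    eq = trans (cong (λ z → s * a + t * z) (sym a+u))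
        (trans (solve 4 (λ s t a u → s :* a :+ t :* (a :+ u) := (s :+ t) :* a :+ t :* u) refl s t a (b -ᵣ a))
        (cong (_+ t * (b -ᵣ a)) (trans (cong (_* a) s+t) (trans (*-comm 1r a) (*-idʳ a)))))

  sum-zero : ∀ {x y} → 0r ≤ x → 0r ≤ y → x + y ≡ 0r → x ≡ 0r × y ≡ 0r
  sum-zero {x} {y} p q e =
    ≤-antisym (≤-trans (subst (_≤ x + y) (+-idʳ x) (+-monoˡ x q)) (≤-reflexive e)) p ,
    ≤-antisym (≤-trans (subst (_≤ x + y) (+-idˡ y) (+-mono y p)) (≤-reflexive e)) q

  product-zero : ∀ {x d} → d ≢ 0r → x * d ≡ 0r → x ≡ 0r
  product-zero {x} {d} nz e with *-inv d nz
  ... | i , di = trans (sym (*-idʳ x)) (trans (cong (x *_) (sym di))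
                 (trans (sym (*-assoc x d i)) (trans (cong (_* i) e) (zeroˡ i))))

  -- Subtracting the two representations of `x` gives `s * d + t * e ≡ 0r` with nonnegative
  -- summands, where `d` and `e` are the gaps at the two ends. Both summands vanish, so a positive
  -- gap forces its coefficient to be zero.
  convex-compare : ∀ {t a b a′ b′ x} → 0r ≤ t → Convex t a b x → Convex t a′ b′ x → a ≤ a′ → b ≤ b′ →
                   (a < a′ → t ≡ 1r) × (b < b′ → t ≡ 0r)
  convex-compare {t} {a} {b} {a′} {b′} {x} 0≤t C C′ p q =
    (λ lt → trans (sym (+-idˡ t)) (trans (cong (_+ t) (sym (product-zero (nonzero lt (proj₂ ga)) (proj₁ zeros)))) C.s+t)) ,
    (λ lt → product-zero (nonzero lt (proj₂ gb)) (proj₂ zeros))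
    where
    module C = Convex C
    module C′ = Convex C′
    ga : Σ ℝ λ d → a + d ≡ a′
    ga = gap a a′
    gb : Σ ℝ λ e → b + e ≡ b′
    gb = gap b b′
    d e : ℝ
    d = proj₁ ga
    e = proj₁ gb
    s≡ : C′.s ≡ C.s
    s≡ = +-cancelʳ _ _ t (trans C′.s+t (sym C.s+t))
    sum≡0 : C.s * d + t * e ≡ 0r
    sum≡0 = +-cancelʳ _ _ x (trans (+-comm _ x) (trans
      (cong (_+ (C.s * d + t * e)) C.value)
      (trans (solve 6 (λ s t a b d e → (s :* a :+ t :* b) :+ (s :* d :+ t :* e) := s :* (a :+ d) :+ t :* (b :+ e)) refl C.s t a b d e)
      (trans (cong₂ (λ u v → C.s * u + t * v) (proj₂ ga) (proj₂ gb))
      (trans (cong (λ s → s * a′ + t * b′) (sym s≡)) (trans (sym C′.value) (sym (+-idˡ x))))))))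
    zeros : C.s * d ≡ 0r × t * e ≡ 0r
    zeros = sum-zero (*-pos C.0≤s (gap-nonneg (proj₂ ga) p)) (*-pos 0≤t (gap-nonneg (proj₂ gb) q)) sum≡0
    nonzero : ∀ {u v w} → u < v → u + w ≡ v → w ≢ 0r
    nonzero {u} lt eq refl = lt (≤-reflexive (trans (sym eq) (+-idʳ u)))

  onSeg-start : ∀ {a b t x} → x ≡ a + t * (b -ᵣ a) → t ≡ 0r → x ≡ a
  onSeg-start {a} {b} e refl = trans e (trans (cong (a +_) (zeroˡ _)) (+-idʳ a))

  onSeg-end : ∀ {a b t x} → x ≡ a + t * (b -ᵣ a) → t ≡ 1r → x ≡ b
  onSeg-end {a} {b} e refl = trans e (trans (cong (a +_) (trans (*-comm 1r _) (*-idʳ _)))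
    (trans (cong (a +_) (+-comm b (- a))) (trans (sym (+-assoc a (- a) b)) (trans (cong (_+ b) (+-invʳ a)) (+-idˡ b)))))

  onSeg-swap : ∀ P Q x → OnSeg P Q x → OnSeg Q P x
  onSeg-swap (a₁ , a₂) (b₁ , b₂) (x₁ , x₂) (t , 0≤t , t≤1 , e₁ , e₂) =
    C.s , C.0≤s , subst (C.s ≤_) C.s+t (subst (_≤ C.s + t) (+-idʳ C.s) (+-monoˡ C.s 0≤t)) , flip e₁ , flip e₂
    where
    module C = Convex (convex t≤1 e₁)
    flip : ∀ {a b x} → x ≡ a + t * (b -ᵣ a) → x ≡ b + C.s * (a -ᵣ b)
    flip {a} {b} {x} e = trans (Convex.value (convex t≤1 e)) (trans (cong₂ (λ s u → s * u + t * b) s≡ (sym b+u))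
      (trans (solve 4 (λ s t b u → s :* (b :+ u) :+ t :* b := (s :+ t) :* b :+ s :* u) refl C.s t b (a -ᵣ b))
      (cong (_+ C.s * (a -ᵣ b)) (trans (cong (_* b) C.s+t) (trans (*-comm 1r b) (*-idʳ b))))))
      where
      s≡ : Convex.s (convex t≤1 e) ≡ C.s
      s≡ = +-cancelʳ _ _ t (trans (Convex.s+t (convex t≤1 e)) (sym C.s+t))
      b+u : b + (a -ᵣ b) ≡ a
      b+u = trans (cong (b +_) (+-comm a (- b))) (trans (sym (+-assoc b (- b) a)) (trans (cong (_+ a) (+-invʳ b)) (+-idˡ a)))

  segment : ∀ {p q} → p ≢ q → PolyArc p q
  segment {p} {q} ne = record
    { n = 0 ; pts = pts ; start = refl ; end = refl
    ; nondeg = λ { zero → ne }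
    ; consec = λ { zero zero () }
    ; apart = λ { zero zero neq → ⊥-elim (neq refl) } }
    where
    pts : Fin 2 → Point
    pts zero    = p
    pts (suc _) = q

  -- A graph whose vertices sit on the vertical lines x = 0, 1, 2, … and whose edges join
  -- consecutive lines monotonically is plane.
  module Levelled (X : Set) (line : X → ℕ) (key : X → List ℕ) (E : X → X → Set)
    (E-line : ∀ {u v} → E u v → line v ≡ suc (line u))
    (key-length : ∀ u v → line u ≡ line v → length (key u) ≡ length (key v))
    (key-inj : ∀ {u v} → line u ≡ line v → key u ≡ key v → u ≡ v)
    (noncrossing : ∀ {u v u′ v′} → E u v → E u′ v′ → line u ≡ line u′ → key u ≺ key u′ → ¬ (key v′ ≺ key v))
    where

    pos : X → Point
    pos u = ν (line u) , height (key u)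

    pos-injective : Injective _≡_ _≡_ pos
    pos-injective {u} {v} e with ν-injective (cong proj₁ e)
    ... | l = key-inj l (height-injective (key u) (key v) (key-length u v l) (cong proj₂ e))

    Adjacent : X → X → Set
    Adjacent u v = E u v ⊎ E v u

    E-distinct : ∀ {u v} → E u v → pos u ≢ pos v
    E-distinct {u} e p = ν-step (line u) (≤-reflexive (trans (cong ν (sym (E-line e))) (sym (cong proj₁ p))))

    module _ {u v x₁ x₂} (e : E u v) (on : OnSeg (pos u) (pos v) (x₁ , x₂)) where
      param : ℝ
      param = proj₁ on

      0≤param : 0r ≤ param
      0≤param = proj₁ (proj₂ on)

      param≤1 : param ≤ 1r
      param≤1 = proj₁ (proj₂ (proj₂ on))

      abscissa : x₁ ≡ ν (line u) + param
      abscissa = trans (proj₁ (proj₂ (proj₂ (proj₂ on)))) (cong (ν (line u) +_)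
        (trans (cong (param *_) step) (*-idʳ param)))
        where
        step : ν (line v) -ᵣ ν (line u) ≡ 1r
        step = trans (cong (λ c → ν c -ᵣ ν (line u)) (E-line e))
               (trans (cong (_+ (- ν (line u))) (+-comm (ν (line u)) 1r))
               (trans (+-assoc 1r _ _) (trans (cong (1r +_) (+-invʳ _)) (+-idʳ 1r))))

      at-start : param ≡ 0r → (x₁ , x₂) ≡ pos u
      at-start p = cong₂ _,_ (onSeg-start (proj₁ (proj₂ (proj₂ (proj₂ on)))) p) (onSeg-start (proj₂ (proj₂ (proj₂ (proj₂ on)))) p)

      at-end : param ≡ 1r → (x₁ , x₂) ≡ pos v
      at-end p = cong₂ _,_ (onSeg-end (proj₁ (proj₂ (proj₂ (proj₂ on)))) p) (onSeg-end (proj₂ (proj₂ (proj₂ (proj₂ on)))) p)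

      ordinate : Convex param (height (key u)) (height (key v)) x₂
      ordinate = convex param≤1 (proj₂ (proj₂ (proj₂ (proj₂ on))))

    Ends : X → X → Point → Set
    Ends u v x = x ≡ pos u ⊎ x ≡ pos v

    consecutive : ∀ {u v u′ v′} x → E u v → E u′ v′ → line u <ℕ line u′ →
                  OnSeg (pos u) (pos v) x → OnSeg (pos u′) (pos v′) x → x ≡ pos v × x ≡ pos u′
    consecutive {u} {v} {u′} {v′} (x₁ , x₂) e e′ lt on on′ with ≤ℕ⇒<∨≡ lt
    ... | inj₁ far = ⊥-elim (ν-< far (≤-trans (subst (ν (line u′) ≤_) (sym (abscissa e′ on′)) (subst (_≤ ν (line u′) + param e′ on′) (+-idʳ _) (+-monoˡ _ (0≤param e′ on′))))
                         (≤-trans (≤-reflexive (abscissa e on)) (+-monoˡ _ (param≤1 e on)))))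
    ... | inj₂ next = at-end e on t≡1 , at-start e′ on′ t′≡0
      where
      t t′ : ℝ
      t  = param e on
      t′ = param e′ on′
      t≡1+t′ : t ≡ 1r + t′
      t≡1+t′ = +-cancelʳ _ _ (ν (line u)) (trans (+-comm t _) (trans (sym (abscissa e on)) (trans (abscissa e′ on′)
        (trans (cong (λ c → ν c + t′) (sym next)) (trans (+-assoc _ _ _) (+-comm (ν (line u)) _))))))
      t′≡0 : t′ ≡ 0r
      t′≡0 = ≤-antisym (+-cancel-≤ 1r (subst₂ _≤_ (trans t≡1+t′ (+-comm 1r t′)) (sym (+-idˡ 1r)) (param≤1 e on))) (0≤param e′ on′)
      t≡1 : t ≡ 1r
      t≡1 = trans t≡1+t′ (trans (cong (1r +_) t′≡0) (+-idʳ 1r))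

    -- Edges between different pairs of lines share at most a vertical line. Between the same two
    -- lines, the abscissa forces equal parameters; then `noncrossing` makes the gaps at both ends
    -- point the same way, and a common point lies at an end.
    crossing : ∀ {u v u′ v′} x → E u v → E u′ v′ → OnSeg (pos u) (pos v) x → OnSeg (pos u′) (pos v′) x →
               (u ≡ u′ × v ≡ v′) ⊎ (Ends u v x × Ends u′ v′ x)
    crossing {u} {v} {u′} {v′} x e e′ on on′ with <ℕ-cmp (line u) (line u′)
    ... | tri< lt _ _ with consecutive x e e′ lt on on′
    ...   | p , q = inj₂ (inj₂ p , inj₁ q)
    crossing {u} {v} {u′} {v′} x e e′ on on′ | tri> _ _ gt with consecutive x e′ e gt on′ on
    ...   | p , q = inj₂ (inj₁ q , inj₂ p)
    crossing {u} {v} {u′} {v′} x@(x₁ , x₂) e e′ on on′ | tri≈ _ same _ =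
      decide (≺-cmp (key u) (key u′) (key-length u u′ same)) (≺-cmp (key v) (key v′) (key-length v v′ same′))
      where
      same′ : line v ≡ line v′
      same′ = trans (E-line e) (trans (cong suc same) (sym (E-line e′)))
      t t′ : ℝ
      t  = param e on
      t′ = param e′ on′
      t≡ : t ≡ t′
      t≡ = +-cancelʳ _ _ (ν (line u)) (trans (+-comm t _) (trans (sym (abscissa e on)) (trans (abscissa e′ on′) (trans (cong (λ c → ν c + t′) (sym same)) (+-comm _ t′)))))
      C′ : Convex t (height (key u′)) (height (key v′)) x₂
      C′ = subst (λ r → Convex r _ _ _) (sym t≡) (ordinate e′ on′)
      start : t ≡ 0r → Ends u v x × Ends u′ v′ x
      start p = inj₁ (at-start e on p) , inj₁ (at-start e′ on′ (trans (sym t≡) p))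
      end : t ≡ 1r → Ends u v x × Ends u′ v′ x
      end p = inj₂ (at-end e on p) , inj₂ (at-end e′ on′ (trans (sym t≡) p))
      up : height (key u) ≤ height (key u′) → height (key v) ≤ height (key v′) →
           (height (key u) < height (key u′) → t ≡ 1r) × (height (key v) < height (key v′) → t ≡ 0r)
      up = convex-compare (0≤param e on) (ordinate e on) C′
      down : height (key u′) ≤ height (key u) → height (key v′) ≤ height (key v) →
           (height (key u′) < height (key u) → t ≡ 1r) × (height (key v′) < height (key v) → t ≡ 0r)
      down = convex-compare (0≤param e on) C′ (ordinate e on)
      decide : (key u ≺ key u′) ⊎ (key u ≡ key u′) ⊎ (key u′ ≺ key u) → (key v ≺ key v′) ⊎ (key v ≡ key v′) ⊎ (key v′ ≺ key v) →
               (u ≡ u′ × v ≡ v′) ⊎ (Ends u v x × Ends u′ v′ x)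
      decide (inj₂ (inj₁ p)) (inj₂ (inj₁ q)) = inj₁ (key-inj same p , key-inj same′ q)
      decide (inj₁ p) (inj₁ q) = inj₂ (end (proj₁ (up (<⇒≤ (height-< p)) (<⇒≤ (height-< q))) (height-< p)))
      decide (inj₁ p) (inj₂ (inj₁ q)) = inj₂ (end (proj₁ (up (<⇒≤ (height-< p)) (≤-reflexive (cong height q))) (height-< p)))
      decide (inj₁ p) (inj₂ (inj₂ q)) = ⊥-elim (noncrossing e e′ same p q)
      decide (inj₂ (inj₁ p)) (inj₁ q) = inj₂ (start (proj₂ (up (≤-reflexive (cong height p)) (<⇒≤ (height-< q))) (height-< q)))
      decide (inj₂ (inj₁ p)) (inj₂ (inj₂ q)) = inj₂ (start (proj₂ (down (≤-reflexive (cong height (sym p))) (<⇒≤ (height-< q))) (height-< q)))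
      decide (inj₂ (inj₂ p)) (inj₁ q) = ⊥-elim (noncrossing e′ e (sym same) p q)
      decide (inj₂ (inj₂ p)) (inj₂ (inj₁ q)) = inj₂ (end (proj₁ (down (<⇒≤ (height-< p)) (≤-reflexive (cong height (sym q)))) (height-< p)))
      decide (inj₂ (inj₂ p)) (inj₂ (inj₂ q)) = inj₂ (end (proj₁ (down (<⇒≤ (height-< p)) (<⇒≤ (height-< q))) (height-< p)))

    vertex-on : ∀ {u v} w → E u v → OnSeg (pos u) (pos v) (pos w) → w ≡ u ⊎ w ≡ v
    vertex-on {u} {v} w e on with <ℕ-cmp (line w) (line u)
    ... | tri< lt _ _ = ⊥-elim (ν-< lt (subst (ν (line u) ≤_) (sym (abscissa e on)) (subst (_≤ ν (line u) + param e on) (+-idʳ _) (+-monoˡ _ (0≤param e on)))))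
    ... | tri≈ _ eq _ = inj₁ (pos-injective (at-start e on
            (+-cancelʳ _ _ (ν (line u)) (trans (+-comm _ (ν (line u))) (trans (sym (abscissa e on)) (trans (cong ν eq) (sym (+-idˡ _))))))))
    ... | tri> _ _ gt with ≤ℕ⇒<∨≡ gt
    ...   | inj₁ far = ⊥-elim (ν-< far (≤-trans (≤-reflexive (abscissa e on)) (+-monoˡ _ (param≤1 e on))))
    ...   | inj₂ next = inj₂ (pos-injective (at-end e on
            (+-cancelʳ _ _ (ν (line u)) (trans (+-comm _ (ν (line u))) (trans (sym (abscissa e on)) (trans (cong ν (sym next)) (+-comm (ν (line u)) 1r)))))))

    arc : ∀ u v → Adjacent u v → PolyArc (pos u) (pos v)
    arc u v (inj₁ e) = segment (E-distinct e)
    arc u v (inj₂ e) = segment (λ p → E-distinct e (sym p))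

    onArc : ∀ {u v} (a : Adjacent u v) {x} → OnArc (arc u v a) x → OnSeg (pos u) (pos v) x
    onArc (inj₁ e) (zero , on) = on
    onArc (inj₂ e) (zero , on) = on

    onArc⁻ : ∀ {u v} (a : Adjacent u v) {x} → OnSeg (pos u) (pos v) x → OnArc (arc u v a) x
    onArc⁻ (inj₁ e) on = zero , on
    onArc⁻ (inj₂ e) on = zero , on

    disjoint : ∀ u v u′ v′ (a : Adjacent u v) (a′ : Adjacent u′ v′) → ¬ (u ≡ u′ × v ≡ v′) → ¬ (u ≡ v′ × v ≡ u′) →
               ∀ x → OnSeg (pos u) (pos v) x → OnSeg (pos u′) (pos v′) x → Ends u v x × Ends u′ v′ x
    disjoint u v u′ v′ (inj₁ e) (inj₁ e′) n₁ n₂ x on on′ =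
      Sum.[ (λ p → ⊥-elim (n₁ p)) , (λ p → p) ]′ (crossing {u} {v} {u′} {v′} x e e′ on on′)
    disjoint u v u′ v′ (inj₁ e) (inj₂ e′) n₁ n₂ x on on′ =
      Sum.[ (λ p → ⊥-elim (n₂ p)) , (λ p → proj₁ p , Sum.swap (proj₂ p)) ]′
        (crossing {u} {v} {v′} {u′} x e e′ on (onSeg-swap (pos u′) (pos v′) x on′))
    disjoint u v u′ v′ (inj₂ e) (inj₁ e′) n₁ n₂ x on on′ =
      Sum.[ (λ p → ⊥-elim (n₂ (swap p))) , (λ p → Sum.swap (proj₁ p) , proj₂ p) ]′
        (crossing {v} {u} {u′} {v′} x e e′ (onSeg-swap (pos u) (pos v) x on) on′)
    disjoint u v u′ v′ (inj₂ e) (inj₂ e′) n₁ n₂ x on on′ =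
      Sum.[ (λ p → ⊥-elim (n₁ (swap p))) , (λ p → Sum.swap (proj₁ p) , Sum.swap (proj₂ p)) ]′
        (crossing {v} {u} {v′} {u′} x e e′ (onSeg-swap (pos u) (pos v) x on) (onSeg-swap (pos u′) (pos v′) x on′))

    avoid : ∀ {u v} (a : Adjacent u v) w → OnSeg (pos u) (pos v) (pos w) → w ≡ u ⊎ w ≡ v
    avoid (inj₁ e) w on = vertex-on w e on
    avoid (inj₂ e) w on = Sum.swap (vertex-on w e (onSeg-swap _ _ _ on))

    graph : Graph
    graph = record
      { V = X ; Adj = Adjacent ; sym = Sum.swap
      ; irrefl = λ { (inj₁ e) → E-distinct e refl ; (inj₂ e) → E-distinct e refl } }

    planar : Planar graph
    planar = record
      { pos = pos ; pos-inj = pos-injective ; arc = arc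
      ; coherent = λ u v a a′ x on → onArc⁻ a′ (onSeg-swap _ _ x (onArc a on))
      ; disjoint = λ u v u′ v′ a a′ n₁ n₂ x on on′ → disjoint u v u′ v′ a a′ n₁ n₂ x (onArc a on) (onArc a′ on′)
      ; avoid = λ u v a w on → avoid a w (onArc a on) }

open import Data.Nat using (_+_; _*_; _∸_; _≤_; _<_; _<?_; _≤?_)
import Data.Nat as ℕ
open import Data.Nat.Properties hiding (suc-injective)
open import Data.Nat.DivMod using (_/_; /-monoˡ-≤; m*n/n≡m; +-distrib-/-∣ʳ; m<n⇒m/n≡0)
open import Data.Nat.Divisibility using (divides-refl)
open import Data.Nat.Solver using (module +-*-Solver)
open import Data.Maybe using (Maybe; just; nothing)
open import Data.Maybe.Properties using (just-injective)
open import Data.List using (_++_; map; reverse; upTo; cartesianProduct; cartesianProductWith; filter)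
open import Data.List.Properties using (unfold-reverse; reverse-involutive; ++-assoc; ++-identityʳ; length-++; length-map; map-++; ∷-injective; ≡-dec)
open import Data.List.Membership.Propositional using (_∈_; _∉_)
open import Data.List.Membership.Propositional.Properties using (∈-++⁺ˡ; ∈-++⁺ʳ; ∈-++⁻; ∈-map⁺; ∈-map⁻; ∈-upTo⁺; ∈-upTo⁻; ∈-cartesianProduct⁺; ∈-cartesianProduct⁻; ∈-cartesianProductWith⁺; ∈-filter⁺; ∈-filter⁻; ∈-∃++)
open import Data.List.Relation.Unary.Any using (here; there; any?)
open import Data.List.Relation.Unary.Any.Properties using (reverse⁺; reverse⁻)
open import Data.List.Relation.Unary.All using (All; []; _∷_; tabulate)
import Data.List.Relation.Unary.All as All
open import Data.List.Relation.Unary.All.Properties using (¬Any⇒All¬; All¬⇒¬Any)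
open import Data.List.Relation.Unary.AllPairs using ([]; _∷_)
open import Data.List.Relation.Unary.Linked using (Linked; [-]; _∷_)
open import Data.List.Relation.Unary.Unique.Propositional using (Unique)
import Data.List.Relation.Unary.Unique.Propositional.Properties as Uniq
open import Data.List.Relation.Binary.Permutation.Propositional using (_↭_; ↭-sym; ↭-trans; ↭-refl; ↭-reflexive; prep) renaming (swap to ↭-swap)
open import Data.List.Relation.Binary.Permutation.Propositional.Properties using (∈-resp-↭; drop-mid; ↭-length; ∷↭∷ʳ; ++⁺ˡ) renaming (shift to ↭-shift)
open import Data.Unit using (⊤; tt)

-- The host graphs

-- This is the number 2^x (2y + 1). It is never 0, which leaves 0 as the code of the empty list.
pair : ℕ → ℕ → ℕ
pair zero    y = suc (y + y)
pair (suc x) y = pair x y + pair x y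

double-injective : ∀ x y → x + x ≡ y + y → x ≡ y
double-injective zero    zero    e = refl
double-injective (suc x) (suc y) e = cong suc (double-injective x y
  (suc-injective (trans (sym (+-suc x x)) (trans (suc-injective e) (+-suc y y)))))

double≢suc-double : ∀ x y → x + x ≢ suc (y + y)
double≢suc-double (suc x) zero e with trans (sym (+-suc x x)) (suc-injective e)
... | ()
double≢suc-double (suc x) (suc y) e = double≢suc-double x y (suc-injective (trans (sym (+-suc x x)) (trans (suc-injective e) (cong suc (+-suc y y)))))

pair-injective : ∀ x y x′ y′ → pair x y ≡ pair x′ y′ → x ≡ x′ × y ≡ y′
pair-injective zero y zero y′ e = refl , double-injective y y′ (suc-injective e)
pair-injective zero y (suc x′) y′ e = ⊥-elim (double≢suc-double (pair x′ y′) y (sym e))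
pair-injective (suc x) y zero y′ e = ⊥-elim (double≢suc-double (pair x y) y′ e)
pair-injective (suc x) y (suc x′) y′ e with pair-injective x y x′ y′ (double-injective _ _ e)
... | refl , q = refl , q

code : List ℕ → ℕ
code []      = 0
code (x ∷ l) = pair x (code l)

pair≢0 : ∀ x y → pair x y ≢ 0
pair≢0 (suc x) y e = pair≢0 x y (m+n≡0⇒m≡0 (pair x y) e)

code-injective : Injective _≡_ _≡_ code
code-injective {[]} {[]} e = refl
code-injective {[]} {y ∷ ys} e = ⊥-elim (pair≢0 y (code ys) (sym e))
code-injective {x ∷ xs} {[]} e = ⊥-elim (pair≢0 x (code xs) e)
code-injective {x ∷ xs} {y ∷ ys} e with pair-injective x (code xs) y (code ys) e
... | refl , q = cong (x ∷_) (code-injective q)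

-- A cell is five slabs wide: the fan from its port `A` begins in `slab₀`, the fan into its port `D`
-- ends in `slab₄`, and the rails, rungs and diagonals occupy the three slabs between.
data Kind : Set where
  hub slab₀ slab₁ slab₂ slab₃ slab₄ : Kind

cyclic : ℕ → Kind
cyclic 0 = slab₀
cyclic 1 = slab₁
cyclic 2 = slab₂
cyclic 3 = slab₃
cyclic 4 = slab₄
cyclic (suc (suc (suc (suc (suc n))))) = cyclic n

kind : ℕ → Kind
kind zero    = hub
kind (suc n) = cyclic n

odd : ℕ → Bool
odd 0 = false
odd 1 = true
odd (suc (suc e)) = odd e

-- Positions of the strands of one track at the two ends of the slabs of a cell, from bottom to
-- top and without the strand of the track itself.  Even positions are vertices of the graph before
-- its edges are thickened; at odd positions a thickened edge passes through the column.
from₁ to₁ from₂ to₂ from₃ to₃ : Subset → ℕ → ℕ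
from₁ b 0 = 0
from₁ b 1 = 0
from₁ b 2 = 0
from₁ b 3 = 5
from₁ b 4 = 8
from₁ b (suc (suc (suc (suc (suc i))))) = 8 + from₁ (b ∘ suc) i
to₁ b 0 = 1
-- If the bit is set, strand 1 begins the diagonal from the lower row of the block. Otherwise it
-- doubles the next strand; such idle strands keep the numbering independent of the bit.
to₁ b 1 = if b 0 then 3 else 4
to₁ b 2 = 4
to₁ b 3 = 4
to₁ b 4 = 4
to₁ b (suc (suc (suc (suc (suc i))))) = 8 + to₁ (b ∘ suc) i
from₂ b 0 = 1
from₂ b 1 = if b 0 then 3 else 4
from₂ b 2 = 4
from₂ b (suc (suc (suc i))) = 8 + from₂ (b ∘ suc) i
to₂ b 0 = 0
to₂ b 1 = if b 0 then 3 else 0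
to₂ b 2 = 5
to₂ b (suc (suc (suc i))) = 8 + to₂ (b ∘ suc) i
from₃ b 0 = 0
from₃ b 1 = 0
from₃ b 2 = if b 0 then 3 else 0
from₃ b 3 = 5
from₃ b 4 = 8
from₃ b (suc (suc (suc (suc (suc i))))) = 8 + from₃ (b ∘ suc) i
to₃ b 0 = 1
to₃ b 1 = 4
to₃ b 2 = 4
to₃ b 3 = 4
to₃ b 4 = 4
to₃ b (suc (suc (suc (suc (suc i))))) = 8 + to₃ (b ∘ suc) i

fan₀ fan₄ : ℕ → ℕ
fan₀ 0 = 0
fan₀ 1 = 5
fan₀ (suc (suc k)) = 8 + fan₀ k
fan₄ 0 = 1
fan₄ 1 = 4
fan₄ (suc (suc k)) = 8 + fan₄ k

infix 4 _⊑_
-- Strands may share a position only where a vertex sits, that is at an even one. At an odd position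
-- the parallel copies of a strand pass through, and two strands there must be strictly ordered to
-- keep their copies from mixing.
_⊑_ : ℕ → ℕ → Set
d ⊑ e = d < e ⊎ (d ≡ e × odd d ≡ false)

⊑-trans : ∀ {a b c} → a ⊑ b → b ⊑ c → a ⊑ c
⊑-trans (inj₁ p) (inj₁ q) = inj₁ (<-trans p q)
⊑-trans (inj₁ p) (inj₂ (refl , _)) = inj₁ p
⊑-trans (inj₂ (refl , _)) q = q

Rising : (ℕ → ℕ) → Set
Rising f = ∀ i → f i ⊑ f (suc i)

shift : ∀ {d e} → d ⊑ e → 8 + d ⊑ 8 + e
shift (inj₁ p) = inj₁ (+-monoʳ-< 8 p)
shift (inj₂ (refl , q)) = inj₂ (refl , q)

rises : ∀ {d e} {p : True (d <? e)} → d ⊑ e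
rises {p = p} = inj₁ (toWitness p)

level : ∀ {e} {p : odd e ≡ false} → e ⊑ e
level {p = p} = inj₂ (refl , p)

from₁-rising : ∀ b → Rising (from₁ b)
from₁-rising b 0 = level {p = refl}
from₁-rising b 1 = level {p = refl}
from₁-rising b 2 = rises
from₁-rising b 3 = rises
from₁-rising b 4 = level {p = refl}
from₁-rising b (suc (suc (suc (suc (suc i))))) = shift (from₁-rising (b ∘ suc) i)

to₁-rising : ∀ b → Rising (to₁ b)
to₁-rising b 0 with b 0
... | true  = rises
... | false = rises
to₁-rising b 1 with b 0
... | true  = rises
... | false = level {p = refl}
to₁-rising b 2 = level {p = refl}
to₁-rising b 3 = level {p = refl}
to₁-rising b 4 = rises
to₁-rising b (suc (suc (suc (suc (suc i))))) = shift (to₁-rising (b ∘ suc) i)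

from₂-rising : ∀ b → Rising (from₂ b)
from₂-rising b 0 with b 0
... | true  = rises
... | false = rises
from₂-rising b 1 with b 0
... | true  = rises
... | false = level {p = refl}
from₂-rising b 2 = rises
from₂-rising b (suc (suc (suc i))) = shift (from₂-rising (b ∘ suc) i)

to₂-rising : ∀ b → Rising (to₂ b)
to₂-rising b 0 with b 0
... | true  = rises
... | false = level {p = refl}
to₂-rising b 1 with b 0
... | true  = rises
... | false = rises
to₂-rising b 2 = rises
to₂-rising b (suc (suc (suc i))) = shift (to₂-rising (b ∘ suc) i)

from₃-rising : ∀ b → Rising (from₃ b)
from₃-rising b 0 = level {p = refl}
from₃-rising b 1 with b 0
... | true  = rises
... | false = level {p = refl}
from₃-rising b 2 with b 0
... | true  = rises
... | false = rises
from₃-rising b 3 = rises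
from₃-rising b 4 = level {p = refl}
from₃-rising b (suc (suc (suc (suc (suc i))))) = shift (from₃-rising (b ∘ suc) i)

to₃-rising : ∀ b → Rising (to₃ b)
to₃-rising b 0 = rises
to₃-rising b 1 = level {p = refl}
to₃-rising b 2 = level {p = refl}
to₃-rising b 3 = level {p = refl}
to₃-rising b 4 = rises
to₃-rising b (suc (suc (suc (suc (suc i))))) = shift (to₃-rising (b ∘ suc) i)

fan₀-rising : Rising fan₀
fan₀-rising 0 = rises
fan₀-rising 1 = rises
fan₀-rising (suc (suc k)) = shift (fan₀-rising k)

fan₄-rising : Rising fan₄
fan₄-rising 0 = rises
fan₄-rising 1 = rises
fan₄-rising (suc (suc k)) = shift (fan₄-rising k)

with-track : (ℕ → ℕ) → ℕ → ℕ
with-track f zero    = 0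
with-track f (suc i) = f i

with-track-rising : ∀ {f} → Rising f → Rising (with-track f)
with-track-rising {f} r zero with f 0
... | zero  = level {p = refl}
... | suc _ = inj₁ (s≤s z≤n)
with-track-rising r (suc i) = r i

rising : ∀ {f} → Rising f → ∀ {i j} → i < j → f i ⊑ f j
rising {f} r {i} {suc j} (s≤s p) with m≤n⇒m<n∨m≡n p
... | inj₁ q    = ⊑-trans (rising {f} r q) (r j)
... | inj₂ refl = r i

Position : Set
Position = ℕ × ℕ

infix 4 _≼_
_≼_ : Position → Position → Set
(s , d) ≼ (t , e) = s < t ⊎ (s ≡ t × d ⊑ e)

-- The i-th strand of track t in the slab between the columns n and n + 1 joins the positions
-- source and target (track, position within the track).
module Strands (w : ℕ) (b : Subset) where

  source target : Kind → ℕ → ℕ → Position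
  -- Each hub gets `suc w` tracks and not `w`, so that the divisor is nonzero also for `w` equal to
  -- 0.
  source hub   t i       = t / suc w , 0
  source slab₀ t zero    = t , 0
  source slab₀ t (suc k) = suc t , 0
  source slab₁ t i       = t , with-track (from₁ b) i
  source slab₂ t i       = t , with-track (from₂ b) i
  source slab₃ t i       = t , with-track (from₃ b) i
  source slab₄ t i       = t , with-track fan₄ i
  target hub   t i       = t , 0
  target slab₀ t i       = t , with-track fan₀ i
  target slab₁ t i       = t , with-track (to₁ b) i
  target slab₂ t i       = t , with-track (to₂ b) i
  target slab₃ t i       = t , with-track (to₃ b) i
  target slab₄ t zero    = t , 0
  target slab₄ t (suc k) = suc t , 0

  Earlier : ℕ → ℕ → ℕ → ℕ → Set
  Earlier t i t′ i′ = t < t′ ⊎ (t ≡ t′ × i < i′)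

  within : ∀ {f} → Rising f → ∀ {t t′ i i′} → Earlier t i t′ i′ → (t , f i) ≼ (t′ , f i′)
  within r (inj₁ p) = inj₁ p
  within {f} r (inj₂ (e , p)) = inj₂ (e , rising {f} r p)

  zero≼ : ∀ {a a′} → a ≤ a′ → (a , 0) ≼ (a′ , 0)
  zero≼ p with m≤n⇒m<n∨m≡n p
  ... | inj₁ q    = inj₁ q
  ... | inj₂ refl = inj₂ (refl , level {p = refl})

  step≼ : (f : ℕ → ℕ → Position) → (∀ t → f t 0 ≡ (t , 0)) → (∀ t k → f t (suc k) ≡ (suc t , 0)) →
          ∀ {t t′ i i′} → Earlier t i t′ i′ → f t i ≼ f t′ i′
  step≼ f z s {t} {t′} {i} {i′} o = subst₂ _≼_ (sym (is t i)) (sym (is t′ i′)) (zero≼ (bound i i′ o))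
    where
    flag : ℕ → ℕ
    flag zero    = 0
    flag (suc _) = 1
    is : ∀ t i → f t i ≡ (flag i + t , 0)
    is t zero    = z t
    is t (suc k) = s t k
    bound : ∀ i i′ → Earlier t i t′ i′ → flag i + t ≤ flag i′ + t′
    bound zero    zero    (inj₁ p) = <⇒≤ p
    bound zero    (suc _) (inj₁ p) = m≤n⇒m≤1+n (<⇒≤ p)
    bound (suc _) zero    (inj₁ p) = p
    bound (suc _) (suc _) (inj₁ p) = s≤s (<⇒≤ p)
    bound zero    zero    (inj₂ (refl , p)) = ≤-refl
    bound zero    (suc _) (inj₂ (refl , p)) = n≤1+n _
    bound (suc _) (suc _) (inj₂ (refl , p)) = ≤-refl

  source-mono : ∀ κ {t t′ i i′} → Earlier t i t′ i′ → source κ t i ≼ source κ t′ i′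
  source-mono hub (inj₁ p) = zero≼ (/-monoˡ-≤ (suc w) (<⇒≤ p))
  source-mono hub (inj₂ (refl , p)) = zero≼ ≤-refl
  source-mono slab₀ = step≼ (source slab₀) (λ _ → refl) (λ _ _ → refl)
  source-mono slab₁ = within (with-track-rising {from₁ b} (from₁-rising b))
  source-mono slab₂ = within (with-track-rising {from₂ b} (from₂-rising b))
  source-mono slab₃ = within (with-track-rising {from₃ b} (from₃-rising b))
  source-mono slab₄ = within (with-track-rising {fan₄} fan₄-rising)

  target-mono : ∀ κ {t t′ i i′} → Earlier t i t′ i′ → target κ t i ≼ target κ t′ i′
  target-mono hub (inj₁ p) = inj₁ p
  target-mono hub (inj₂ (refl , p)) = zero≼ ≤-refl
  target-mono slab₀ = within (with-track-rising {fan₀} fan₀-rising)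
  target-mono slab₁ = within (with-track-rising {to₁ b} (to₁-rising b))
  target-mono slab₂ = within (with-track-rising {to₂ b} (to₂-rising b))
  target-mono slab₃ = within (with-track-rising {to₃ b} (to₃-rising b))
  target-mono slab₄ = step≼ (target slab₄) (λ _ → refl) (λ _ _ → refl)

-- Vertices on the vertical lines 2n (spot) and 2n + 1 (middle); the last argument numbers the infinitely
-- many parallel paths replacing an edge, and is 0 at even positions.
data Vertex : Set where
  spot  : (n t e j : ℕ) → Vertex
  middle : (n t i j : ℕ) → Vertex

vertexCode : Vertex → List ℕ
vertexCode (spot n t e j)  = 0 ∷ n ∷ t ∷ e ∷ j ∷ []
vertexCode (middle n t i j) = 1 ∷ n ∷ t ∷ i ∷ j ∷ []

vertexCode-injective : Injective _≡_ _≡_ vertexCode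
vertexCode-injective {spot _ _ _ _}  {spot _ _ _ _}  refl = refl
vertexCode-injective {middle _ _ _ _} {middle _ _ _ _} refl = refl

copy : ℕ → ℕ → ℕ
copy e j = if odd e then j else 0

place : ℕ → Position → ℕ → Vertex
place n (t , e) j = spot n t e (copy e j)

big : ℕ → ℕ → ℕ → Vertex
big n t e = spot n t e 0

module Host (R : CompleteOrderedField) (w : ℕ) (b : Subset) where
  open OrderedField R using (_≺_; here; there)
  open Strands w b

  line : Vertex → ℕ
  line (spot n t e j)  = n + n
  line (middle n t i j) = suc (n + n)

  key : Vertex → List ℕ
  key (spot n t e j)  = t ∷ e ∷ j ∷ []
  key (middle n t i j) = t ∷ i ∷ j ∷ []

  src tgt : ℕ → ℕ → ℕ → Position
  src n = source (kind n)
  tgt n = target (kind n)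

  data E : Vertex → Vertex → Set where
    leftE  : ∀ n t i j → E (place n (src n t i) j) (middle n t i j)
    rightE : ∀ n t i j → E (middle n t i j) (place (suc n) (tgt n t i) j)

  E-line : ∀ {u v} → E u v → line v ≡ suc (line u)
  E-line (leftE n t i j)  = refl
  E-line (rightE n t i j) = cong suc (+-suc n n)

  key-length : ∀ u v → line u ≡ line v → length (key u) ≡ length (key v)
  key-length (spot _ _ _ _)  (spot _ _ _ _)  e = refl
  key-length (spot _ _ _ _)  (middle _ _ _ _) e = refl
  key-length (middle _ _ _ _) (spot _ _ _ _)  e = refl
  key-length (middle _ _ _ _) (middle _ _ _ _) e = refl

  key-inj : ∀ {u v} → line u ≡ line v → key u ≡ key v → u ≡ v
  key-inj {spot n _ _ _} {spot m _ _ _} e refl with double-injective n m e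
  ... | refl = refl
  key-inj {spot n _ _ _} {middle m _ _ _} e k = ⊥-elim (double≢suc-double n m e)
  key-inj {middle n _ _ _} {spot m _ _ _} e k = ⊥-elim (double≢suc-double m n (sym e))
  key-inj {middle n _ _ _} {middle m _ _ _} e refl with double-injective n m (suc-injective e)
  ... | refl = refl

  ≺-irrefl : ∀ {xs} → ¬ (xs ≺ xs)
  ≺-irrefl (here p)  = <-irrefl refl p
  ≺-irrefl (there p) = ≺-irrefl p

  ≺-asym : ∀ {xs ys} → xs ≺ ys → ¬ (ys ≺ xs)
  ≺-asym (here p)  (here q)  = <-asym p q
  ≺-asym (here p)  (there q) = <-irrefl refl p
  ≺-asym (there p) (here q)  = <-irrefl refl q
  ≺-asym (there p) (there q) = ≺-asym p q

  placeKey : Position → ℕ → List ℕ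
  placeKey (t , e) j = t ∷ e ∷ copy e j ∷ []

  ordered : ∀ p q j k → p ≼ q → ¬ (placeKey q k ≺ placeKey p j)
  ordered p q j k (inj₁ lt) r = ≺-asym (here lt) r
  ordered p q j k (inj₂ (refl , inj₁ lt)) r = ≺-asym (there (here lt)) r
  ordered (t , e) q j k (inj₂ (refl , inj₂ (refl , ev))) r rewrite ev = ≺-irrefl r

  parallel : ∀ p {j k} → j < k → ¬ (placeKey p k ≺ placeKey p j)
  parallel (t , e) lt r with odd e
  ... | true  = ≺-asym (there (there (here lt))) r
  ... | false = ≺-irrefl r

  at-end : (f : ℕ → ℕ → Position) → (∀ {t t′ i i′} → Earlier t i t′ i′ → f t i ≼ f t′ i′) →
           ∀ {t i j t′ i′ j′} → (t ∷ i ∷ j ∷ []) ≺ (t′ ∷ i′ ∷ j′ ∷ []) → ¬ (placeKey (f t′ i′) j′ ≺ placeKey (f t i) j)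
  at-end f m {t} {i} {j} {t′} {i′} {j′} (here p) = ordered (f t i) (f t′ i′) j j′ (m (inj₁ p))
  at-end f m {t} {i} {j} {t′} {i′} {j′} (there (here p)) = ordered (f t i) (f t′ i′) j j′ (m (inj₂ (refl , p)))
  at-end f m {t} {i} (there (there (here p))) = parallel (f t i) p

  noncrossing : ∀ {u v u′ v′} → E u v → E u′ v′ → line u ≡ line u′ → key u ≺ key u′ → ¬ (key v′ ≺ key v)
  noncrossing (leftE n t i j) (leftE n′ t′ i′ j′) l p q with double-injective n n′ l
  ... | refl = at-end (src n) (source-mono (kind n)) q p
  noncrossing (leftE n _ _ _) (rightE m _ _ _) l p q = double≢suc-double n m l
  noncrossing (rightE n _ _ _) (leftE m _ _ _) l p q = double≢suc-double m n (sym l)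
  noncrossing (rightE n t i j) (rightE n′ t′ i′ j′) l p q with double-injective n n′ (suc-injective l)
  ... | refl = at-end (tgt n) (target-mono (kind n)) p q

  open Geometry.Levelled R Vertex line key E E-line key-length key-inj noncrossing public using (graph; planar)

  countable : Countable graph
  countable = (λ v → code (vertexCode v)) , λ e → vertexCode-injective (code-injective e)

  -- A thickened edge, followed from column to column until it reaches an even position.
  data Strand : ℕ → Position → Vertex → Set where
    stop : ∀ {n p q} t i → src n t i ≡ p → tgt n t i ≡ q → odd (proj₂ q) ≡ false →
           Strand n p (big (suc n) (proj₁ q) (proj₂ q))
    pass : ∀ {n p q v} t i → src n t i ≡ p → tgt n t i ≡ q → odd (proj₂ q) ≡ true →
           Strand (suc n) q v → Strand n p v

  data Edge : Vertex → Vertex → Set where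
    edge : ∀ {n t e v} → odd e ≡ false → Strand n (t , e) v → Edge (big n t e) v

-- First column of the c-th column of cells, written so that kind computes on it.
col′ : ℕ → ℕ
col′ zero    = 0
col′ (suc c) = 5 + col′ c

col : ℕ → ℕ
col c = suc (col′ c)

cyclic-col : ∀ c r → cyclic (r + col′ c) ≡ cyclic r
cyclic-col zero r = cong cyclic (+-identityʳ r)
cyclic-col (suc c) r = trans (cong cyclic (trans (sym (+-assoc r 5 (col′ c))) (trans (cong (_+ col′ c) (+-comm r 5)) (+-assoc 5 r (col′ c)))))
                       (cyclic-col c r)

kind-col : ∀ r c → kind (r + col c) ≡ cyclic r
kind-col r c = trans (cong kind (+-suc r (col′ c))) (cyclic-col c r)

infix 8 _·_
-- Recursion on the right factor makes `p · suc m` unfold to `p + p · m`, on which functions defined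
-- by patterns of period `p` compute.
_·_ : ℕ → ℕ → ℕ
p · zero    = 0
p · (suc m) = p + p · m

drop : ℕ → Subset → Subset
drop zero    b = b
drop (suc m) b = drop m (b ∘ suc)

drop-zero : ∀ m b → drop m b 0 ≡ b m
drop-zero zero    b = refl
drop-zero (suc m) b = drop-zero m (b ∘ suc)

block : ∀ p (f : Subset → ℕ → ℕ) → (∀ b i → f b (p + i) ≡ 8 + f (b ∘ suc) i) →
        ∀ m b x → f b (p · m + x) ≡ 8 · m + f (drop m b) x
block p f h zero    b x = refl
block p f h (suc m) b x = trans (cong (f b) (+-assoc p (p · m) x)) (trans (h b (p · m + x)) (cong (8 +_) (block p f h m (b ∘ suc) x)))

odd-block : ∀ m e → odd (8 · m + e) ≡ odd e
odd-block zero    e = refl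
odd-block (suc m) e = odd-block m e

record Row : Set where
  constructor row
  field
    columnᵘ columnᵛ height : ℕ

-- A levelled drawing has no vertical edges, so the rails must zigzag: every second row is shifted
-- by one column. Two rows form a period of height 8, with vertices at 0 and 4 and passing strands
-- at 1, 3 and 5.
rows : ℕ → Row
rows 0 = row 1 3 0
rows 1 = row 2 4 4
rows (suc (suc k)) = row (Row.columnᵘ (rows k)) (Row.columnᵛ (rows k)) (8 + Row.height (rows k))

rows-block : ∀ m x → rows (2 · m + x) ≡ row (Row.columnᵘ (rows x)) (Row.columnᵛ (rows x)) (8 · m + Row.height (rows x))
rows-block zero    x = refl
rows-block (suc m) x = cong (λ ρ → row (Row.columnᵘ ρ) (Row.columnᵛ ρ) (8 + Row.height ρ)) (rows-block m x)

data Parity : ℕ → Set where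
  even-row : ∀ m → Parity (2 · m + 0)
  odd-row  : ∀ m → Parity (2 · m + 1)

parity : ∀ k → Parity k
parity 0 = even-row 0
parity 1 = odd-row 0
parity (suc (suc k)) with parity k
... | even-row m = even-row (suc m)
... | odd-row m  = odd-row (suc m)

-- The cell between the tracks t and t + 1 has rows u k, v k, k ∈ ℕ, of which row 0 lies on track t;
-- its other ports A and D lie on track t + 1.
module CellVertices (c t : ℕ) where
  A D : Vertex
  A = big (col c) (suc t) 0
  D = big (5 + col c) (suc t) 0

  u v : ℕ → Vertex
  u k = big (Row.columnᵘ (rows k) + col c) t (Row.height (rows k))
  v k = big (Row.columnᵛ (rows k) + col c) t (Row.height (rows k))

  u-block : ∀ m x → u (2 · m + x) ≡ big (Row.columnᵘ (rows x) + col c) t (8 · m + Row.height (rows x))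
  u-block m x = cong (λ ρ → big (Row.columnᵘ ρ + col c) t (Row.height ρ)) (rows-block m x)

  v-block : ∀ m x → v (2 · m + x) ≡ big (Row.columnᵛ (rows x) + col c) t (8 · m + Row.height (rows x))
  v-block m x = cong (λ ρ → big (Row.columnᵛ ρ + col c) t (Row.height ρ)) (rows-block m x)

module CellEdges (R : CompleteOrderedField) (w : ℕ) (b : Subset) where
  open Host R w b
  open Strands w b

  source-col : ∀ r c t i {p} → source (cyclic r) t i ≡ p → src (r + col c) t i ≡ p
  source-col r c t i e = trans (cong (λ κ → source κ t i) (kind-col r c)) e

  target-col : ∀ r c t i {p} → target (cyclic r) t i ≡ p → tgt (r + col c) t i ≡ p
  target-col r c t i e = trans (cong (λ κ → target κ t i) (kind-col r c)) e

  stop′ : ∀ r c t i {p q} → source (cyclic r) t i ≡ p → target (cyclic r) t i ≡ q → odd (proj₂ q) ≡ false →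
          Strand (r + col c) p (big (suc (r + col c)) (proj₁ q) (proj₂ q))
  stop′ r c t i e e′ o = stop t i (source-col r c t i e) (target-col r c t i e′) o

  pass′ : ∀ r c t i {p q v} → source (cyclic r) t i ≡ p → target (cyclic r) t i ≡ q → odd (proj₂ q) ≡ true →
          Strand (suc (r + col c)) q v → Strand (r + col c) p v
  pass′ r c t i e e′ o s = pass t i (source-col r c t i e) (target-col r c t i e′) o s

  cyclic≢hub : ∀ n → cyclic n ≢ hub
  cyclic≢hub (suc (suc (suc (suc (suc n))))) e = cyclic≢hub n e

  track-edge : ∀ n t → Edge (big (suc n) t 0) (big (suc (suc n)) t 0)
  track-edge n t = edge refl (stop t 0 (proj₁ (go (cyclic n) refl)) (proj₂ (go (cyclic n) refl)) refl)
    where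
    go : ∀ κ → cyclic n ≡ κ → source (cyclic n) t 0 ≡ (t , 0) × target (cyclic n) t 0 ≡ (t , 0)
    go hub   e = ⊥-elim (cyclic≢hub n e)
    go slab₀ e rewrite e = refl , refl
    go slab₁ e rewrite e = refl , refl
    go slab₂ e rewrite e = refl , refl
    go slab₃ e rewrite e = refl , refl
    go slab₄ e rewrite e = refl , refl

  hub-edge : ∀ t → Edge (big 0 (t / suc w) 0) (big 1 t 0)
  hub-edge t = edge refl (stop t 0 refl refl refl)

  module Cell (c t : ℕ) where
    open CellVertices c t public

    at₁ : ∀ m x → (t , from₁ b (5 · m + x)) ≡ (t , 8 · m + from₁ (drop m b) x)
    at₁ m x = cong (t ,_) (block 5 from₁ (λ _ _ → refl) m b x)
    at₁′ : ∀ m x → (t , to₁ b (5 · m + x)) ≡ (t , 8 · m + to₁ (drop m b) x)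
    at₁′ m x = cong (t ,_) (block 5 to₁ (λ _ _ → refl) m b x)
    at₂ : ∀ m x → (t , from₂ b (3 · m + x)) ≡ (t , 8 · m + from₂ (drop m b) x)
    at₂ m x = cong (t ,_) (block 3 from₂ (λ _ _ → refl) m b x)
    at₂′ : ∀ m x → (t , to₂ b (3 · m + x)) ≡ (t , 8 · m + to₂ (drop m b) x)
    at₂′ m x = cong (t ,_) (block 3 to₂ (λ _ _ → refl) m b x)
    at₃ : ∀ m x → (t , from₃ b (5 · m + x)) ≡ (t , 8 · m + from₃ (drop m b) x)
    at₃ m x = cong (t ,_) (block 5 from₃ (λ _ _ → refl) m b x)
    at₃′ : ∀ m x → (t , to₃ b (5 · m + x)) ≡ (t , 8 · m + to₃ (drop m b) x)
    at₃′ m x = cong (t ,_) (block 5 to₃ (λ _ _ → refl) m b x)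
    at₀ : ∀ m x → (t , fan₀ (2 · m + x)) ≡ (t , 8 · m + fan₀ x)
    at₀ m x = cong (t ,_) (block 2 (λ _ → fan₀) (λ _ _ → refl) m b x)
    at₄ : ∀ m x → (t , fan₄ (2 · m + x)) ≡ (t , 8 · m + fan₄ x)
    at₄ m x = cong (t ,_) (block 2 (λ _ → fan₄) (λ _ _ → refl) m b x)

    next : ∀ m → 8 · m + 8 ≡ 8 · suc m + 0
    next m = trans (+-comm (8 · m) 8) (sym (+-identityʳ (8 + 8 · m)))

    suc-even : ∀ m → suc (2 · m + 0) ≡ 2 · m + 1
    suc-even m = sym (+-suc (2 · m) 0)

    suc-odd : ∀ m → suc (2 · m + 1) ≡ 2 · suc m + 0
    suc-odd m = trans (sym (+-suc (2 · m) 1)) (trans (+-comm (2 · m) 2) (sym (+-identityʳ (2 · suc m))))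

    eq : ∀ {p p′ q q′} → p ≡ p′ → q ≡ q′ → Edge p′ q′ → Edge p q
    eq refl refl e = e

    -- In this and the following edges the numbers after `suc` are strand numbers of the tables,
    -- `suc` skipping the strand of the track itself. The remainders 0 to 4 pick the strand inside
    -- the block `m`.
    A-u : ∀ k → Edge A (u k)
    A-u k with parity k
    ... | even-row m = eq refl (u-block m 0) (edge refl (stop′ 0 c t (suc (2 · m + 0)) refl (at₀ m 0) (odd-block m 0)))
    ... | odd-row m  = eq refl (u-block m 1) (edge refl (pass′ 0 c t (suc (2 · m + 1)) refl (at₀ m 1) (odd-block m 5)
                         (stop′ 1 c t (suc (5 · m + 3)) (at₁ m 3) (at₁′ m 3) (odd-block m 4))))

    u-v : ∀ k → Edge (u k) (v k)
    u-v k with parity k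
    ... | even-row m = eq (u-block m 0) (v-block m 0) (edge (odd-block m 0)
                         (pass′ 1 c t (suc (5 · m + 0)) (at₁ m 0) (at₁′ m 0) (odd-block m 1)
                         (stop′ 2 c t (suc (3 · m + 0)) (at₂ m 0) (at₂′ m 0) (odd-block m 0))))
    ... | odd-row m  = eq (u-block m 1) (v-block m 1) (edge (odd-block m 4)
                         (pass′ 2 c t (suc (3 · m + 2)) (at₂ m 2) (at₂′ m 2) (odd-block m 5)
                         (stop′ 3 c t (suc (5 · m + 3)) (at₃ m 3) (at₃′ m 3) (odd-block m 4))))

    v-D : ∀ k → Edge (v k) D
    v-D k with parity k
    ... | even-row m = eq (v-block m 0) refl (edge (odd-block m 0)
                         (pass′ 3 c t (suc (5 · m + 0)) (at₃ m 0) (at₃′ m 0) (odd-block m 1)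
                         (stop′ 4 c t (suc (2 · m + 0)) (at₄ m 0) refl refl)))
    ... | odd-row m  = eq (v-block m 1) refl (edge (odd-block m 4) (stop′ 4 c t (suc (2 · m + 1)) (at₄ m 1) refl refl))

    Near : Vertex → Vertex → Set
    Near p q = Edge p q ⊎ Edge q p

    u-u : ∀ k → Near (u k) (u (suc k))
    u-u k with parity k
    ... | even-row m = inj₁ (eq (u-block m 0) (trans (cong u (suc-even m)) (u-block m 1)) (edge (odd-block m 0)
                         (stop′ 1 c t (suc (5 · m + 2)) (at₁ m 2) (at₁′ m 2) (odd-block m 4))))
    ... | odd-row m  = inj₂ (eq (trans (cong u (suc-odd m)) (u-block (suc m) 0)) (u-block m 1) (edge (odd-block (suc m) 0)
                         (stop′ 1 c t (suc (5 · m + 4)) (trans (at₁ m 4) (cong (t ,_) (next m))) (at₁′ m 4) (odd-block m 4))))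

    v-v : ∀ k → Near (v k) (v (suc k))
    v-v k with parity k
    ... | even-row m = inj₁ (eq (v-block m 0) (trans (cong v (suc-even m)) (v-block m 1)) (edge (odd-block m 0)
                         (stop′ 3 c t (suc (5 · m + 1)) (at₃ m 1) (at₃′ m 1) (odd-block m 4))))
    ... | odd-row m  = inj₂ (eq (trans (cong v (suc-odd m)) (v-block (suc m) 0)) (v-block m 1) (edge (odd-block (suc m) 0)
                         (stop′ 3 c t (suc (5 · m + 4)) (trans (at₃ m 4) (cong (t ,_) (next m))) (at₃′ m 4) (odd-block m 4))))

    -- This diagonal runs from the first to the fourth inner column and needs three slabs, passing
    -- at position 3. The opposite one joins the two middle columns and needs a single slab.
    diagonal-true : ∀ m → b m ≡ true → Edge (u (2 · m + 0)) (v (2 · m + 1))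
    diagonal-true m bm = eq (u-block m 0) (v-block m 1) (edge (odd-block m 0)
      (pass′ 1 c t (suc (5 · m + 1)) (at₁ m 1) (trans (at₁′ m 1) (cong (λ x → t , 8 · m + x) (choose 3 4))) (odd-block m 3)
      (pass′ 2 c t (suc (3 · m + 1)) (trans (at₂ m 1) (cong (λ x → t , 8 · m + x) (choose 3 4)))
        (trans (at₂′ m 1) (cong (λ x → t , 8 · m + x) (choose 3 0))) (odd-block m 3)
      (stop′ 3 c t (suc (5 · m + 2)) (trans (at₃ m 2) (cong (λ x → t , 8 · m + x) (choose 3 0))) (at₃′ m 2) (odd-block m 4)))))
      where
      choose : ∀ x y → (if drop m b 0 then x else y) ≡ x
      choose x y = cong (λ β → if β then x else y) (trans (drop-zero m b) bm)

    diagonal-false : ∀ m → b m ≡ false → Edge (u (2 · m + 1)) (v (2 · m + 0))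
    diagonal-false m bm = eq (u-block m 1) (v-block m 0) (edge (odd-block m 4)
      (stop′ 2 c t (suc (3 · m + 1)) (trans (at₂ m 1) (cong (λ x → t , 8 · m + x) (choose 3 4)))
        (trans (at₂′ m 1) (cong (λ x → t , 8 · m + x) (choose 3 0))) (odd-block m 0)))
      where
      choose : ∀ x y → (if drop m b 0 then x else y) ≡ y
      choose x y = cong (λ β → if β then x else y) (trans (drop-zero m b) bm)

-- Copies of the host graphs

-- The increasing enumeration of all numbers other than `i`.
skip : ℕ → ℕ → ℕ
skip zero    j       = suc j
skip (suc i) zero    = zero
skip (suc i) (suc j) = suc (skip i j)

skip-injective : ∀ i {j k} → skip i j ≡ skip i k → j ≡ k
skip-injective zero e = suc-injective e
skip-injective (suc i) {zero}  {zero}  e = refl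
skip-injective (suc i) {suc j} {suc k} e = cong suc (skip-injective i (suc-injective e))

skip-≢ : ∀ i j → skip i j ≢ i
skip-≢ (suc i) (suc j) e = skip-≢ i j (suc-injective e)

skip-≤ : ∀ i j → skip i j ≤ suc j
skip-≤ zero    j       = ≤-refl
skip-≤ (suc i) zero    = z≤n
skip-≤ (suc i) (suc j) = s≤s (skip-≤ i j)

module Pigeonhole (wlem : (P : Set) → ¬ P ⊎ ¬ ¬ P) where

  -- Membership in `A i` is not decidable, so even this pigeonhole principle rests on `wlem`. If `x`
  -- cannot be excluded from `A i`, disjointness excludes it from every other set, and the search is
  -- repeated with the index `i` skipped.
  avoiding : {X : Set} (xs : List X) (A : ℕ → X → Set) → (∀ {i j x} → A i x → A j x → i ≡ j) →
             ∃ λ i → i ≤ length xs × (∀ {x} → x ∈ xs → ¬ A i x)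
  avoiding [] A d = 0 , z≤n , λ ()
  avoiding (x ∷ xs) A d with avoiding xs A d
  ... | i , i≤ , p with wlem (A i x)
  ...   | inj₁ n = i , m≤n⇒m≤1+n i≤ , λ { (here refl) → n ; (there q) → p q }
  ...   | inj₂ nn with avoiding xs (A ∘ skip i) (λ a b → skip-injective i (d a b))
  ...     | j , j≤ , q = skip i j , ≤-trans (skip-≤ i j) (s≤s j≤) ,
              λ { (here refl) a → nn (λ b → skip-≢ i j (d a b)) ; (there r) → q r }

module Walks (G : Graph) where
  open import Data.List using ([_])

  infixr 5 _∷_
  data Walk : V G → List (V G) → V G → Set where
    step : ∀ {u v} → Adj G u v → Walk u [] v
    _∷_  : ∀ {u w v l} → Adj G u w → Walk w l v → Walk u (w ∷ l) v

  fromLinked : ∀ u l v → Linked (Adj G) (u ∷ l ++ [ v ]) → Walk u l v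
  fromLinked u []      v (a ∷ _) = step a
  fromLinked u (w ∷ l) v (a ∷ p) = a ∷ fromLinked w l v p

  toLinked : ∀ {u l v} → Walk u l v → Linked (Adj G) (u ∷ l ++ [ v ])
  toLinked (step a)            = a ∷ [-]
  toLinked (a ∷ w@(step _))    = a ∷ toLinked w
  toLinked (a ∷ w@(_ ∷ _))     = a ∷ toLinked w

  join : ∀ {u l v m x} → Walk u l v → Walk v m x → Walk u (l ++ v ∷ m) x
  join (step a) q = a ∷ q
  join (a ∷ p)  q = a ∷ join p q

  walk-reverse : ∀ {u l v} → Walk u l v → Walk v (reverse l) u
  walk-reverse (step a) = step (Graph.sym G a)
  walk-reverse (_∷_ {w = w} {l = l} a p) = subst (λ m → Walk _ m _) (sym (unfold-reverse w l)) (join (walk-reverse p) (step (Graph.sym G a)))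

-- What remains of a topological minor once the parallel paths are forgotten. The inner vertices of
-- a link avoid all tracks, so a piece that follows links meets the tracks exactly at the positions
-- through which it is led.
record Page (G : Graph) (w : ℕ) (R : CompleteOrderedField) (b : Subset) : Set where
  open Walks G
  field
    φ      : Vertex → V G
    φ-inj  : Injective _≡_ _≡_ φ
    link   : ∀ {p q} → Host.Edge R w b p q → (D : List (V G)) → ∃ λ l → Walk (φ p) l (φ q) ×
             (∀ {x} → x ∈ l → x ∉ D) × (∀ {x} → x ∈ l → ∀ n t → x ≢ φ (big n t 0))

module Extract (R : CompleteOrderedField) (G : Graph) (w : ℕ) (b : Subset) (T : TopMinor (Host.graph R w b) G) where
  open OrderedField R using (wlem)
  open Pigeonhole wlem
  open Walks G
  open Host R w b
  open TopMinor T

  -- The value `nothing` marks the vertices shared by all parallel copies.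
  tag : Vertex → Maybe ℕ
  tag (spot n t e j)  = if odd e then just j else nothing
  tag (middle n t i j) = just j

  Fits : ℕ → Vertex → Set
  Fits j v = tag v ≡ nothing ⊎ tag v ≡ just j

  place-fits : ∀ n p j → Fits j (place n p j)
  place-fits n (t , e) j with odd e
  ... | true  = inj₂ refl
  ... | false = inj₁ refl

  pathˡ : ∀ n t i j → Path G (ι (place n (src n t i) j)) (ι (middle n t i j))
  pathˡ n t i j = path _ _ (inj₁ (leftE n t i j))

  pathʳ : ∀ n t i j → Path G (ι (middle n t i j)) (ι (place (suc n) (tgt n t i) j))
  pathʳ n t i j = path _ _ (inj₁ (rightE n t i j))

  slab : ℕ → ℕ → ℕ → ℕ → List (V G)
  slab n t i j = interior (pathˡ n t i j) ++ ι (middle n t i j) ∷ interior (pathʳ n t i j)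

  slab-walk : ∀ n t i j → Walk (ι (place n (src n t i) j)) (slab n t i j) (ι (place (suc n) (tgt n t i) j))
  slab-walk n t i j = join (fromLinked _ _ _ (linked (pathˡ n t i j))) (fromLinked _ _ _ (linked (pathʳ n t i j)))

  place-even : ∀ n p j → odd (proj₂ p) ≡ false → place n p j ≡ big n (proj₁ p) (proj₂ p)
  place-even n (t , e) j ev rewrite ev = refl

  inner : ∀ {n p v} → Strand n p v → ℕ → List (V G)
  inner {n} (stop t i _ _ _)           j = slab n t i j
  inner {n} (pass {q = q} t i _ _ _ s) j = slab n t i j ++ ι (place (suc n) q j) ∷ inner s j

  inner-walk : ∀ {n p v} (s : Strand n p v) j → Walk (ι (place n p j)) (inner s j) (ι v)
  inner-walk {n} (stop t i refl refl ev) j = subst (Walk (ι (place n (src n t i) j)) (slab n t i j)) (cong ι (place-even (suc n) (tgt n t i) j ev)) (slab-walk n t i j)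
  inner-walk {n} (pass t i refl refl od s) j = join (slab-walk n t i j) (inner-walk s j)

  -- The part of `G` taken by the copies with number `j`, for all thickened edges together. Parts
  -- with different numbers are disjoint, so by `avoiding` one of the copies misses any given finite
  -- set.
  data Owned (j : ℕ) (x : V G) : Set where
    vertex   : ∀ v → tag v ≡ just j → x ≡ ι v → Owned j x
    into     : ∀ n t i v (a : Adj graph v (middle n t i j)) → Fits j v → x ∈ interior (path v (middle n t i j) a) → Owned j x
    out-of   : ∀ n t i v (a : Adj graph (middle n t i j) v) → Fits j v → x ∈ interior (path (middle n t i j) v a) → Owned j x

  slab-owned : ∀ n t i j {x} → x ∈ slab n t i j → Owned j x
  slab-owned n t i j x∈ with ∈-++⁻ (interior (pathˡ n t i j)) x∈
  ... | inj₁ y         = into n t i _ _ (place-fits n (src n t i) j) y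
  ... | inj₂ (here e)  = vertex (middle n t i j) refl e
  ... | inj₂ (there y) = out-of n t i _ _ (place-fits (suc n) (tgt n t i) j) y

  owned : ∀ {n p v} (s : Strand n p v) j {x} → x ∈ inner s j → Owned j x
  owned {n} (stop t i _ _ _) j x∈ = slab-owned n t i j x∈
  owned {n} (pass {q = q} t i _ _ od s) j x∈ with ∈-++⁻ (slab n t i j) x∈
  ... | inj₁ y         = slab-owned n t i j y
  ... | inj₂ (here e)  = vertex (place (suc n) q j) (tag-odd od) e
    where
    tag-odd : odd (proj₂ q) ≡ true → tag (place (suc n) q j) ≡ just j
    tag-odd od rewrite od = refl
  ... | inj₂ (there y) = owned s j y

  fits-mid : ∀ {j k n t i v} → Fits j v → v ≡ middle n t i k → j ≡ k
  fits-mid (inj₂ refl) refl = refl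

  mid-copy : ∀ {n t i j n′ t′ i′ k} → middle n t i j ≡ middle n′ t′ i′ k → j ≡ k
  mid-copy refl = refl

  owned-disjoint : ∀ {j k x} → Owned j x → Owned k x → j ≡ k
  owned-disjoint {j} {k} {x} o o′ with j ℕ.≟ k
  ... | yes e = e
  ... | no j≢k = ⊥-elim (clash o o′)
    where
    clash : Owned j x → Owned k x → ⊥
    clash (vertex v e p) (vertex v′ e′ p′) with ι-inj (trans (sym p) p′)
    ... | refl = j≢k (just-injective (trans (sym e) e′))
    clash (vertex v e refl) (into n t i v′ a f y) = avoid _ _ _ v y
    clash (vertex v e refl) (out-of n t i v′ a f y) = avoid _ _ _ v y
    clash (into n t i v a f y) (vertex v′ e′ refl) = avoid _ _ _ v′ y
    clash (out-of n t i v a f y) (vertex v′ e′ refl) = avoid _ _ _ v′ y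
    clash (into n t i v a f y) (into n′ t′ i′ v′ a′ f′ y′) =
      disjoint _ _ _ _ a a′ (λ e → j≢k (mid-copy (proj₂ e))) (λ e → j≢k (fits-mid f (proj₁ e))) x y y′
    clash (into n t i v a f y) (out-of n′ t′ i′ v′ a′ f′ y′) =
      disjoint _ _ _ _ a a′ (λ e → j≢k (fits-mid f (proj₁ e))) (λ e → j≢k (mid-copy (proj₂ e))) x y y′
    clash (out-of n t i v a f y) (into n′ t′ i′ v′ a′ f′ y′) =
      disjoint _ _ _ _ a a′ (λ e → j≢k (fits-mid f (proj₂ e))) (λ e → j≢k (mid-copy (proj₁ e))) x y y′
    clash (out-of n t i v a f y) (out-of n′ t′ i′ v′ a′ f′ y′) =
      disjoint _ _ _ _ a a′ (λ e → j≢k (mid-copy (proj₁ e))) (λ e → j≢k (fits-mid f (proj₂ e))) x y y′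

  not-big : ∀ {j x} → Owned j x → ∀ n t → x ≢ ι (big n t 0)
  not-big (vertex v e refl) n t p with ι-inj p
  not-big (vertex v () refl) n t p | refl
  not-big (into _ _ _ v a f y) n t refl = avoid _ _ _ (big n t 0) y
  not-big (out-of _ _ _ v a f y) n t refl = avoid _ _ _ (big n t 0) y

  links : ∀ {p q} → Edge p q → (D : List (V G)) → ∃ λ l → Walk (ι p) l (ι q) × (∀ {x} → x ∈ l → x ∉ D) ×
          (∀ {x} → x ∈ l → ∀ n t → x ≢ ι (big n t 0))
  links (edge {n} {t} {e} ev s) D with avoiding D (λ j x → x ∈ inner s j) (λ {j} {k} y z → owned-disjoint (owned s j y) (owned s k z))
  ... | j , _ , free = inner s j , subst (λ x → Walk x (inner s j) (ι _)) (cong ι (place-even n (t , e) j ev)) (inner-walk s j) ,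
                       (λ x∈ x∈D → free x∈D x∈) , λ x∈ → not-big (owned s j x∈)

  page : Page G w R b
  page = record { φ = ι ; φ-inj = ι-inj ; link = links }

-- The pages for the subsets W and B of the tower agree on the tracks in a large box, although
-- their bits differ at an explicitly known place.
record Companion (G : Graph) (w : ℕ) (R : CompleteOrderedField) {b : Subset} (P : Page G w R b) (j : ℕ) : Set where
  field
    bits    : Subset
    page    : Page G w R bits
    x       : ℕ
    b-x     : b x ≡ true
    bits-x  : bits x ≡ false
    agree   : ∀ n t → n < j → t < j → Page.φ P (big n t 0) ≡ Page.φ page (big n t 0)

same-head : (L M : ℕ → List ℕ) → ∀ i j → i ∷ L i ≡ j ∷ M j → L j ≡ M j
same-head L M i j e with ∷-injective e
... | refl , q = q

module Pages (R : CompleteOrderedField) (G : Graph) (cnt : Countable G)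
  (hyp : (H : Graph) → Countable H → Plane.Planar R H → TopMinor H G) (w : ℕ) where
  open OrderedField R using (ℝ; wlem)
  open Encoding R using (enc; dec; enc-cong; dec-enc)

  lab : V G → ℕ
  lab = proj₁ cnt

  box : ℕ → List Vertex
  box j = cartesianProductWith (λ n t → big n t 0) (upTo j) (upTo j)

  map-≡⁻ : ∀ {X : Set} (f g : X → ℕ) xs → map f xs ≡ map g xs → ∀ {x} → x ∈ xs → f x ≡ g x
  map-≡⁻ f g (y ∷ ys) e (here refl) = proj₁ (∷-injective e)
  map-≡⁻ f g (y ∷ ys) e (there p)   = map-≡⁻ f g ys (proj₂ (∷-injective e)) p

  abstract
    pageAt : (r : ℝ) → Page G w R (dec r)
    pageAt r = Extract.page R G w (dec r) (hyp (Host.graph R w (dec r)) (Host.countable R w (dec r)) (Host.planar R w (dec r)))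

  image : ℝ → Vertex → V G
  image r = Page.φ (pageAt r)

  labels : ℕ → ℝ → List ℕ
  labels j r = map (λ v → lab (image r v)) (box j)

  images-agree : ∀ j r s → labels j r ≡ labels j s → ∀ n t → n < j → t < j → image r (big n t 0) ≡ image s (big n t 0)
  images-agree j r s e n t n<j t<j = proj₂ cnt (map-≡⁻ (λ v → lab (image r v)) (λ v → lab (image s v)) (box j) e
    (∈-cartesianProductWith⁺ (λ n t → big n t 0) (∈-upTo⁺ n<j) (∈-upTo⁺ t<j)))

  -- The tower only yields some index `i` with `N i B ≡ N j W`. The leading entry of the list
  -- reveals the index, so that `i` must be `j` and the labels of the same box are compared.
  N : ℕ → Subset → ℕ
  N j f = code (j ∷ labels j (enc f))

  N-ext : ∀ j {f g} → f ≗ g → N j f ≡ N j g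
  N-ext j e = cong (λ r → code (j ∷ labels j r)) (enc-cong e)

  N-labels : ∀ i j f g → N i f ≡ N j g → labels j (enc f) ≡ labels j (enc g)
  N-labels i j f g e = same-head (λ k → labels k (enc f)) (λ k → labels k (enc g)) i j
    (code-injective {i ∷ labels i (enc f)} {j ∷ labels j (enc g)} e)

  open Tower wlem N N-ext using (W; N-W; module Stage)

  base : Page G w R (dec (enc W))
  base = pageAt (enc W)

  module _ (j : ℕ) where
    open Stage j

    labels-agree : labels j (enc B) ≡ labels j (enc W)
    -- Lists of numbers have decidable equality: here the double negation of the tower is removed.
    labels-agree = decidable-stable (≡-dec ℕ._≟_ (labels j (enc B)) (labels j (enc W)))
      λ k → entered λ { (i , e) → k (N-labels i j B W e) }

    companion : Companion G w R base j
    companion = record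
      { bits = dec (enc B) ; page = pageAt (enc B) ; x = x
      ; b-x = trans (dec-enc W x) (N-W j) ; bits-x = trans (dec-enc B x) B-x
      ; agree = images-agree j (enc W) (enc B) (sym labels-agree) }

-- Crossings of ladders

data Side : Set where
  leftward rightward : Side

data Route {X : Set} (_~_ : X → X → Set) : X → List X → X → Set where
  [_] : ∀ {x y} → x ~ y → Route _~_ x [] y
  _∷_ : ∀ {x y z l} → x ~ z → Route _~_ z l y → Route _~_ x (z ∷ l) y

infixr 5 _∷_

record Ladder {X : Set} (_~_ : X → X → Set) (A D : X) (P : Side → ℕ → X) : Set where
  field
    P-inj : ∀ {s s′ i i′} → P s i ≡ P s′ i′ → s ≡ s′ × i ≡ i′
    A-u   : ∀ k → A ~ P leftward k
    v-D   : ∀ k → P rightward k ~ D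
    rung  : ∀ k → P leftward k ~ P rightward k
    rise  : ∀ s k → P s k ~ P s (suc k)

-- Two triangulated ladders between the same hubs A and D that start in the same rung, but have opposite
-- diagonals in one of their squares, contain disjoint routes from the left foot to D and from the right foot to A.
module Cross {X : Set} (_≟_ : DecidableEquality X) (_~_ : X → X → Set) (~-sym : ∀ {x y} → x ~ y → y ~ x)
             {A D : X} {P Q : Side → ℕ → X} (LP : Ladder _~_ A D P) (LQ : Ladder _~_ A D Q)
             (foot : ∀ s → P s 0 ≡ Q s 0) where
  module P = Ladder LP
  module Q = Ladder LQ

  Inner : ℕ → X → Set
  Inner k x = (∃ λ s → ∃ λ i → k < i × x ≡ P s i) ⊎ (∃ λ s → ∃ λ i → k < i × x ≡ Q s i)

  record Crossing (k : ℕ) : Set where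
    field
      {l₁ l₂} : List X
      route₁   : Route _~_ (P leftward k) l₁ D
      route₂   : Route _~_ (P rightward k) l₂ A
      inner₁   : ∀ {x} → x ∈ l₁ → Inner k x
      inner₂   : ∀ {x} → x ∈ l₂ → Inner k x
      disjoint : ∀ {x} → x ∈ l₁ → x ∈ l₂ → ⊥

  Agree : ℕ → Set
  Agree k = ∀ s i → i ≤ k → P s i ≡ Q s i

  Inner-down : ∀ {k x} → Inner (suc k) x → Inner k x
  Inner-down (inj₁ (s , i , p , e)) = inj₁ (s , i , <-trans ≤-refl p , e)
  Inner-down (inj₂ (s , i , p , e)) = inj₂ (s , i , <-trans ≤-refl p , e)

  fresh : ∀ {k s x} → Agree k → P s k ≡ x → ¬ Inner k x
  fresh {k} {s} a e (inj₁ (s′ , i , p , e′)) = <-irrefl (proj₂ (P.P-inj (trans e e′))) p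
  fresh {k} {s} a e (inj₂ (s′ , i , p , e′)) = <-irrefl (proj₂ (Q.P-inj (trans (sym (a s k ≤-refl)) (trans e e′)))) p

  -- As far as the ladders agree, both routes can be prolonged downwards along the rails of `P`.
  -- Agreement ensures that these rail vertices do not recur among the higher vertices of `Q`.
  descend : ∀ k → Agree k → Crossing k → Crossing 0
  descend zero a X = X
  descend (suc k) a X = descend k (λ s i p → a s i (m≤n⇒m≤1+n p)) record
    { route₁ = P.rise leftward k ∷ route₁
    ; route₂ = P.rise rightward k ∷ route₂
    ; inner₁ = λ { (here e) → inj₁ (leftward , suc k , ≤-refl , e) ; (there p) → Inner-down (inner₁ p) }
    ; inner₂ = λ { (here e) → inj₁ (rightward , suc k , ≤-refl , e) ; (there p) → Inner-down (inner₂ p) }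
    ; disjoint = λ { (here e) (here e′) → sides (trans (sym e) e′)
                   ; (here e) (there p) → fresh {s = leftward} a (sym e) (inner₂ p)
                   ; (there p) (here e) → fresh {s = rightward} a (sym e) (inner₁ p)
                   ; (there p) (there q) → disjoint p q } }
    where
    open Crossing X
    sides : P leftward (suc k) ≢ P rightward (suc k)
    sides e with P.P-inj e
    ... | () , _

  module At (k : ℕ) (a : Agree k) where
    u₁ u₂ v₁ v₂ u₁′ v₁′ : X
    u₁ = P leftward (1 + k)
    u₂ = P leftward (2 + k)
    v₁ = P rightward (1 + k)
    v₂ = P rightward (2 + k)
    u₁′ = Q leftward (1 + k)
    v₁′ = Q rightward (1 + k)

    up-u : P leftward k ~ u₁
    up-u = P.rise leftward k
    up-v : P rightward k ~ v₁
    up-v = P.rise rightward k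
    up-u′ : P leftward k ~ u₁′
    up-u′ = subst (_~ u₁′) (sym (a leftward k ≤-refl)) (Q.rise leftward k)
    up-v′ : P rightward k ~ v₁′
    up-v′ = subst (_~ v₁′) (sym (a rightward k ≤-refl)) (Q.rise rightward k)

    PP : ∀ s i s′ i′ → ¬ (s ≡ s′ × i ≡ i′) → P s i ≢ P s′ i′
    PP s i s′ i′ n e = n (P.P-inj e)

    data Node : X → Set where
      p₁ : ∀ s → Node (P s (1 + k))
      p₂ : ∀ s → Node (P s (2 + k))
      q₁ : ∀ s → Node (Q s (1 + k))

    node-inner : ∀ {x} → Node x → Inner k x
    node-inner (p₁ s) = inj₁ (s , 1 + k , ≤-refl , refl)
    node-inner (p₂ s) = inj₁ (s , 2 + k , n≤1+n _ , refl)
    node-inner (q₁ s) = inj₂ (s , 1 + k , ≤-refl , refl)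

    infixr 5 _,,_
    data Nodes : List X → Set where
      end  : Nodes []
      _,,_ : ∀ {x l} → Node x → Nodes l → Nodes (x ∷ l)

    nodes-inner : ∀ {l x} → Nodes l → x ∈ l → Inner k x
    nodes-inner (n ,, ns) (here refl) = node-inner n
    nodes-inner (n ,, ns) (there p)   = nodes-inner ns p

    crossing : ∀ {l₁ l₂} → Route _~_ (P leftward k) l₁ D → Route _~_ (P rightward k) l₂ A → Nodes l₁ → Nodes l₂ →
               (∀ {x} → x ∈ l₁ → x ∈ l₂ → ⊥) → Crossing k
    crossing r₁ r₂ n₁ n₂ d = record { route₁ = r₁ ; route₂ = r₂ ; inner₁ = nodes-inner n₁ ; inner₂ = nodes-inner n₂ ; disjoint = d }

    no-sides : ∀ {i i′ : ℕ} → ¬ (leftward ≡ rightward × i ≡ i′)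
    no-sides ()

    no-levels : ∀ {s s′ : Side} → ¬ (s ≡ s′ × 1 + k ≡ 2 + k)
    no-levels (_ , e) = <-irrefl e ≤-refl

    u₁v₁ : u₁ ≢ v₁
    u₁v₁ = PP _ _ _ _ no-sides
    u₁v₂ : u₁ ≢ v₂
    u₁v₂ = PP _ _ _ _ no-sides
    u₁u₂ : u₁ ≢ u₂
    u₁u₂ = PP _ _ _ _ no-levels
    u₂v₁ : u₂ ≢ v₁
    u₂v₁ = PP _ _ _ _ no-sides
    v₁v₂ : v₁ ≢ v₂
    v₁v₂ = PP _ _ _ _ no-levels

    -- If the next rows of the two ladders are disjoint, the left route crosses over on the rung of
    -- `P` and the right route on the rung of `Q`. Otherwise a coincidence lets one vertex play two
    -- roles and shortens one route, while the other may go around through row `2 + k` of `P`.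
    left-differs : u₁ ≢ u₁′ → Crossing k
    left-differs d with u₁ ≟ v₁′
    ... | yes u₁=v₁′ = crossing (up-u ∷ [ subst (_~ D) (sym u₁=v₁′) (Q.v-D (1 + k)) ])
                         (up-v ∷ P.rise rightward (1 + k) ∷ ~-sym (P.rung (2 + k)) ∷ [ ~-sym (P.A-u (2 + k)) ])
                         (p₁ leftward ,, end) (p₁ rightward ,, p₂ rightward ,, p₂ leftward ,, end)
                         λ { (here e) (here e′) → u₁v₁ (trans (sym e) e′) ; (here e) (there (here e′)) → u₁v₂ (trans (sym e) e′)
                           ; (here e) (there (there (here e′))) → u₁u₂ (trans (sym e) e′) }
    ... | no u₁≠v₁′ with v₁ ≟ v₁′
    left-differs d | no u₁≠v₁′ | no v₁≠v₁′ with v₁ ≟ u₁′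
    ...   | yes v₁=u₁′ = crossing (up-u ∷ P.rise leftward (1 + k) ∷ P.rung (2 + k) ∷ [ P.v-D (2 + k) ])
                           (up-v ∷ [ subst (_~ A) (sym v₁=u₁′) (~-sym (Q.A-u (1 + k))) ])
                           (p₁ leftward ,, p₂ leftward ,, p₂ rightward ,, end) (p₁ rightward ,, end)
                           λ { (here e) (here e′) → u₁v₁ (trans (sym e) e′) ; (there (here e)) (here e′) → u₂v₁ (trans (sym e) e′)
                             ; (there (there (here e))) (here e′) → v₁v₂ (trans (sym e′) e) }
    ...   | no v₁≠u₁′ = crossing (up-u ∷ P.rung (1 + k) ∷ [ P.v-D (1 + k) ])
                          (up-v′ ∷ ~-sym (Q.rung (1 + k)) ∷ [ ~-sym (Q.A-u (1 + k)) ])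
                          (p₁ leftward ,, p₁ rightward ,, end) (q₁ rightward ,, q₁ leftward ,, end)
                          λ { (here e) (here e′) → u₁≠v₁′ (trans (sym e) e′) ; (here e) (there (here e′)) → d (trans (sym e) e′)
                            ; (there (here e)) (here e′) → v₁≠v₁′ (trans (sym e) e′) ; (there (here e)) (there (here e′)) → v₁≠u₁′ (trans (sym e) e′) }
    left-differs d | no u₁≠v₁′ | yes v₁=v₁′ with u₂ ≟ u₁′
    ...   | yes u₂=u₁′ = crossing (subst (P leftward k ~_) (sym u₂=u₁′) up-u′ ∷ P.rung (2 + k) ∷ [ P.v-D (2 + k) ])
                           (up-v ∷ ~-sym (P.rung (1 + k)) ∷ [ ~-sym (P.A-u (1 + k)) ])
                           (p₂ leftward ,, p₂ rightward ,, end) (p₁ rightward ,, p₁ leftward ,, end)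
                           λ { (here e) (here e′) → u₂v₁ (trans (sym e) e′) ; (here e) (there (here e′)) → u₁u₂ (trans (sym e′) e)
                             ; (there (here e)) (here e′) → v₁v₂ (trans (sym e′) e) ; (there (here e)) (there (here e′)) → u₁v₂ (trans (sym e′) e) }
    ...   | no u₂≠u₁′ with v₂ ≟ u₁′
    ...     | yes v₂=u₁′ = crossing (subst (P leftward k ~_) (sym v₂=u₁′) up-u′ ∷ [ P.v-D (2 + k) ])
                             (up-v ∷ ~-sym (P.rung (1 + k)) ∷ [ ~-sym (P.A-u (1 + k)) ])
                             (p₂ rightward ,, end) (p₁ rightward ,, p₁ leftward ,, end)
                             λ { (here e) (here e′) → v₁v₂ (trans (sym e′) e) ; (here e) (there (here e′)) → u₁v₂ (trans (sym e′) e) }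
    ...     | no v₂≠u₁′ = crossing (up-u ∷ P.rise leftward (1 + k) ∷ P.rung (2 + k) ∷ [ P.v-D (2 + k) ])
                            (up-v ∷ subst (_~ u₁′) (sym v₁=v₁′) (~-sym (Q.rung (1 + k))) ∷ [ ~-sym (Q.A-u (1 + k)) ])
                            (p₁ leftward ,, p₂ leftward ,, p₂ rightward ,, end) (p₁ rightward ,, q₁ leftward ,, end)
                            λ { (here e) (here e′) → u₁v₁ (trans (sym e) e′) ; (here e) (there (here e′)) → d (trans (sym e) e′)
                              ; (there (here e)) (here e′) → u₂v₁ (trans (sym e) e′) ; (there (here e)) (there (here e′)) → u₂≠u₁′ (trans (sym e) e′)
                              ; (there (there (here e))) (here e′) → v₁v₂ (trans (sym e′) e) ; (there (there (here e))) (there (here e′)) → v₂≠u₁′ (trans (sym e) e′) }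

    right-differs : u₁ ≡ u₁′ → v₁ ≢ v₁′ → Crossing k
    right-differs u₁=u₁′ d with v₂ ≟ v₁′
    ... | yes v₂=v₁′ = crossing (up-u ∷ P.rung (1 + k) ∷ [ P.v-D (1 + k) ])
                         (subst (P rightward k ~_) (sym v₂=v₁′) up-v′ ∷ ~-sym (P.rung (2 + k)) ∷ [ ~-sym (P.A-u (2 + k)) ])
                         (p₁ leftward ,, p₁ rightward ,, end) (p₂ rightward ,, p₂ leftward ,, end)
                         λ { (here e) (here e′) → u₁v₂ (trans (sym e) e′) ; (here e) (there (here e′)) → u₁u₂ (trans (sym e) e′)
                           ; (there (here e)) (here e′) → v₁v₂ (trans (sym e) e′) ; (there (here e)) (there (here e′)) → u₂v₁ (trans (sym e′) e) }
    ... | no v₂≠v₁′ with u₂ ≟ v₁′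
    ...   | yes u₂=v₁′ = crossing (up-u ∷ P.rung (1 + k) ∷ [ P.v-D (1 + k) ])
                           (subst (P rightward k ~_) (sym u₂=v₁′) up-v′ ∷ [ ~-sym (P.A-u (2 + k)) ])
                           (p₁ leftward ,, p₁ rightward ,, end) (p₂ leftward ,, end)
                           λ { (here e) (here e′) → u₁u₂ (trans (sym e) e′) ; (there (here e)) (here e′) → u₂v₁ (trans (sym e′) e) }
    ...   | no u₂≠v₁′ = crossing (up-u ∷ subst (_~ v₁′) (sym u₁=u₁′) (Q.rung (1 + k)) ∷ [ Q.v-D (1 + k) ])
                          (up-v ∷ P.rise rightward (1 + k) ∷ ~-sym (P.rung (2 + k)) ∷ [ ~-sym (P.A-u (2 + k)) ])
                          (p₁ leftward ,, q₁ rightward ,, end) (p₁ rightward ,, p₂ rightward ,, p₂ leftward ,, end)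
                          λ { (here e) (here e′) → u₁v₁ (trans (sym e) e′) ; (here e) (there (here e′)) → u₁v₂ (trans (sym e) e′)
                            ; (here e) (there (there (here e′))) → u₁u₂ (trans (sym e) e′)
                            ; (there (here e)) (here e′) → d (trans (sym e′) e) ; (there (here e)) (there (here e′)) → v₂≠v₁′ (trans (sym e′) e)
                            ; (there (here e)) (there (there (here e′))) → u₂≠v₁′ (trans (sym e′) e) }

  agree-suc : ∀ {k} → Agree k → (∀ s → P s (suc k) ≡ Q s (suc k)) → Agree (suc k)
  agree-suc a e s i p with m≤n⇒m<n∨m≡n p
  ... | inj₁ (s≤s q) = a s i q
  ... | inj₂ refl    = e s

  agree-or-cross : ∀ k → Crossing 0 ⊎ Agree k
  agree-or-cross zero = inj₂ λ { s zero z≤n → foot s }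
  agree-or-cross (suc k) with agree-or-cross k
  ... | inj₁ X = inj₁ X
  ... | inj₂ a with P leftward (suc k) ≟ Q leftward (suc k) | P rightward (suc k) ≟ Q rightward (suc k)
  ...   | no d  | _     = inj₁ (descend k a (At.left-differs k a d))
  ...   | yes e | no d  = inj₁ (descend k a (At.right-differs k a e d))
  ...   | yes e | yes f = inj₂ (agree-suc a λ { leftward → e ; rightward → f })

  abstract
    -- The first row in which the ladders differ already gives a crossing. If there is none up to
    -- row `suc k`, the two diagonals belong to the same square and cross there.
    cross : ∀ k → P leftward k ~ P rightward (suc k) → Q leftward (suc k) ~ Q rightward k → Crossing 0
    cross k d d′ with agree-or-cross (suc k)
    ... | inj₁ X = X
    ... | inj₂ a = descend k a′ (crossing (d ∷ [ P.v-D (suc k) ])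
                     (subst₂ _~_ (sym (a rightward k (n≤1+n k))) (sym (a leftward (suc k) ≤-refl)) (~-sym d′) ∷ [ ~-sym (P.A-u (suc k)) ])
                     (p₁ rightward ,, end) (p₁ leftward ,, end) λ { (here e) (here e′) → u₁v₁ (trans (sym e′) e) })
      where
      a′ : Agree k
      a′ s i p = a s i (m≤n⇒m≤1+n p)
      open At k a′

-- Lines and their moves

module Lines (G : Graph) (_≟_ : DecidableEquality (V G)) where
  open Walks G

  infix 4 _∈?_
  _∈?_ : (x : V G) (l : List (V G)) → Dec (x ∈ l)
  x ∈? l = any? (x ≟_) l

  -- A `Walk` has at least one edge, hence the separate trivial case. Only inner vertices must lie
  -- in `l`, so that the ends may be outside, such as hubs.
  Reach : List (V G) → V G → V G → Set
  Reach l x y = x ≡ y ⊎ ∃ λ m → Walk x m y × (∀ {z} → z ∈ m → z ∈ l)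

  ∈-reverse⁻ : ∀ {z} (m : List (V G)) → z ∈ reverse m → z ∈ m
  ∈-reverse⁻ m = reverse⁻

  reach-sym : ∀ {l x y} → Reach l x y → Reach l y x
  reach-sym (inj₁ e) = inj₁ (sym e)
  reach-sym (inj₂ (m , w , s)) = inj₂ (reverse m , walk-reverse w , λ p → s (∈-reverse⁻ m p))

  reach-trans : ∀ {l x y z} → y ∈ l → Reach l x y → Reach l y z → Reach l x z
  reach-trans y∈ (inj₁ refl) r = r
  reach-trans y∈ r (inj₁ refl) = r
  reach-trans {l} {y = y} y∈ (inj₂ (m , w , s)) (inj₂ (m′ , w′ , s′)) = inj₂ (m ++ y ∷ m′ , join w w′ , inside)
    where
    inside : ∀ {z} → z ∈ m ++ y ∷ m′ → z ∈ l
    inside p with ∈-++⁻ m p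
    ... | inj₁ q         = s q
    ... | inj₂ (here refl) = y∈
    ... | inj₂ (there q) = s′ q

  reach-mono : ∀ {l l′ x y} → (∀ {z} → z ∈ l → z ∈ l′) → Reach l x y → Reach l′ x y
  reach-mono f (inj₁ e) = inj₁ e
  reach-mono f (inj₂ (m , w , s)) = inj₂ (m , w , λ p → f (s p))

  prefix-walk : ∀ {v m u x} → Walk v m u → x ∈ m → ∃ λ m′ → Walk v m′ x × (∀ {z} → z ∈ m′ → z ∈ m)
  prefix-walk (a ∷ w) (here refl) = [] , step a , λ ()
  prefix-walk (a ∷ w) (there p) with prefix-walk w p
  ... | m′ , w′ , s = _ ∷ m′ , a ∷ w′ , λ { (here e) → here e ; (there q) → there (s q) }

  last-edge : ∀ {v m u} → Walk v m u → ∃ λ z → z ∈ v ∷ m × Adj G z u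
  last-edge (step a) = _ , here refl , a
  last-edge (a ∷ w) with last-edge w
  ... | z , p , b = z , there p , b

  record Config : Set where
    field
      C    : ℕ → List (V G)
      -- all vertices that are in use, including those set aside for later
      U    : List (V G)
      C⊆U  : ∀ {i x} → x ∈ C i → x ∈ U
      disj : ∀ {i j x} → x ∈ C i → x ∈ C j → i ≡ j
      conn : ∀ {i x y} → x ∈ C i → y ∈ C i → Reach (C i) x y
  open Config public

  -- The field `C-new` protects vertices set aside by `reserve`: they lie in `U` but in no piece,
  -- and growth never takes them, so a walk prepared earlier can still be attached.
  record Grow (K K′ : Config) (S : V G → Set) : Set where
    field
      C-mono : ∀ {i x} → x ∈ C K i → x ∈ C K′ i
      U-mono : ∀ {x} → x ∈ U K → x ∈ U K′
      news   : ∀ {x} → x ∈ U K′ → x ∈ U K ⊎ S x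
      C-new  : ∀ {i x} → x ∈ C K′ i → x ∈ C K i ⊎ x ∉ U K
      idle   : ∀ {i} → (∀ {x} → x ∉ C K i) → ∀ {x} → x ∉ C K′ i
  open Grow public

  grow-refl : ∀ {K S} → Grow K K S
  grow-refl = record { C-mono = λ p → p ; U-mono = λ p → p ; news = inj₁ ; C-new = inj₁ ; idle = λ n → n }

  grow-trans : ∀ {K K′ K″ S} → Grow K K′ S → Grow K′ K″ S → Grow K K″ S
  grow-trans {K} {K′} {K″} {S} g h = record { C-mono = λ p → C-mono h (C-mono g p) ; U-mono = λ p → U-mono h (U-mono g p)
                                ; news = λ p → both (news h p) ; C-new = λ p → new (C-new h p) ; idle = λ n → idle h (idle g n) }
    where
    new : ∀ {i x} → x ∈ C K′ i ⊎ x ∉ U K′ → x ∈ C K i ⊎ x ∉ U K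
    new (inj₁ q) = C-new g q
    new (inj₂ n) = inj₂ λ p → n (U-mono g p)
    both : ∀ {x} → x ∈ U K′ ⊎ S x → x ∈ U K ⊎ S x
    both (inj₁ q) = news g q
    both (inj₂ s) = inj₂ s

  grow-weaken : ∀ {K K′ S T} → (∀ {x} → S x → T x) → Grow K K′ S → Grow K K′ T
  grow-weaken f g = record { C-mono = C-mono g ; U-mono = U-mono g ; news = λ p → Sum.map₂ f (news g p) ; C-new = C-new g ; idle = idle g }

  add : (ℕ → List (V G)) → ℕ → List (V G) → ℕ → List (V G)
  add C i l j with j ℕ.≟ i
  ... | yes _ = l ++ C j
  ... | no _  = C j

  add-old : ∀ C i l j {x} → x ∈ C j → x ∈ add C i l j
  add-old C i l j p with j ℕ.≟ i
  ... | yes _ = ∈-++⁺ʳ l p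
  ... | no _  = p

  add-new : ∀ C i l {x} → x ∈ l → x ∈ add C i l i
  add-new C i l p with i ℕ.≟ i
  ... | yes _ = ∈-++⁺ˡ p
  ... | no n  = ⊥-elim (n refl)

  add-inv : ∀ C i l j {x} → x ∈ add C i l j → x ∈ C j ⊎ (j ≡ i × x ∈ l)
  add-inv C i l j p with j ℕ.≟ i
  ... | no _  = inj₁ p
  ... | yes e with ∈-++⁻ l p
  ...   | inj₁ q = inj₂ (e , q)
  ...   | inj₂ q = inj₁ q

  record Attached (K : Config) (i : ℕ) (l : List (V G)) : Set where
    field
      K′     : Config
      C-up   : ∀ {j x} → x ∈ C K j → x ∈ C K′ j
      into   : ∀ {x} → x ∈ l → x ∈ C K′ i
      C-inv  : ∀ {j x} → x ∈ C K′ j → x ∈ C K j ⊎ (j ≡ i × x ∈ l)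
      U-up   : ∀ {x} → x ∈ U K → x ∈ U K′
      U-inv  : ∀ {x} → x ∈ U K′ → x ∈ U K ⊎ x ∈ l

  abstract
    attach : (K : Config) (i : ℕ) (l : List (V G)) → (∀ {j x} → x ∈ l → x ∉ C K j) →
             (∀ {x y} → x ∈ l ⊎ x ∈ C K i → y ∈ l ⊎ y ∈ C K i → Reach (add (C K) i l i) x y) → Attached K i l
    attach K i l new reach = record
      { K′ = record
        { C = add (C K) i l ; U = l ++ U K
        ; C⊆U = λ {j} p → sub j (add-inv (C K) i l j p)
        ; disj = λ {j} {k} p q → dis j k (add-inv (C K) i l j p) (add-inv (C K) i l k q)
        ; conn = λ {j} p q → con j (add-inv (C K) i l j p) (add-inv (C K) i l j q) }
      ; C-up = λ {j} → add-old (C K) i l j ; into = add-new (C K) i l ; C-inv = λ {j} → add-inv (C K) i l j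
      ; U-up = ∈-++⁺ʳ l ; U-inv = λ p → Sum.swap (∈-++⁻ l p) }
      where
      sub : ∀ j {x} → x ∈ C K j ⊎ (j ≡ i × x ∈ l) → x ∈ l ++ U K
      sub j (inj₁ p) = ∈-++⁺ʳ l (C⊆U K p)
      sub j (inj₂ (_ , p)) = ∈-++⁺ˡ p
      dis : ∀ j k {x} → x ∈ C K j ⊎ (j ≡ i × x ∈ l) → x ∈ C K k ⊎ (k ≡ i × x ∈ l) → j ≡ k
      dis j k (inj₁ p) (inj₁ q) = disj K p q
      dis j k (inj₁ p) (inj₂ (_ , q)) = ⊥-elim (new q p)
      dis j k (inj₂ (_ , p)) (inj₁ q) = ⊥-elim (new p q)
      dis j k (inj₂ (refl , _)) (inj₂ (refl , _)) = refl
      con : ∀ j {x y} → x ∈ C K j ⊎ (j ≡ i × x ∈ l) → y ∈ C K j ⊎ (j ≡ i × y ∈ l) → Reach (add (C K) i l j) x y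
      con j (inj₁ p) (inj₁ q) = reach-mono (add-old (C K) i l j) (conn K p q)
      con j (inj₁ p) (inj₂ (refl , q)) = reach (inj₂ p) (inj₁ q)
      con j (inj₂ (refl , p)) (inj₁ q) = reach (inj₁ p) (inj₂ q)
      con j (inj₂ (refl , p)) (inj₂ (_ , q)) = reach (inj₁ p) (inj₁ q)

  attached-idle : ∀ {K i l v} (A : Attached K i l) → v ∈ C K i → ∀ {j} → (∀ {x} → x ∉ C K j) → ∀ {x} → x ∉ C (Attached.K′ A) j
  attached-idle A v∈ n p with Attached.C-inv A p
  ... | inj₁ q          = n q
  ... | inj₂ (refl , _) = n v∈

  attached-grow : ∀ {K i l v} (A : Attached K i l) → v ∈ C K i → (∀ {x} → x ∈ l → x ∉ U K) → Grow K (Attached.K′ A) (_∈ l)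
  attached-grow {K} {i} {l} A v∈ new = record { idle = attached-idle A v∈ ; C-mono = C-up ; U-mono = U-up ; news = U-inv ; C-new = λ p → Sum.map₂ (λ q → new (proj₂ q)) (C-inv p) }
    where open Attached A

  attach-from : (K : Config) (i : ℕ) (l : List (V G)) {v : V G} → v ∈ C K i → (∀ {j x} → x ∈ l → x ∉ C K j) →
                (∀ {x} → x ∈ l → Reach l v x) → Attached K i l
  attach-from K i l {v} v∈ new reach = attach K i l new λ p q → reach-trans (add-old (C K) i l i v∈) (reach-sym (to p)) (to q)
    where
    to : ∀ {x} → x ∈ l ⊎ x ∈ C K i → Reach (add (C K) i l i) v x
    to (inj₁ p) = reach-mono (add-new (C K) i l) (reach p)
    to (inj₂ p) = reach-mono (add-old (C K) i l i) (conn K v∈ p)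

  attach-walk : (K : Config) (i : ℕ) {v u : V G} {m : List (V G)} → v ∈ C K i → Walk v m u →
                (∀ {j x} → x ∈ u ∷ m → x ∉ C K j) → Attached K i (u ∷ m)
  attach-walk K i {v} {u} {m} v∈ w new = attach-from K i (u ∷ m) v∈ new
    λ { (here refl) → inj₂ (m , w , there) ; (there p) → inj₂ (let (m′ , w′ , s) = prefix-walk w p in m′ , w′ , λ q → there (s q)) }

  reserve : (K : Config) (l : List (V G)) → Config
  reserve K l = record { C = C K ; U = l ++ U K ; C⊆U = λ p → ∈-++⁺ʳ l (C⊆U K p) ; disj = disj K ; conn = conn K }

  extend : (K : Config) (i : ℕ) {v u : V G} {m : List (V G)} → v ∈ C K i → Walk v m u → (∀ {x} → x ∈ m → x ∉ U K) → u ∉ U K →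
           Σ Config λ K′ → Grow K K′ (λ x → x ∈ m ⊎ x ≡ u) × u ∈ C K′ i
  extend K i {v} {u} {m} v∈ w new u∉ = K′ , grow-weaken (λ { (here e) → inj₂ e ; (there p) → inj₁ p }) (attached-grow A v∈ fresh) , into (here refl)
    where
    fresh : ∀ {x} → x ∈ u ∷ m → x ∉ U K
    fresh (here refl) = u∉
    fresh (there p)   = new p
    A : Attached K i (u ∷ m)
    A = attach-walk K i v∈ w λ p q → fresh p (C⊆U K q)
    open Attached A

  Touch : Config → ℕ → ℕ → Set
  Touch K i j = ∃ λ x → ∃ λ y → x ∈ C K i × y ∈ C K j × Adj G x y

  touch-mono : ∀ {K K′ i j} → (∀ {k x} → x ∈ C K k → x ∈ C K′ k) → Touch K i j → Touch K′ i j
  touch-mono f (x , y , p , q , a) = x , y , f p , f q , a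

  -- Only inner vertices of the walk are taken. The end `u` may belong to another piece, with which
  -- an adjacency is obtained.
  contact : (K : Config) (i : ℕ) {v u : V G} {m : List (V G)} → v ∈ C K i → Walk v m u → (∀ {x} → x ∈ m → x ∉ U K) →
            Σ Config λ K′ → Grow K K′ (_∈ m) × ∃ λ z → z ∈ C K′ i × Adj G z u
  contact K i {v} {u} {m} v∈ w new = K′ , attached-grow A v∈ new , edge (last-edge w)
    where
    A : Attached K i m
    A = attach-from K i m v∈ (λ p q → new p (C⊆U K q)) λ p → inj₂ (prefix-walk w p)
    open Attached A
    edge : (∃ λ z → z ∈ v ∷ m × Adj G z u) → ∃ λ z → z ∈ C K′ i × Adj G z u
    edge (z , here refl , a) = z , C-up v∈ , a
    edge (z , there p , a)   = z , into p , a

  born : (K : Config) (i : ℕ) (u : V G) → (∀ {x} → x ∉ C K i) → u ∉ U K → Attached K i (u ∷ [])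
  born K i u none u∉ = attach K i (u ∷ []) (λ { (here refl) q → u∉ (C⊆U K q) }) λ p q → inj₁ (trans (only p) (sym (only q)))
    where
    only : ∀ {x} → x ∈ u ∷ [] ⊎ x ∈ C K i → x ≡ u
    only (inj₁ (here e)) = e
    only (inj₂ p) = ⊥-elim (none p)

-- Trails along the tracks and rungs

module Grid (G : Graph) (_≟_ : DecidableEquality (V G)) (φ : ℕ → ℕ → V G)
            (φ-inj : ∀ {n t n′ t′} → φ n t ≡ φ n′ t′ → n ≡ n′ × t ≡ t′) where
  open Walks G
  open Lines G _≟_

  OffTrack : V G → Set
  OffTrack x = ∀ n t → x ≢ φ n t

  Link : V G → V G → Set
  Link x y = (D : List (V G)) → ∃ λ l → Walk x l y × (∀ {z} → z ∈ l → z ∉ D) × (∀ {z} → z ∈ l → OffTrack z)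

  link-sym : ∀ {x y} → Link x y → Link y x
  link-sym f D with f D
  ... | l , w , free , off = reverse l , walk-reverse w , (λ p → free (∈-reverse⁻ l p)) , (λ p → off (∈-reverse⁻ l p))

  On : (ℕ → ℕ → Set) → V G → Set
  On S x = (∃ λ n → ∃ λ t → S n t × x ≡ φ n t) ⊎ OffTrack x

  on-mono : ∀ {S T : ℕ → ℕ → Set} → (∀ {n t} → S n t → T n t) → ∀ {x} → On S x → On T x
  on-mono f (inj₁ (n , t , s , e)) = inj₁ (n , t , f s , e)
  on-mono f (inj₂ o) = inj₂ o

  on-track : ∀ {S n t} → On S (φ n t) → S n t
  on-track (inj₁ (n , t , s , e)) with φ-inj e
  ... | refl , refl = s
  on-track (inj₂ o) = ⊥-elim (o _ _ refl)

  data Trail (S : ℕ → ℕ → Set) : ℕ → ℕ → ℕ → ℕ → Set where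
    done : ∀ {n t} → Trail S n t n t
    go   : ∀ {n t m s n′ t′} → Link (φ n t) (φ m s) → S m s → Trail S m s n′ t′ → Trail S n t n′ t′

  infixr 5 _▷_
  _▷_ : ∀ {S n t m s n′ t′} → Trail S n t m s → Trail S m s n′ t′ → Trail S n t n′ t′
  done      ▷ q = q
  go l s p  ▷ q = go l s (p ▷ q)

  -- Positions that are already in use may be revisited by the piece that owns them.
  Open : Config → ℕ → (ℕ → ℕ → Set) → Set
  Open K i S = ∀ n t → S n t → φ n t ∈ U K → φ n t ∈ C K i

  -- A position in use belongs to the piece already, and then nothing is drawn: a piece has to be
  -- connected, not a path, so it may revisit its own vertices.
  follow-link : (K : Config) (i : ℕ) {x : V G} {m s : ℕ} → x ∈ C K i → Link x (φ m s) → (φ m s ∈ U K → φ m s ∈ C K i) →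
                Σ Config λ K′ → Grow K K′ (On (λ n t → n ≡ m × t ≡ s)) × φ m s ∈ C K′ i
  follow-link K i {x} {m} {s} x∈ l op with φ m s ∈? U K
  ... | yes p = K , grow-refl , op p
  ... | no p with l (U K)
  ...   | I , w , free , off with extend K i x∈ w free p
  ...     | K′ , g , q = K′ , grow-weaken (λ { (inj₁ z) → inj₂ (off z) ; (inj₂ e) → inj₁ (m , s , (refl , refl) , e) }) g , q

  follow : ∀ {S n t n′ t′} (K : Config) (i : ℕ) → φ n t ∈ C K i → Open K i S → Trail S n t n′ t′ →
           Σ Config λ K′ → Grow K K′ (On S) × Open K′ i S × φ n′ t′ ∈ C K′ i
  follow K i p op done = K , grow-refl , op , p
  follow {S} K i p op (go {m = m} {s} l ok tr) with follow-link K i p l (op m s ok)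
  ... | K₁ , g₁ , q with follow K₁ i q open₁ tr
    where
    open₁ : Open K₁ i S
    open₁ n t st u with news g₁ u
    ... | inj₁ old = C-mono g₁ (op n t st old)
    ... | inj₂ o with on-track {λ n′ t′ → n′ ≡ m × t′ ≡ s} o
    ...   | refl , refl = q
  ...   | K₂ , g₂ , op₂ , r = K₂ , grow-trans (grow-weaken (on-mono λ { (refl , refl) → ok }) g₁) g₂ , op₂ , r

  open-grow : ∀ {K K′ i} {S T : ℕ → ℕ → Set} → Grow K K′ (On T) → (∀ {n t} → S n t → ¬ T n t) → Open K i S → Open K′ i S
  open-grow {T = T} g apart op n t s p with news g p
  ... | inj₁ old = C-mono g (op n t s old)
  ... | inj₂ o   = ⊥-elim (apart s (on-track {T} o))

  module Moves (track : ∀ n t → 0 < n → Link (φ n t) (φ (suc n) t))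
               (rungᵃ : ∀ c t → Link (φ (col c) (suc t)) (φ (1 + col c) t))
               (rungᵈ : ∀ c t → Link (φ (3 + col c) t) (φ (5 + col c) (suc t))) where

    Rect : ℕ → ℕ → ℕ → ℕ → ℕ → Set
    Rect c lo hi n t = col c < n × n ≤ 5 + col c × lo ≤ t × t ≤ hi

    straight : ∀ {S : ℕ → ℕ → Set} d n t → 0 < n → (∀ e → e < d → S (suc (e + n)) t) → Trail S n t (d + n) t
    straight zero n t p s = done
    straight {S} (suc d) n t p s = straight {S} d n t p (λ e q → s e (m≤n⇒m≤1+n q)) ▷
      go (track (d + n) t (≤-trans p (m≤n+m n d))) (s d ≤-refl) done

    col>0 : ∀ r c → 0 < r + col c
    col>0 r c = ≤-trans (s≤s z≤n) (m≤n+m (col c) r)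

    rect : ∀ {c lo hi t} r → 0 < r → r ≤ 5 → lo ≤ t → t ≤ hi → Rect c lo hi (r + col c) t
    rect {c} (suc r) p q a b = s≤s (m≤n+m (col c) r) , +-monoˡ-≤ (col c) q , a , b

    -- The rung to the next row ends at the last column but starts two columns before it, so the
    -- trail first goes back along the track.
    up-one : ∀ c {lo hi} t → lo ≤ t → suc t ≤ hi → Trail (Rect c lo hi) (5 + col c) t (5 + col c) (suc t)
    up-one c t a b =
      go (link-sym (track (4 + col c) t (col>0 4 c))) (rect {c} 4 (s≤s z≤n) (s≤s (s≤s (s≤s (s≤s z≤n)))) a (<⇒≤ b))
      (go (link-sym (track (3 + col c) t (col>0 3 c))) (rect {c} 3 (s≤s z≤n) (s≤s (s≤s (s≤s z≤n))) a (<⇒≤ b))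
      (go (rungᵈ c t) (rect {c} 5 (s≤s z≤n) ≤-refl (m≤n⇒m≤1+n a) b) done))

    down-one : ∀ c {lo hi} t → lo ≤ t → suc t ≤ hi → Trail (Rect c lo hi) (5 + col c) (suc t) (5 + col c) t
    down-one c t a b =
      go (link-sym (rungᵈ c t)) (rect {c} 3 (s≤s z≤n) (s≤s (s≤s (s≤s z≤n))) a (<⇒≤ b))
      (go (track (3 + col c) t (col>0 3 c)) (rect {c} 4 (s≤s z≤n) (s≤s (s≤s (s≤s (s≤s z≤n)))) a (<⇒≤ b))
      (go (track (4 + col c) t (col>0 4 c)) (rect {c} 5 (s≤s z≤n) ≤-refl a (<⇒≤ b)) done))

    climb : ∀ c {lo hi} d t → lo ≤ t → d + t ≤ hi → Trail (Rect c lo hi) (5 + col c) t (5 + col c) (d + t)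
    climb c zero    t a b = done
    climb c (suc d) t a b = climb c d t a (<⇒≤ b) ▷ up-one c (d + t) (≤-trans a (m≤n+m t d)) b

    sink : ∀ c {lo hi} d t → lo ≤ t → d + t ≤ hi → Trail (Rect c lo hi) (5 + col c) (d + t) (5 + col c) t
    sink c zero    t a b = done
    sink c (suc d) t a b = down-one c (d + t) (≤-trans a (m≤n+m t d)) b ▷ sink c d t a (<⇒≤ b)

    vertical : ∀ c {lo hi} t t′ → lo ≤ t → t ≤ hi → lo ≤ t′ → t′ ≤ hi → Trail (Rect c lo hi) (5 + col c) t (5 + col c) t′
    vertical c t t′ a b a′ b′ with ≤-total t t′
    ... | inj₁ p = subst (Trail _ _ _ _) (m∸n+n≡m p) (climb c (t′ ∸ t) t a (subst (_≤ _) (sym (m∸n+n≡m p)) b′))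
    ... | inj₂ p = subst (λ s → Trail _ _ s _ _) (m∸n+n≡m p) (sink c (t ∸ t′) t′ a′ (subst (_≤ _) (sym (m∸n+n≡m p)) b))

    crossing-column : ∀ c {lo hi} n t t′ → col c ≤ n → n ≤ 5 + col c → lo ≤ t → t ≤ hi → lo ≤ t′ → t′ ≤ hi →
                      Trail (Rect c lo hi) n t (5 + col c) t′
    crossing-column c {lo} {hi} n t t′ p q a b a′ b′ =
      subst (λ m → Trail (Rect c lo hi) n t m t) (m∸n+n≡m q)
        (straight (5 + col c ∸ n) n t (≤-trans (s≤s z≤n) p) λ e e< →
          s≤s (≤-trans p (m≤n+m n e)) , ≤-trans (+-monoˡ-≤ n e<) (≤-reflexive (m∸n+n≡m q)) , a , b)
      ▷ vertical c t t′ a b a′ b′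

    Heads : Set
    Heads = List (ℕ × ℕ)

    -- Rising rows, each line moving upwards inside its own interval of rows.
    data Shift : ℕ → Heads → Heads → Set where
      []  : ∀ {lo} → Shift lo [] []
      _∷_ : ∀ {lo i τ τ′ hs hs′} → lo ≤ τ × τ ≤ τ′ → Shift (suc τ′) hs hs′ → Shift lo ((i , τ) ∷ hs) ((i , τ′) ∷ hs′)

    Sorted : ℕ → Heads → Set
    Sorted lo hs = Shift lo hs hs

    At : Config → ℕ → Heads → Set
    At K n hs = ∀ {i τ} → (i , τ) ∈ hs → φ n τ ∈ C K i

    Clear : Config → ℕ → ∀ {lo hs hs′} → Shift lo hs hs′ → Set
    Clear K c [] = ⊤
    Clear K c (_∷_ {i = i} {τ} {τ′} _ ms) = Open K i (Rect c τ τ′) × Clear K c ms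

    Beyond : ℕ → ℕ → ℕ → ℕ → Set
    Beyond c lo n t = col c < n × n ≤ 5 + col c × lo ≤ t

    clear-grow : ∀ {K K′ c lo hs hs′ τ′} {T : ℕ → ℕ → Set} (ms : Shift lo hs hs′) → Grow K K′ (On T) → suc τ′ ≤ lo →
                 (∀ {n t} → T n t → t ≤ τ′) → Clear K c ms → Clear K′ c ms
    clear-grow [] g p f cl = tt
    clear-grow ((a , b) ∷ ms) g p f (op , cl) =
      open-grow g (λ { (_ , _ , c , _) t → <-irrefl refl (≤-trans (≤-trans p a) (≤-trans c (f t))) }) op ,
      clear-grow ms g (≤-trans p (≤-trans a (≤-trans b (n≤1+n _)))) f cl

    -- Each line makes a short detour at the end of the column, so that it owns the foot of the rung to the row above.
    advance : ∀ {lo hs hs′} (K : Config) c (ms : Shift lo hs hs′) → At K (col c) hs → Clear K c ms →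
              Σ Config λ K′ → Grow K K′ (On (Beyond c lo)) × At K′ (5 + col c) hs′ × At K′ (3 + col c) hs′
    advance K c [] at cl = K , grow-refl , (λ ()) , λ ()
    advance K c (_∷_ {i = i} {τ} {τ′} (a , b) ms) at (op , cl)
      with follow K i (at (here refl)) op (crossing-column c (col c) τ τ′ ≤-refl (m≤n+m (col c) 5) ≤-refl b b ≤-refl)
    ... | K₁ , g₁ , op₁ , p with follow K₁ i p op₁ back
      where
      back : Trail (Rect c τ τ′) (5 + col c) τ′ (3 + col c) τ′
      back = go (link-sym (track (4 + col c) τ′ (col>0 4 c))) (rect {c} 4 (s≤s z≤n) (s≤s (s≤s (s≤s (s≤s z≤n)))) b ≤-refl)
            (go (link-sym (track (3 + col c) τ′ (col>0 3 c))) (rect {c} 3 (s≤s z≤n) (s≤s (s≤s (s≤s z≤n))) b ≤-refl) done)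
    ...   | K₂ , g₂ , _ , q with advance K₂ c ms (λ r → C-mono g₂ (C-mono g₁ (at (there r))))
                              (clear-grow ms (grow-trans g₁ g₂) ≤-refl (λ { (_ , _ , _ , d) → d }) cl)
    ...     | K₃ , g₃ , at₅ , at₃ = K₃ ,
        grow-trans (grow-weaken (on-mono λ { (x , y , z , _) → x , y , ≤-trans a z }) (grow-trans g₁ g₂))
                   (grow-weaken (on-mono λ { (x , y , z) → x , y , ≤-trans a (≤-trans b (≤-trans (n≤1+n _) z)) }) g₃) ,
        (λ { (here refl) → C-mono g₃ (C-mono g₂ p) ; (there r) → at₅ r }) ,
        (λ { (here refl) → C-mono g₃ q ; (there r) → at₃ r })

-- Loop erasure

module Erasing (G : Graph) (_≟_ : DecidableEquality (V G)) where
  open Walks G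
  open Lines G _≟_

  suffix : ∀ {u w l v} → Walk w l v → Unique (w ∷ l) → u ∈ w ∷ l → ∃ λ l′ → Walk u l′ v × (∀ {z} → z ∈ l′ → z ∈ l) × Unique (u ∷ l′)
  suffix {l = l} walk un (here refl) = l , walk , (λ p → p) , un
  suffix (a ∷ walk) (_ ∷ un) (there p) with suffix walk un p
  ... | l′ , walk′ , sub , un′ = l′ , walk′ , (λ q → there (sub q)) , un′

  erase : ∀ {u l v} → Walk u l v → ∃ λ l′ → Walk u l′ v × (∀ {z} → z ∈ l′ → z ∈ l) × Unique (u ∷ l′)
  erase (step a) = [] , step a , (λ ()) , [] ∷ []
  erase {u} (_∷_ {w = w} a walk) with erase walk
  ... | l′ , walk′ , sub , un with u ∈? w ∷ l′
  ...   | no u∉ = w ∷ l′ , a ∷ walk′ , (λ { (here e) → here e ; (there p) → there (sub p) }) , ¬Any⇒All¬ _ u∉ ∷ un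
  ...   | yes u∈ with suffix walk′ un u∈
  ...     | l″ , walk″ , sub″ , un″ = l″ , walk″ , (λ p → there (sub (sub″ p))) , un″

  unique-reverse : ∀ (l : List (V G)) → Unique l → Unique (reverse l)
  unique-reverse [] un = []
  unique-reverse (x ∷ l) (x∉ ∷ un) = subst Unique (sym (unfold-reverse x l))
    (Uniq.++⁺ (unique-reverse l un) ([] ∷ []) λ { (p , here refl) → All¬⇒¬Any x∉ (∈-reverse⁻ l p) })

  to-path : ∀ {u l v} → Walk u l v → Unique l → u ∉ l → v ∉ l → u ≢ v → Path G u v
  to-path {u} {l} {v} walk un u∉ v∉ u≢v = record
    { interior = l ; linked = toLinked walk
    ; distinct = Uniq.++⁺ (¬Any⇒All¬ l u∉ ∷ un) ([] ∷ []) λ { (here e , here e′) → u≢v (trans (sym e) e′) ; (there p , here refl) → v∉ p } }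


locate : ∀ a b n → a ≤ b → col a < n → n ≤ col b → ∃ λ d → a ≤ d × d < b × col d < n × n ≤ 5 + col d
locate a b n p q r with m≤n⇒m<n∨m≡n p
... | inj₂ refl = ⊥-elim (<-irrefl refl (≤-trans q r))
locate a (suc b) n p q r | inj₁ (s≤s a≤b) with n ≤? col b
... | no  n≰ = b , a≤b , ≤-refl , ≰⇒> n≰ , r
... | yes n≤ with locate a b n a≤b q n≤
...   | d , x , y , z , w = d , x , m≤n⇒m≤1+n y , z , w

col-mono : ∀ {c d} → c ≤ d → col c ≤ col d
col-mono {zero}  {zero}  p = ≤-refl
col-mono {zero}  {suc d} p = ≤-trans (col-mono {zero} {d} z≤n) (m≤n+m (col d) 5)
col-mono {suc c} {suc d} (s≤s p) = +-monoʳ-≤ 5 (col-mono p)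

col-unique : ∀ {c d n} → col c < n → n ≤ 5 + col c → col d < n → n ≤ 5 + col d → c ≡ d
col-unique {c} {d} p q p′ q′ with <-cmp c d
... | tri≈ _ e _ = e
... | tri< lt _ _ = ⊥-elim (<-irrefl refl (≤-trans (≤-trans p′ q) (col-mono lt)))
... | tri> _ _ gt = ⊥-elim (<-irrefl refl (≤-trans (≤-trans p q′) (col-mono gt)))

-- Lines travelling through a partly occupied grid

module Machine (wlem : (P : Set) → ¬ P ⊎ ¬ ¬ P) (G : Graph) (_≟_ : DecidableEquality (V G)) (φ : ℕ → ℕ → V G)
  (φ-inj : ∀ {n t n′ t′} → φ n t ≡ φ n′ t′ → n ≡ n′ × t ≡ t′)
  (track : ∀ n t → 0 < n → Grid.Link G _≟_ φ φ-inj (φ n t) (φ (suc n) t))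
  (rungᵃ : ∀ c t → Grid.Link G _≟_ φ φ-inj (φ (col c) (suc t)) (φ (1 + col c) t))
  (rungᵈ : ∀ c t → Grid.Link G _≟_ φ φ-inj (φ (3 + col c) t) (φ (5 + col c) (suc t))) where
  open Walks G public
  open Lines G _≟_ public
  open Grid G _≟_ φ φ-inj public
  open Moves track rungᵃ rungᵈ public
  open Pigeonhole wlem public

  Vs : Set
  Vs = List (V G)

  -- W lists the vertices in use that may lie on tracks further to the right.
  Ahead : Config → ℕ → Vs → Set
  Ahead K c W = ∀ n t → col c < n → φ n t ∈ U K → φ n t ∈ W

  Upto : ℕ → ℕ → ℕ → Set
  Upto c n t = n ≤ col c

  record Moved (K : Config) (c′ : ℕ) (hs : Heads) : Set where
    field
      K′   : Config
      grow : Grow K K′ (On (Upto c′))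
      at   : At K′ (col c′) hs

  ahead-grow : ∀ {K K′ c c′ W} → c ≤ c′ → Grow K K′ (On (Upto c′)) → Ahead K c W → Ahead K′ c′ W
  ahead-grow {c′ = c′} p g a n t lt u with news g u
  ... | inj₁ old = a n t (≤-trans (s≤s (col-mono p)) lt) old
  ... | inj₂ o   = ⊥-elim (<-irrefl refl (≤-trans lt (on-track {Upto c′} o)))

  FreeRows : (ℕ → Set) → ∀ {lo hs hs′} → Shift lo hs hs′ → Set
  FreeRows P [] = ⊤
  FreeRows P (_∷_ {τ = τ} {τ′} _ ms) = (∀ t → τ ≤ t → t ≤ τ′ → P t) × FreeRows P ms

  clear : ∀ {K c W lo hs hs′} (ms : Shift lo hs hs′) → Ahead K c W →
          FreeRows (λ t → ∀ n → col c < n → n ≤ 5 + col c → φ n t ∉ W) ms → Clear K c ms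
  clear [] a f = tt
  clear (_ ∷ ms) a (f , fs) = (λ n t r u → ⊥-elim (f t (proj₁ (proj₂ (proj₂ r))) (proj₂ (proj₂ (proj₂ r))) n (proj₁ r) (proj₁ (proj₂ r))
                                   (a n t (proj₁ r) u))) , clear ms a fs

  -- In a sorted list of heads nobody moves, so only the rows of the heads matter.
  stay-free : ∀ {P lo hs} (ms : Sorted lo hs) → (∀ {i τ} → (i , τ) ∈ hs → P τ) → FreeRows P ms
  stay-free [] f = tt
  stay-free {P = P} (_ ∷ ms) f = (λ t a b → subst P (≤-antisym a b) (f (here refl))) , stay-free ms (λ p → f (there p))

  bounded-free : ∀ {P H lo hs hs′} (ms : Shift lo hs hs′) → (∀ t → t < H → P t) → (∀ {i τ} → (i , τ) ∈ hs′ → τ < H) → FreeRows P ms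
  bounded-free [] f b = tt
  bounded-free (_ ∷ ms) f b = (λ t _ q → f t (≤-trans (s≤s q) (b (here refl)))) , bounded-free ms f (λ p → b (there p))

  record Column (K : Config) (c : ℕ) (hs : Heads) : Set where
    field
      moved : Moved K (suc c) hs
      at₃   : At (Moved.K′ moved) (3 + col c) hs

  column : ∀ {K c lo hs hs′} (ms : Shift lo hs hs′) → At K (col c) hs → Clear K c ms → Column K c hs′
  column {K} {c} ms at cl with advance K c ms at cl
  ... | K′ , g , at₅ , at₃ = record { moved = record { K′ = K′ ; grow = grow-weaken (on-mono λ (_ , b , _) → b) g ; at = at₅ } ; at₃ = at₃ }

  then : ∀ {K c c′ hs hs′} (M : Moved K c hs) → c ≤ c′ → Moved (Moved.K′ M) c′ hs′ → Moved K c′ hs′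
  then M p N = record { K′ = Moved.K′ N ; grow = grow-trans (grow-weaken (on-mono λ q → ≤-trans q (col-mono p)) (Moved.grow M)) (Moved.grow N) ; at = Moved.at N }

  Clean : Vs → ℕ → ℕ → ℕ → Set
  Clean W c c′ t = ∀ n → col c < n → n ≤ col c′ → φ n t ∉ W

  travel : ∀ {K W lo hs} d c → Sorted lo hs → At K (col c) hs → Ahead K c W → (∀ {i τ} → (i , τ) ∈ hs → Clean W c (d + c) τ) →
           Moved K (d + c) hs
  travel {K} zero c so at ah cl = record { K′ = K ; grow = grow-refl ; at = at }
  travel {K} {W} (suc d) c so at ah cl = then M (n≤1+n _)
    (Column.moved (column so (Moved.at M) (clear so (ahead-grow (m≤n+m c d) (Moved.grow M) ah)
      (stay-free so λ p n a b → cl p n (≤-trans (s≤s (col-mono (m≤n+m c d))) a) b))))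
    where
    M : Moved K (d + c) _
    M = travel d c so at ah λ p n a b → cl p n a (≤-trans b (m≤n+m (col (d + c)) 5))

  abstract
    travel-to : ∀ {K W lo hs c c′} → c ≤ c′ → Sorted lo hs → At K (col c) hs → Ahead K c W →
                (∀ {i τ} → (i , τ) ∈ hs → Clean W c c′ τ) → Moved K c′ hs
    travel-to {K} {W} {hs = hs} {c} {c′} p so at ah cl =
      subst (λ e → Moved K e hs) (m∸n+n≡m p) (travel (c′ ∸ c) c so at ah λ q → subst (λ e → Clean W c e _) (sym (m∸n+n≡m p)) (cl q))

  -- Lines with rows below β and their target rows above β, followed by lines that stay where they are.
  data Targets (β : ℕ) (P : ℕ → Set) : ℕ → Heads → Heads → Set where
    stop : ∀ {lo hs} → Sorted lo hs → (∀ {i τ} → (i , τ) ∈ hs → P τ) → Targets β P lo hs hs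
    _∷_  : ∀ {lo i τ τ′ hs hs′} → τ < β × β ≤ τ′ × lo ≤ τ′ × P τ′ → Targets β P (suc τ′) hs hs′ → Targets β P lo ((i , τ) ∷ hs) ((i , τ′) ∷ hs′)

  steps : ∀ {β P lo hs hs′} → Targets β P lo hs hs′ → ℕ
  steps (stop _ _) = 0
  steps (_ ∷ ts)   = suc (steps ts)

  targets-sorted : ∀ {β P lo hs hs′} → Targets β P lo hs hs′ → Sorted lo hs′
  targets-sorted (stop so _) = so
  targets-sorted ((_ , _ , a , _) ∷ ts) = (a , ≤-refl) ∷ targets-sorted ts

  targets-P : ∀ {β P lo hs hs′ i τ} → Targets β P lo hs hs′ → (i , τ) ∈ hs′ → P τ
  targets-P (stop _ f) q = f q
  targets-P ((_ , _ , _ , p) ∷ ts) (here refl) = p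
  targets-P (_ ∷ ts) (there q) = targets-P ts q

  targets-mono : ∀ {β P Q lo hs hs′} → (∀ {t} → P t → Q t) → Targets β P lo hs hs′ → Targets β Q lo hs hs′
  targets-mono f (stop so g) = stop so (λ p → f (g p))
  targets-mono f ((a , b , c , d) ∷ ts) = (a , b , c , f d) ∷ targets-mono f ts

  sorted-weaken : ∀ {lo lo′ hs hs′} → lo ≤ lo′ → Shift lo′ hs hs′ → Shift lo hs hs′
  sorted-weaken p [] = []
  sorted-weaken p ((a , b) ∷ so) = (≤-trans p a , b) ∷ so

  raise : ∀ {lo β i τ τ′ hs hs′} pre → Sorted lo (pre ++ (i , τ) ∷ hs) → (∀ {j σ} → (j , σ) ∈ pre → σ < β) → τ ≤ τ′ →
          β ≤ τ′ → Sorted (suc τ′) hs′ → Shift lo (pre ++ (i , τ) ∷ hs′) (pre ++ (i , τ′) ∷ hs′)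
  raise [] ((a , _) ∷ _) b q p so = (a , q) ∷ so
  raise (x ∷ pre) (a ∷ so′) b q p so = a ∷ raise pre so′ (λ r → b (there r)) q p so

  -- The lines are raised to their target rows one after the other, the uppermost one first.
  fan : ∀ {K W lo lo′ β H hs hs′} pre c (ts : Targets β (_< H) lo′ hs hs′) → Sorted lo (pre ++ hs) → (∀ {j σ} → (j , σ) ∈ pre → σ < β) → β ≤ H →
        At K (col c) (pre ++ hs) → Ahead K c W → (∀ t → t < H → Clean W c (steps ts + c) t) → Moved K (steps ts + c) (pre ++ hs′)
  fan {K} pre c (stop _ _) so b βH at ah cl = record { K′ = K ; grow = grow-refl ; at = at }
  fan {K} {W} {lo} {β = β} {H} {(i , τ) ∷ hs} {(_ , τ′) ∷ hs′} pre c ((τ<β , β≤τ′ , p , q) ∷ ts) so b βH at ah cl =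
    then M (n≤1+n (steps ts + c)) (Column.moved (column ms at′ (clear ms (ahead-grow (m≤n+m c (steps ts)) (Moved.grow M) ah)
      (bounded-free ms (λ t lt n a z → cl t lt n (≤-trans (s≤s (col-mono (m≤n+m c (steps ts)))) a) z) below))))
    where
    assoc : ∀ (l : Heads) → (pre ++ (i , τ) ∷ []) ++ l ≡ pre ++ (i , τ) ∷ l
    assoc l = ++-assoc pre _ l
    b′ : ∀ {j σ} → (j , σ) ∈ pre ++ (i , τ) ∷ [] → σ < β
    b′ r with ∈-++⁻ pre r
    ... | inj₁ s           = b s
    ... | inj₂ (here refl) = τ<β
    M : Moved K (steps ts + c) ((pre ++ (i , τ) ∷ []) ++ hs′)
    M = fan (pre ++ (i , τ) ∷ []) c ts (subst (Sorted lo) (sym (assoc hs)) so) b′ βH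
          (λ r → at (subst (_ ∈_) (assoc hs) r)) ah (λ t lt n a z → cl t lt n a (≤-trans z (m≤n+m (col (steps ts + c)) 5)))
    ms : Shift lo (pre ++ (i , τ) ∷ hs′) (pre ++ (i , τ′) ∷ hs′)
    ms = raise pre so b (≤-trans (<⇒≤ τ<β) β≤τ′) β≤τ′ (targets-sorted ts)
    at′ : At (Moved.K′ M) (col (steps ts + c)) (pre ++ (i , τ) ∷ hs′)
    at′ r = Moved.at M (subst (_ ∈_) (sym (assoc hs′)) r)
    below : ∀ {j σ} → (j , σ) ∈ pre ++ (i , τ′) ∷ hs′ → σ < H
    below r with ∈-++⁻ pre r
    ... | inj₁ s           = ≤-trans (b s) βH
    ... | inj₂ (here refl) = q
    ... | inj₂ (there s)   = targets-P ts s

  FreeRow : Vs → ℕ → ℕ → Set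
  FreeRow W c t = ∀ n → col c < n → φ n t ∉ W

  FreeColumn : Vs → ℕ → Set
  FreeColumn W c = ∀ n t → col c < n → n ≤ 5 + col c → φ n t ∉ W

  freeRow-later : ∀ {W c c′ t} → c ≤ c′ → FreeRow W c t → FreeRow W c′ t
  freeRow-later p f n lt = f n (≤-trans (s≤s (col-mono p)) lt)

  pick-row : ∀ W c β → ∃ λ t → β ≤ t × t ≤ β + length W × FreeRow W c t
  pick-row W c β with avoiding W (λ i x → ∃ λ n → col c < n × x ≡ φ n (i + β))
                        (λ { {i} {j} (_ , _ , e) (_ , _ , e′) → +-cancelʳ-≡ β i j (proj₂ (φ-inj (trans (sym e) e′))) })
  ... | i , p , free = i + β , m≤n+m β i , subst (_≤ β + length W) (+-comm β i) (+-monoʳ-≤ β p) , λ n lt w → free w (n , lt , refl)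

  -- Every line gets a window of `suc (length W)` rows, one of which is free because a vertex lies
  -- in at most one row. This is the product in the bound.
  pick-rows : ∀ {P : ℕ → Set} W c β₀ β β′ hs suf → β₀ ≤ β → β + length hs * suc (length W) ≤ β′ → (∀ {i τ} → (i , τ) ∈ hs → τ < β₀) →
              (∀ t → t < β′ → FreeRow W c t → P t) → Sorted β′ suf → (∀ {i τ} → (i , τ) ∈ suf → P τ) →
              ∃ λ hs′ → Σ (Targets β₀ P β (hs ++ suf) (hs′ ++ suf)) λ ts → steps ts ≡ length hs × map proj₁ hs′ ≡ map proj₁ hs ×
                (∀ {i τ} → (i , τ) ∈ hs′ → τ < β′)
  pick-rows W c β₀ β β′ [] suf z b r f so g = [] , stop (sorted-weaken (≤-trans (m≤m+n β 0) b) so) g , refl , refl , λ ()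
  pick-rows {P} W c β₀ β β′ ((i , τ) ∷ hs) suf z b r f so g with pick-row W c β
  ... | t , p , q , free with pick-rows {P} W c β₀ (suc t) β′ hs suf (≤-trans z (m≤n⇒m≤1+n p)) bound (λ s → r (there s)) f so g
    where
    bound : suc t + length hs * suc (length W) ≤ β′
    bound = ≤-trans (+-monoˡ-≤ (length hs * suc (length W)) (≤-trans (s≤s q) (≤-reflexive (sym (+-suc β (length W))))))
            (≤-trans (≤-reflexive (+-assoc β _ _)) b)
  ...   | hs′ , ts , e , ids , below = (i , t) ∷ hs′ , (r (here refl) , ≤-trans z p , p , f t first free) ∷ ts , cong suc e , cong (i ∷_) ids ,
            λ { (here refl) → first ; (there s) → below s }
    where
    first : t < β′
    first = ≤-trans (s≤s q) (≤-trans (≤-reflexive (sym (+-suc β (length W)))) (≤-trans (+-monoʳ-≤ β (m≤m+n _ _)) b))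

  -- The columns from `c` on are cut into blocks of `M`. A vertex of `W` spoils at most one block,
  -- so some block is free.
  pick-columns : ∀ W c M → ∃ λ s → c ≤ s × (∀ d → s ≤ d → d < M + s → FreeColumn W d)
  pick-columns W c M with avoiding W (λ i x → ∃ λ d → i * M + c ≤ d × d < M + (i * M + c) × ∃ λ n → ∃ λ t → col d < n × n ≤ 5 + col d × x ≡ φ n t) blocks-disjoint
    where
    later : ∀ {i j} → i < j → M + (i * M + c) ≤ j * M + c
    later {i} {j} lt = ≤-trans (≤-reflexive (sym (+-assoc M (i * M) c))) (+-monoˡ-≤ c (*-monoˡ-≤ M lt))
    blocks-disjoint : ∀ {i j x} → (∃ λ d → i * M + c ≤ d × d < M + (i * M + c) × ∃ λ n → ∃ λ t → col d < n × n ≤ 5 + col d × x ≡ φ n t) →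
           (∃ λ d → j * M + c ≤ d × d < M + (j * M + c) × ∃ λ n → ∃ λ t → col d < n × n ≤ 5 + col d × x ≡ φ n t) → i ≡ j
    blocks-disjoint {i} {j} (d , a , b , n , t , p , q , e) (d′ , a′ , b′ , n′ , t′ , p′ , q′ , e′) with φ-inj (trans (sym e) e′)
    ... | refl , refl with col-unique {d} {d′} p q p′ q′
    ...   | refl with <-cmp i j
    ...     | tri≈ _ r _ = r
    ...     | tri< lt _ _ = ⊥-elim (<-irrefl refl (≤-trans b (≤-trans (later lt) a′)))
    ...     | tri> _ _ gt = ⊥-elim (<-irrefl refl (≤-trans b′ (≤-trans (later gt) a)))
  ... | i , _ , free = i * M + c , m≤n+m c (i * M) , λ d a b n t p q w → free w (d , a , b , n , t , p , q , refl)

  Avoidable : V G → V G → Set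
  Avoidable x y = (D : Vs) → ∃ λ l → Walk x l y × (∀ {z} → z ∈ l → z ∉ D)

  realise : ∀ {x l y} → Route Avoidable x l y → (D : Vs) → ∃ λ m → Walk x m y × (∀ {z} → z ∈ m → z ∈ l ⊎ z ∉ D)
  realise [ r ] D with r D
  ... | m , w , f = m , w , λ p → inj₂ (f p)
  realise (_∷_ {z = z} r rs) D with r D | realise rs D
  ... | m , w , f | m′ , w′ , f′ = m ++ z ∷ m′ , join w w′ , inside
    where
    inside : ∀ {u} → u ∈ m ++ z ∷ m′ → u ∈ z ∷ _ ⊎ u ∉ D
    inside p with ∈-++⁻ m p
    ... | inj₁ q         = inj₂ (f q)
    ... | inj₂ (here e)  = inj₁ (here e)
    ... | inj₂ (there q) = Sum.map₁ there (f′ q)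

  -- What a companion page offers in each cell: a crossing of the two lines through the cell whose new
  -- vertices avoid all tracks in a large box.
  record Cells (j : ℕ) : Set₁ where
    field
      In₁ In₂ : ℕ → ℕ → V G → Set
      In₁-col : ∀ {c c′ t x} → In₁ c t x → In₁ c′ t x → c ≡ c′
      In₂-col : ∀ {c c′ t x} → In₂ c t x → In₂ c′ t x → c ≡ c′
      In₁-off : ∀ {c t x} → In₁ c t x → OffTrack x
      In₂-off : ∀ {c t x} → In₂ c t x → ∀ n t′ → n < j → t′ < j → x ≢ φ n t′
      crossing : ∀ c t → 5 + col c < j → suc t < j → ∃ λ l₁ → ∃ λ l₂ →
                 Route Avoidable (φ (1 + col c) t) l₁ (φ (5 + col c) (suc t)) × Route Avoidable (φ (3 + col c) t) l₂ (φ (col c) (suc t)) ×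
                 (∀ {x} → x ∈ l₁ → In₁ c t x ⊎ In₂ c t x) × (∀ {x} → x ∈ l₂ → In₁ c t x ⊎ In₂ c t x) × (∀ {x} → x ∈ l₁ → x ∉ l₂)

  record Exchange (U₀ : Vs) (j c t : ℕ) : Set where
    field
      {X₁ X₂} : Vs
      walk₁ : Walk (φ (1 + col c) t) X₁ (φ (5 + col c) (suc t))
      walk₂ : Walk (φ (col c) (suc t)) X₂ (φ (3 + col c) t)
      new₁  : ∀ {x} → x ∈ X₁ → x ∉ U₀
      new₂  : ∀ {x} → x ∈ X₂ → x ∉ U₀
      off₁  : ∀ {x} → x ∈ X₁ → ∀ n t′ → n < j → t′ < j → x ≢ φ n t′
      off₂  : ∀ {x} → x ∈ X₂ → ∀ n t′ → n < j → t′ < j → x ≢ φ n t′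
      apart : ∀ {x} → x ∈ X₁ → x ∉ X₂

  box : ℕ → Vs
  box j = map (λ (n , t) → φ n t) (cartesianProduct (upTo j) (upTo j))

  ∈-box : ∀ {j n t} → n < j → t < j → φ n t ∈ box j
  ∈-box p q = ∈-map⁺ _ (∈-cartesianProduct⁺ (∈-upTo⁺ p) (∈-upTo⁺ q))

  exchange : ∀ {j} (cells : Cells j) (U₀ : Vs) → ∀ c t → 5 + col c < j → suc t < j →
             (∀ {x} → x ∈ U₀ → ¬ Cells.In₁ cells c t x × ¬ Cells.In₂ cells c t x) → Exchange U₀ j c t
  exchange {j} cells U₀ c t p q outside with Cells.crossing cells c t p q
  -- The first walk must miss the fixed vertices `l₂` of the second route, which cannot be moved
  -- later. The second walk then avoids the entire first one.
  ... | l₁ , l₂ , r₁ , r₂ , in₁ , in₂ , d with realise r₁ ((U₀ ++ box j) ++ l₂)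
  ...   | X₁ , w₁ , f₁ with realise r₂ ((U₀ ++ box j) ++ X₁)
  ...     | X₂ , w₂ , f₂ = record
    { walk₁ = w₁ ; walk₂ = walk-reverse w₂
    ; new₁ = λ x∈ u → new in₁ (f₁ x∈) u ; new₂ = λ x∈ u → new in₂ (f₂ (∈-reverse⁻ X₂ x∈)) u
    ; off₁ = λ x∈ → off in₁ (f₁ x∈) ; off₂ = λ x∈ → off in₂ (f₂ (∈-reverse⁻ X₂ x∈))
    ; apart = λ x∈ y∈ → apart x∈ (f₂ (∈-reverse⁻ X₂ y∈)) }
    where
    open Cells cells
    new : ∀ {x l D} → (∀ {x} → x ∈ l → In₁ c t x ⊎ In₂ c t x) → x ∈ l ⊎ x ∉ (U₀ ++ box j) ++ D → x ∉ U₀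
    new i (inj₁ x∈) u with i x∈
    ... | inj₁ z = proj₁ (outside u) z
    ... | inj₂ z = proj₂ (outside u) z
    new i (inj₂ n) u = n (∈-++⁺ˡ (∈-++⁺ˡ u))
    off : ∀ {x l D} → (∀ {x} → x ∈ l → In₁ c t x ⊎ In₂ c t x) → x ∈ l ⊎ x ∉ (U₀ ++ box j) ++ D → ∀ n t′ → n < j → t′ < j → x ≢ φ n t′
    off i (inj₁ x∈) n t′ a b with i x∈
    ... | inj₁ z = In₁-off z n t′
    ... | inj₂ z = In₂-off z n t′ a b
    off i (inj₂ ne) n t′ a b refl = ne (∈-++⁺ˡ (∈-++⁺ʳ U₀ (∈-box a b)))
    apart : ∀ {x} → x ∈ X₁ → x ∈ l₂ ⊎ x ∉ (U₀ ++ box j) ++ X₁ → ⊥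
    apart x∈ (inj₂ n) = n (∈-++⁺ʳ (U₀ ++ box j) x∈)
    apart x∈ (inj₁ y) with f₁ x∈
    ... | inj₁ z = d z y
    ... | inj₂ n = n (∈-++⁺ʳ (U₀ ++ box j) y)

  -- Every vertex in use lies in at most two of the candidate cells.
  candidate : ∀ {j} → (cells : Cells j) → (U₀ : Vs) → ∀ s t → ∃ λ i → i ≤ length U₀ + length U₀ ×
              (∀ {x} → x ∈ U₀ → ¬ Cells.In₁ cells (i + s) t x × ¬ Cells.In₂ cells (i + s) t x)
  candidate cells U₀ s t with avoiding (map inj₁ U₀ ++ map inj₂ U₀) Hit (λ {i} {j} {x} → disjoint {i} {j} {x})
    where
    Hit : ℕ → V G ⊎ V G → Set
    Hit i (inj₁ x) = Cells.In₁ cells (i + s) t x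
    Hit i (inj₂ x) = Cells.In₂ cells (i + s) t x
    disjoint : ∀ {i j x} → Hit i x → Hit j x → i ≡ j
    disjoint {i} {j} {inj₁ x} p q = +-cancelʳ-≡ s i j (Cells.In₁-col cells p q)
    disjoint {i} {j} {inj₂ x} p q = +-cancelʳ-≡ s i j (Cells.In₂-col cells p q)
  ... | i , p , free = i , ≤-trans p (≤-reflexive (trans (length-++ (map inj₁ U₀)) (cong₂ _+_ (length-map inj₁ U₀) (length-map inj₂ U₀)))) ,
        λ u → free (∈-++⁺ˡ (∈-map⁺ inj₁ u)) , free (∈-++⁺ʳ (map inj₁ U₀) (∈-map⁺ inj₂ u))

  record FirstHit (a : V G) (m L : Vs) : Set where
    field
      J      : Vs
      q      : V G
      walk   : Walk a J q
      missed : ∀ {z} → z ∈ J → z ∉ L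
      hit    : q ∈ L
      J⊆     : ∀ {z} → z ∈ q ∷ J → z ∈ m

  first-hit : ∀ {a m b} (L : Vs) → Walk a m b → FirstHit a m L ⊎ (∀ {z} → z ∈ m → z ∉ L)
  first-hit L (step _) = inj₂ λ ()
  first-hit L (_∷_ {w = z} e w) with z ∈? L
  ... | yes p = inj₁ record { J = [] ; q = z ; walk = step e ; missed = λ () ; hit = p ; J⊆ = λ { (here r) → here r } }
  ... | no p with first-hit L w
  ...   | inj₁ h = inj₁ record { J = z ∷ J ; q = q ; walk = e ∷ walk ; hit = hit
                               ; missed = λ { (here refl) → p ; (there r) → missed r }
                               ; J⊆ = λ { (here r) → there (J⊆ (here r)) ; (there (here r)) → here r ; (there (there r)) → there (J⊆ (there r)) } }
    where open FirstHit h
  ...   | inj₂ n = inj₂ λ { (here refl) → p ; (there r) → n r }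

  record State (K : Config) (c : ℕ) (W : Vs) (hs : Heads) : Set where
    field
      sorted : Sorted 0 hs
      at     : At K (col c) hs
      ahead  : Ahead K c W
      free   : ∀ {i τ} → (i , τ) ∈ hs → FreeRow W c τ

  record Evolve (K K′ : Config) : Set where
    field
      up   : ∀ {i x} → x ∈ C K i → x ∈ C K′ i
      dull : ∀ {i} → (∀ {x} → x ∉ C K i) → ∀ {x} → x ∉ C K′ i

  evolve-trans : ∀ {K K′ K″} → Evolve K K′ → Evolve K′ K″ → Evolve K K″
  evolve-trans e f = record { up = λ p → Evolve.up f (Evolve.up e p) ; dull = λ n → Evolve.dull f (Evolve.dull e n) }

  grown : ∀ {K K′ S} → Grow K K′ S → Evolve K K′
  grown g = record { up = C-mono g ; dull = idle g }

  attached : ∀ {K i l v} (A : Attached K i l) → v ∈ C K i → Evolve K (Attached.K′ A)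
  attached A v∈ = record { up = Attached.C-up A ; dull = attached-idle A v∈ }

  ids : Heads → List ℕ
  ids = map proj₁

  -- The entrance for the next new line, which has to start below all others.
  Spare : ℕ → Vs → Heads → Set
  Spare c W hs = ∃ λ r → Sorted (suc r) hs × FreeRow W c r

  -- The tournament rests on `shape`: directly above `x` come the lines that were above `y`, so `x`
  -- can go on to the next of them. Where `y` has gone is immaterial and hidden in `below` and
  -- `tail`.
  record Outcome (K : Config) (x y : ℕ) (hs post : Heads) : Set where
    field
      {K′}       : Config
      {c′}       : ℕ
      {W′}       : Vs
      {hs′}      : Heads
      state      : State K′ c′ W′ hs′
      evolve     : Evolve K K′
      touched    : Touch K′ x y
      below tail : List ℕ
      shape      : ids hs′ ≡ below ++ x ∷ ids post ++ tail
      perm       : ids hs ↭ ids hs′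
      spare      : Spare c′ W′ hs′

  shift-sorted : ∀ {lo hs hs′} → Shift lo hs hs′ → Sorted lo hs′
  shift-sorted [] = []
  shift-sorted ((a , b) ∷ ms) = (≤-trans a b , ≤-refl) ∷ shift-sorted ms

  sorted-below : ∀ {lo i t rest} pre → Sorted lo (pre ++ (i , t) ∷ rest) → lo ≤ t × (∀ {j τ} → (j , τ) ∈ pre → τ < t)
  sorted-below [] ((a , _) ∷ so) = a , λ ()
  sorted-below (_ ∷ pre) ((a , _) ∷ so) with sorted-below pre so
  ... | b , f = ≤-trans a (<⇒≤ b) , λ { (here refl) → b ; (there p) → f p }

  sorted-lo : ∀ {lo hs} → Sorted lo hs → ∀ {j τ} → (j , τ) ∈ hs → lo ≤ τ
  sorted-lo ((a , _) ∷ so) (here refl) = a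
  sorted-lo ((a , _) ∷ so) (there p) = ≤-trans a (<⇒≤ (sorted-lo so p))

  sorted-above : ∀ {lo i t rest} pre → Sorted lo (pre ++ (i , t) ∷ rest) → Sorted (suc t) rest
  sorted-above [] (_ ∷ so) = so
  sorted-above (_ ∷ pre) (_ ∷ so) = sorted-above pre so

  sorted-remove : ∀ {lo h rest} pre → Sorted lo (pre ++ h ∷ rest) → Sorted lo (pre ++ rest)
  sorted-remove [] ((a , _) ∷ so) = sorted-weaken (≤-trans a (n≤1+n _)) so
  sorted-remove (_ ∷ pre) (a ∷ so) = a ∷ sorted-remove pre so

  climb-shift : ∀ {lo x τ y t post} pre → Sorted lo (pre ++ (x , τ) ∷ (y , suc t) ∷ post) →
                Shift lo (pre ++ (x , τ) ∷ (y , suc t) ∷ post) (pre ++ (x , t) ∷ (y , suc t) ∷ post)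
  climb-shift [] ((a , _) ∷ (s≤s b , _) ∷ so) = (a , b) ∷ (≤-refl , ≤-refl) ∷ so
  climb-shift (_ ∷ pre) (a ∷ so) = a ∷ climb-shift pre so

  swap-sorted : ∀ {lo x y t post} pre → Sorted lo (pre ++ (x , t) ∷ (y , suc t) ∷ post) → Sorted lo (pre ++ (y , t) ∷ (x , suc t) ∷ post)
  swap-sorted [] (a ∷ b ∷ so) = a ∷ b ∷ so
  swap-sorted (_ ∷ pre) (a ∷ so) = a ∷ swap-sorted pre so

  sorted-snoc : ∀ {lo hs i τ} → Sorted lo hs → lo ≤ τ → (∀ {j σ} → (j , σ) ∈ hs → σ < τ) → Sorted lo (hs ++ (i , τ) ∷ [])
  sorted-snoc [] p f = (p , ≤-refl) ∷ []
  sorted-snoc (a ∷ so) p f = a ∷ sorted-snoc so (f (here refl)) (λ q → f (there q))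

  top : Heads → ℕ
  top [] = 0
  top ((_ , τ) ∷ hs) = suc τ + top hs

  below-top : ∀ {hs i τ} → (i , τ) ∈ hs → τ < top hs
  below-top (here refl) = m≤m+n _ _
  below-top {(_ , σ) ∷ hs} (there p) = ≤-trans (below-top p) (m≤n+m _ (suc σ))

  OnRow : ℕ → Heads → ℕ → ℕ → Set
  OnRow c hs n t = col c < n × n ≤ 5 + col c × ∃ λ i → (i , t) ∈ hs

  stay : ∀ {lo hs} (K : Config) c (so : Sorted lo hs) → At K (col c) hs → Clear K c so →
         Σ Config λ K′ → Grow K K′ (On (OnRow c hs)) × At K′ (5 + col c) hs
  stay K c [] at cl = K , grow-refl , λ ()
  stay K c (_∷_ {i = i} {τ} (a , _) so) at (op , cl)
    with follow K i (at (here refl)) op (crossing-column c (col c) τ τ ≤-refl (m≤n+m (col c) 5) ≤-refl ≤-refl ≤-refl ≤-refl)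
  ... | K₁ , g₁ , _ , p with stay K₁ c so (λ r → C-mono g₁ (at (there r))) (clear-grow so g₁ ≤-refl (λ { (_ , _ , _ , d) → d }) cl)
  ...   | K₂ , g₂ , at₂ = K₂ ,
          grow-trans (grow-weaken (on-mono λ { (x , y , z , w) → x , y , i , here (cong (i ,_) (≤-antisym w z)) }) g₁)
                     (grow-weaken (on-mono λ { (x , y , j , r) → x , y , j , there r }) g₂) ,
          λ { (here refl) → C-mono g₂ p ; (there r) → at₂ r }

  clear-apart : ∀ {K K′ c lo hs} {S : ℕ → ℕ → Set} (so : Sorted lo hs) → Grow K K′ (On S) →
                (∀ {i τ n} → (i , τ) ∈ hs → ¬ S n τ) → Clear K c so → Clear K′ c so
  clear-apart [] g f cl = tt
  clear-apart {S = S} (_∷_ _ so) g f (op , cl) =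
    open-grow g (λ { {n} (_ , _ , a , b) s → f (here refl) (subst (S n) (≤-antisym b a) s) }) op , clear-apart so g (λ p → f (there p)) cl

  -- A line owning a vertex of the column c leaves the column in the row r′, while all others go straight on.
  board : ∀ {K c W y lo hs n r r′ a b} → Sorted lo hs → At K (col c) hs → Ahead K c W →
          (∀ {i τ} → (i , τ) ∈ hs → Clean W c (suc c) τ) →
          φ n r ∈ C K y → col c < n → n ≤ 5 + col c → a ≤ r → r ≤ b → a ≤ r′ → r′ ≤ b →
          (∀ m t → Rect c a b m t → φ m t ∈ W → φ m t ≡ φ n r) → (∀ {i τ} → (i , τ) ∈ hs → τ < a ⊎ b < τ) →
          Moved K (suc c) ((y , r′) ∷ hs)
  board {K} {c} {W} {y} {n = n} {r} {r′} {a} {b} so at ah cl y∈ c<n n≤ ar rb ar′ rb′ only beside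
    with follow K y y∈ op (crossing-column c n r r′ (<⇒≤ c<n) n≤ ar rb ar′ rb′)
    where
    op : Open K y (Rect c a b)
    op m t re u = subst (_∈ C K y) (sym (only m t re (ah m t (proj₁ re) u))) y∈
  ... | K₁ , g₁ , _ , p with stay K₁ c so (λ q → C-mono g₁ (at q))
                              (clear-apart so g₁ (λ q (_ , _ , z , w) → away (beside q) z w) (clear so ah (stay-free so λ q n → cl q n)))
    where
    away : ∀ {τ} → τ < a ⊎ b < τ → a ≤ τ → τ ≤ b → ⊥
    away (inj₁ z) w _ = <-irrefl refl (≤-trans z w)
    away (inj₂ z) _ w = <-irrefl refl (≤-trans z w)
  ...   | K₂ , g₂ , at₂ = record
          { K′ = K₂ ; grow = grow-trans (grow-weaken (on-mono λ (_ , z , _) → z) g₁) (grow-weaken (on-mono λ (_ , z , _) → z) g₂)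
          ; at = λ { (here refl) → C-mono g₂ p ; (there q) → at₂ q } }

  strip : ℕ → ℕ → ℕ → Vs
  strip a b h = map (λ (n , t) → φ n t) (filter (λ p → a <? proj₁ p) (cartesianProduct (upTo (suc b)) (upTo h)))

  ∈-strip⁺ : ∀ {a b h n t} → a < n → n ≤ b → t < h → φ n t ∈ strip a b h
  ∈-strip⁺ {a} p q r = ∈-map⁺ _ (∈-filter⁺ (λ p → a <? proj₁ p) (∈-cartesianProduct⁺ (∈-upTo⁺ (s≤s q)) (∈-upTo⁺ r)) p)

  ∈-strip⁻ : ∀ {a b h x} → x ∈ strip a b h → ∃ λ n → ∃ λ t → a < n × n ≤ b × t < h × x ≡ φ n t
  ∈-strip⁻ {a} {b} {h} p with ∈-map⁻ _ p
  ... | (n , t) , q , e with ∈-filter⁻ (λ p → a <? proj₁ p) {xs = cartesianProduct (upTo (suc b)) (upTo h)} q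
  ...   | q′ , lt with ∈-cartesianProduct⁻ (upTo (suc b)) (upTo h) q′
  ...     | u , v with ∈-upTo⁻ u
  ...       | s≤s w = n , t , lt , w , ∈-upTo⁻ v , e

  -- Where an exchange takes place: the lower line climbs in column s, the cell used is in column m, and the lanes
  -- behind it are the k columns from l on and the k columns after these.
  record Plan (K : Config) (c : ℕ) (W : Vs) (t k h : ℕ) : Set where
    field
      s m l : ℕ
      c≤s   : c ≤ s
      s<m   : s < m
      m<l   : m < l
    l′ = k + l
    e  = k + l′
    -- The box covers all columns of the plan and all rows below `h`, hence the cell itself and all
    -- rows used before the exchange.
    j  = suc (col e + h)
    field
      free : ∀ d → s ≤ d → d < e → FreeColumn W d
      exch : Exchange (U K) j m t
    open Exchange exch public

    m<e : m < e
    m<e = ≤-trans m<l (≤-trans (m≤n+m l k) (m≤n+m l′ k))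

    free-W : ∀ {n τ} → col s < n → n ≤ col e → φ n τ ∉ W
    free-W {n} {τ} p q with locate s e n (<⇒≤ (<-trans s<m m<e)) p q
    ... | d , x , y , z , w = free d x y n τ z w

  plan : ∀ K c W t k h → (∀ j → Cells j) → suc t < h → Plan K c W t k h
  -- The free block consists of one column for the climb, one candidate cell more than twice the
  -- number of used vertices, and `k + k` columns of lanes.
  plan K c W t k h cells t<h with pick-columns W c (k + (k + (suc (length (U K) + length (U K)) + 1)))
  ... | s , c≤s , free with candidate (cells (suc (col (k + (k + (suc (length (U K) + length (U K)) + suc s))) + h))) (U K) (suc s) t
  ...   | i , i≤ , outside = record
    { s = s ; m = i + suc s ; l = N + suc s ; c≤s = c≤s ; s<m = m≤n+m (suc s) i ; m<l = +-monoˡ-≤ (suc s) (s≤s i≤)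
    ; free = λ d p q → free d p (≤-trans q (≤-reflexive total))
    ; exch = exchange (cells j) (U K) (i + suc s) t (s≤s (≤-trans (col-mono {suc (i + suc s)} (≤-trans (+-monoˡ-≤ (suc s) (s≤s i≤)) (≤-trans (m≤n+m _ k) (m≤n+m _ k)))) (m≤m+n _ h)))
                     (s≤s (≤-trans (<⇒≤ t<h) (m≤n+m h _))) outside }
    where
    N j : ℕ
    N = suc (length (U K) + length (U K))
    j = suc (col (k + (k + (N + suc s))) + h)
    total : k + (k + (N + suc s)) ≡ (k + (k + (N + 1))) + s
    total = let open +-*-Solver in solve 3 (λ k N s → k :+ (k :+ (N :+ (con 1 :+ s))) := (k :+ (k :+ (N :+ con 1))) :+ s) refl k N s

  meet : ∀ {K s hs x y t} (M : Moved K (suc s) hs) → φ (3 + col s) t ∈ C (Moved.K′ M) x → (y , suc t) ∈ hs →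
         Σ (Moved K (suc s) hs) λ M′ → Touch (Moved.K′ M′) x y
  meet {s = s} {x = x} {y} {t} M x∈ y∈ with rungᵈ s t (U (Moved.K′ M))
  ... | l , w , new , off with contact (Moved.K′ M) x x∈ w new
  ...   | K′ , g , z , z∈ , a = record { K′ = K′ ; grow = grow-trans (Moved.grow M) (grow-weaken (λ p → inj₂ (off p)) g)
                                ; at = λ p → C-mono g (Moved.at M p) } , z , _ , z∈ , C-mono g (Moved.at M y∈) , a

  module Step {K : Config} {c : ℕ} {W : Vs} {x τ y t : ℕ} {post : Heads} (pre : Heads)
              (st : State K c W (pre ++ (x , τ) ∷ (y , suc t) ∷ post)) (h k : ℕ)
              (k-length : k ≡ suc (length (pre ++ (x , t) ∷ post)))
              (bound : ∀ {i σ} → (i , σ) ∈ pre ++ (x , τ) ∷ (y , suc t) ∷ post → σ < h)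
              (pl : Plan K c W t k h) where
    open Plan pl
    open State st

    hs hs₁ rest : Heads
    hs   = pre ++ (x , τ) ∷ (y , suc t) ∷ post
    hs₁  = pre ++ (x , t) ∷ (y , suc t) ∷ post
    rest = pre ++ (x , t) ∷ post

    suct<h : suc t < h
    suct<h = bound (∈-++⁺ʳ pre (there (here refl)))

    bound₁ : ∀ {i σ} → (i , σ) ∈ hs₁ → σ < h
    bound₁ p with ∈-++⁻ pre p
    ... | inj₁ q           = bound (∈-++⁺ˡ q)
    ... | inj₂ (here refl) = <-trans ≤-refl suct<h
    ... | inj₂ (there q)   = bound (∈-++⁺ʳ pre (there q))

    rest⊆ : ∀ {i σ} → (i , σ) ∈ rest → (i , σ) ∈ hs₁
    rest⊆ p with ∈-++⁻ pre p
    ... | inj₁ q         = ∈-++⁺ˡ q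
    ... | inj₂ (here e)  = ∈-++⁺ʳ pre (here e)
    ... | inj₂ (there q) = ∈-++⁺ʳ pre (there (there q))

    climbing : Shift 0 hs hs₁
    climbing = climb-shift pre sorted

    sorted₁ : Sorted 0 hs₁
    sorted₁ = shift-sorted climbing

    sorted-rest : Sorted 0 rest
    sorted-rest = subst (Sorted 0) (++-assoc pre _ post)
      (sorted-remove (pre ++ (x , t) ∷ []) (subst (Sorted 0) (sym (++-assoc pre ((x , t) ∷ []) ((y , suc t) ∷ post))) sorted₁))

    Off : Vs → Set
    Off Y = ∀ {z} → z ∈ Y → ∀ n t′ → n < j → t′ < j → z ≢ φ n t′

    -- The vertices `Y` of the intended walk are reserved before the lines approach the cell,
    -- because the links drawn on the way are chosen to avoid only what is in `U`.
    record Ready (Y : Vs) : Set where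
      field
        K′      : Config
        grow    : Grow (reserve K Y) K′ (On (Upto m))
        at′     : At K′ (col m) hs₁
        touched : Touch K′ x y

    in-j : ∀ {n} → n ≤ col e → n < j
    in-j p = s≤s (≤-trans p (m≤m+n (col e) h))

    low-j : ∀ {σ} → σ < h → σ < j
    low-j p = ≤-trans p (≤-trans (m≤n+m h (col e)) (n≤1+n _))

    off-clean : ∀ {Y} → Off Y → ∀ {n σ} → col s < n → n ≤ col e → σ < h → φ n σ ∉ Y ++ W
    off-clean {Y} off a b lt p with ∈-++⁻ Y p
    ... | inj₁ q = off q _ _ (in-j b) (low-j lt) refl
    ... | inj₂ q = free-W a b q

    s≤m : suc s ≤ m
    s≤m = s<m

    reserve-ahead : ∀ Y → Ahead (reserve K Y) c (Y ++ W)
    reserve-ahead Y n t′ a u with ∈-++⁻ Y u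
    ... | inj₁ q = ∈-++⁺ˡ q
    ... | inj₂ q = ∈-++⁺ʳ Y (ahead n t′ a q)

    e≥ : ∀ {d} → d ≤ m → col d ≤ col e
    e≥ p = col-mono (≤-trans p (<⇒≤ m<e))

    approach : (Y : Vs) → Off Y → Moved (reserve K Y) s hs
    approach Y off = travel-to c≤s sorted at (reserve-ahead Y) λ {i} {σ} p n a b q → case p n a b (∈-++⁻ Y q)
      where
      case : ∀ {i σ} → (i , σ) ∈ hs → ∀ n → col c < n → n ≤ col s → φ n σ ∈ Y ⊎ φ n σ ∈ W → ⊥
      case p n a b (inj₁ q) = off q n _ (in-j (≤-trans b (e≥ (≤-trans (n≤1+n s) s≤m)))) (low-j (bound p)) refl
      case p n a b (inj₂ q) = State.free st p n a q

    encounter : (Y : Vs) → Off Y → Moved (reserve K Y) s hs → Σ (Moved (reserve K Y) (suc s) hs₁) λ M → Touch (Moved.K′ M) x y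
    encounter Y off M = meet (then M (n≤1+n s) (Column.moved climbed)) (Column.at₃ climbed (∈-++⁺ʳ pre (here refl))) (∈-++⁺ʳ pre (there (here refl)))
      where
      climbed : Column (Moved.K′ M) s hs₁
      climbed = column climbing (Moved.at M) (clear climbing (ahead-grow c≤s (Moved.grow M) (reserve-ahead Y))
                  (bounded-free climbing (λ σ lt n a b → off-clean off a (≤-trans b (e≥ s≤m)) lt) bound₁))

    proceed : (Y : Vs) → Off Y → (Σ (Moved (reserve K Y) (suc s) hs₁) λ M → Touch (Moved.K′ M) x y) → Ready Y
    proceed Y off (M , tou) = record { K′ = Moved.K′ M₂ ; grow = Moved.grow (then M s≤m M₂) ; at′ = Moved.at M₂ ; touched = touch-mono {Moved.K′ M} {Moved.K′ M₂} {x} {y} (C-mono (Moved.grow M₂)) tou }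
      where
      M₂ : Moved (Moved.K′ M) m hs₁
      M₂ = travel-to {W = Y ++ W} s≤m sorted₁ (Moved.at M) (ahead-grow {c = c} {c′ = suc s} (≤-trans c≤s (n≤1+n s)) (Moved.grow M) (reserve-ahead Y))
             λ p n a b → off-clean off (≤-trans (s≤s (col-mono {s} {suc s} (n≤1+n s))) a) (≤-trans b (e≥ {m} ≤-refl)) (bound₁ p)

    ready : (Y : Vs) → Off Y → Ready Y
    ready Y off = proceed Y off (encounter Y off (approach Y off))

    ready-ahead : ∀ {Y} (r : Ready Y) → Ahead (Ready.K′ r) m (Y ++ W)
    ready-ahead {Y} r = ahead-grow (≤-trans c≤s (<⇒≤ s<m)) (Ready.grow r) (reserve-ahead Y)

    ready-evolve : ∀ {Y} (r : Ready Y) → Evolve K (Ready.K′ r)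
    ready-evolve r = record { up = C-mono (Ready.grow r) ; dull = idle (Ready.grow r) }

    reserved : ∀ {Y K′ S} → Grow (reserve K Y) K′ S → (∀ {z} → z ∈ Y → z ∉ U K) → ∀ {i z} → z ∈ Y → z ∉ C K′ i
    reserved {Y} g new p q with C-new g q
    ... | inj₁ old = new p (C⊆U K old)
    ... | inj₂ n   = n (∈-++⁺ˡ p)

    Y₁₂ W₁ : Vs
    Y₁₂ = X₁ ++ X₂
    W₁  = Y₁₂ ++ W

    off₁₂ : Off Y₁₂
    off₁₂ p with ∈-++⁻ X₁ p
    ... | inj₁ q = off₁ q
    ... | inj₂ q = off₂ q

    new₁₂ : ∀ {z} → z ∈ Y₁₂ → z ∉ U K
    new₁₂ p with ∈-++⁻ X₁ p
    ... | inj₁ q = new₁ q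
    ... | inj₂ q = new₂ q

    -- Old rows lie below `h`. Between `h` and `β₁` there is room for a spare row; the bands from
    -- `β₁` to `mid` and from `mid` to `H` each have room for `k` lines in free rows. The extra
    -- summand `b` in each band lets a single free row be picked from its bottom.
    b β₁ mid′ mid H′ H : ℕ
    b    = length W₁
    β₁   = suc (h + b)
    mid′ = β₁ + b + k * suc b
    mid  = suc mid′
    H′   = mid + b + k * suc b
    H    = suc H′

    5≤e : 5 + col m ≤ col e
    5≤e = col-mono {suc m} {e} m<e

    unused : ∀ {Y} → Off Y → (r : Ready Y) → ∀ {n σ} → col m < n → n ≤ 5 + col m → σ < h → φ n σ ∉ U (Ready.K′ r)
    unused off r a b lt u = off-clean off (≤-trans (s≤s (col-mono (<⇒≤ s<m))) a) (≤-trans b 5≤e) lt (ready-ahead r _ _ a u)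

    others : Heads
    others = pre ++ post

    sorted-others : Sorted 0 others
    sorted-others = sorted-remove pre sorted-rest

    others⊆ : ∀ {i σ} → (i , σ) ∈ others → (i , σ) ∈ hs₁
    others⊆ p with ∈-++⁻ pre p
    ... | inj₁ q = ∈-++⁺ˡ q
    ... | inj₂ q = ∈-++⁺ʳ pre (there (there q))

    others-rows : ∀ {i σ} → (i , σ) ∈ others → σ < t ⊎ suc t < σ
    others-rows p with ∈-++⁻ pre p
    ... | inj₁ q = inj₁ (proj₂ (sorted-below pre sorted₁) q)
    ... | inj₂ q with sorted-above pre sorted₁
    ...   | _ ∷ so = inj₂ (sorted-lo so q)

    others-clear : ∀ {Y} → Off Y → (r : Ready Y) → ∀ {lo hs′} (so : Sorted lo hs′) → (∀ {i σ} → (i , σ) ∈ hs′ → σ < h) → Clear (Ready.K′ r) m so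
    others-clear off r so lt = clear so (ready-ahead r) (stay-free so λ p n a b →
      off-clean off (≤-trans (s≤s (col-mono (<⇒≤ s<m))) a) (≤-trans b 5≤e) (lt p))

    record Swapped : Set where
      field
        K′      : Config
        evolve  : Evolve K K′
        at′     : At K′ (5 + col m) (pre ++ (y , t) ∷ (x , suc t) ∷ post)
        ahead′  : Ahead K′ (suc m) W₁
        touched : Touch K′ x y

    -- After the other lines have passed the column, `x` takes `X₁` from the row `t` up to `D`, and
    -- `y` takes `X₂` down to `E`, from where it continues along the row `t`.
    module Swap (r : Ready Y₁₂) {K₁ K₂ : Config} (g₁ : Grow (Ready.K′ r) K₁ (On (OnRow m others))) (at₁ : At K₁ (5 + col m) others)
                (g₂ : Grow K₁ K₂ (On (λ n σ → n ≡ 1 + col m × σ ≡ t))) (p : φ (1 + col m) t ∈ C K₂ x) where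
      fresh₂ : ∀ {n σ} → col m < n → n ≤ 5 + col m → σ ≡ t ⊎ σ ≡ suc t → ¬ (n ≡ 1 + col m × σ ≡ t) → φ n σ ∉ U K₂
      fresh₂ {n} {σ} a b c ne u with news g₂ u
      ... | inj₂ o = ne (on-track {λ n σ → n ≡ 1 + col m × σ ≡ t} o)
      ... | inj₁ u₁ with news g₁ u₁
      ...   | inj₁ u₀ = unused off₁₂ r a b (row<h c) u₀
        where
        row<h : σ ≡ t ⊎ σ ≡ suc t → σ < h
        row<h (inj₁ refl) = <-trans ≤-refl suct<h
        row<h (inj₂ refl) = suct<h
      ...   | inj₂ o with on-track {OnRow m others} o
      ...     | _ , _ , _ , q with others-rows q
      fresh₂ a b (inj₁ refl) ne u | inj₁ u₁ | inj₂ o | _ , _ , _ , q | inj₁ lt = <-irrefl refl lt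
      fresh₂ a b (inj₂ refl) ne u | inj₁ u₁ | inj₂ o | _ , _ , _ , q | inj₁ lt = <-irrefl refl (<-trans lt ≤-refl)
      fresh₂ a b (inj₁ refl) ne u | inj₁ u₁ | inj₂ o | _ , _ , _ , q | inj₂ lt = <-irrefl refl (<-trans lt ≤-refl)
      fresh₂ a b (inj₂ refl) ne u | inj₁ u₁ | inj₂ o | _ , _ , _ , q | inj₂ lt = <-irrefl refl lt

      g₀ : Grow (reserve K Y₁₂) K₂ (λ _ → ⊤)
      g₀ = grow-trans (grow-weaken (λ _ → tt) (Ready.grow r)) (grow-trans (grow-weaken (λ _ → tt) g₁) (grow-weaken (λ _ → tt) g₂))

      D E : V G
      D = φ (5 + col m) (suc t)
      E = φ (3 + col m) t

      r<5 : ∀ i → i ≤ 5 → i + col m ≤ 5 + col m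
      r<5 i p = +-monoˡ-≤ (col m) p

      m<r : ∀ i → col m < suc i + col m
      m<r i = s≤s (m≤n+m (col m) i)

      D∉ : D ∉ U K₂
      D∉ = fresh₂ (m<r 4) ≤-refl (inj₂ refl) λ (e , _) → <-irrefl (sym e) (s≤s (s≤s (m≤n+m (col m) 3)))

      E∉ : E ∉ U K₂
      E∉ = fresh₂ (m<r 2) (r<5 3 (s≤s (s≤s (s≤s z≤n)))) (inj₁ refl) λ (e , _) → <-irrefl (sym e) (s≤s (s≤s (m≤n+m (col m) 1)))

      inside : ∀ i → i ≤ 5 → i + col m < j
      inside i p = in-j (≤-trans (r<5 i p) 5≤e)

      first : Attached K₂ x (D ∷ X₁)
      first = attach-walk K₂ x p walk₁ λ { (here refl) q → D∉ (C⊆U K₂ q) ; (there z) q → reserved g₀ new₁₂ (∈-++⁺ˡ z) q }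

      after : ∀ {i z} → z ∈ E ∷ X₂ → z ∈ C K₂ i ⊎ (i ≡ x × z ∈ D ∷ X₁) → ⊥
      after (here refl) (inj₁ q) = E∉ (C⊆U K₂ q)
      after (there z)   (inj₁ q) = reserved g₀ new₁₂ (∈-++⁺ʳ X₁ z) q
      after (here refl) (inj₂ (_ , here e)) = <-irrefl (proj₁ (φ-inj e)) (s≤s (s≤s (s≤s (s≤s (m≤n+m (col m) 1)))))
      after (here refl) (inj₂ (_ , there q)) = off₁ q _ _ (inside 3 (s≤s (s≤s (s≤s z≤n)))) (low-j (<-trans ≤-refl suct<h)) refl
      after (there z)   (inj₂ (_ , here e)) = off₂ z _ _ (inside 5 ≤-refl) (low-j suct<h) e
      after (there z)   (inj₂ (_ , there q)) = apart q z

      second : (A₃ : Attached K₂ x (D ∷ X₁)) → φ (col m) (suc t) ∈ C (Attached.K′ A₃) y → Attached (Attached.K′ A₃) y (E ∷ X₂)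
      second A₃ y∈ = attach-walk (Attached.K′ A₃) y y∈ walk₂ λ z q → after z (Attached.C-inv A₃ q)

      End : ℕ → ℕ → Set
      End n σ = 3 + col m < n × n ≤ 5 + col m × σ ≡ t

      module Last (A₃ : Attached K₂ x (D ∷ X₁)) (y∈ : φ (col m) (suc t) ∈ C (Attached.K′ A₃) y)
                  (A₄ : Attached (Attached.K′ A₃) y (E ∷ X₂)) where
        K₄ : Config
        K₄ = Attached.K′ A₄

        U₄ : ∀ {z} → z ∈ U K₄ → z ∈ U K₂ ⊎ z ∈ D ∷ X₁ ⊎ z ∈ E ∷ X₂
        U₄ u with Attached.U-inv A₄ u
        ... | inj₂ q = inj₂ (inj₂ q)
        ... | inj₁ q with Attached.U-inv A₃ q
        ...   | inj₁ q′ = inj₁ q′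
        ...   | inj₂ q′ = inj₂ (inj₁ q′)

        open₄ : Open K₄ y End
        open₄ n σ (a , b , refl) u with U₄ u
        ... | inj₁ q = ⊥-elim (fresh₂ (≤-trans (s≤s (m≤n+m (col m) 3)) a) b (inj₁ refl)
                         (λ (e , _) → <-irrefl (sym e) (≤-trans (s≤s (s≤s (m≤n+m (col m) 2))) a)) q)
        ... | inj₂ (inj₁ (here e)) = ⊥-elim (<-irrefl (proj₂ (φ-inj e)) ≤-refl)
        ... | inj₂ (inj₁ (there q)) = ⊥-elim (off₁ q _ _ (in-j (≤-trans b 5≤e)) (low-j (<-trans ≤-refl suct<h)) refl)
        ... | inj₂ (inj₂ (here e)) = ⊥-elim (<-irrefl (sym (proj₁ (φ-inj e))) a)
        ... | inj₂ (inj₂ (there q)) = ⊥-elim (off₂ q _ _ (in-j (≤-trans b 5≤e)) (low-j (<-trans ≤-refl suct<h)) refl)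

        finish : (Σ Config λ K₅ → Grow K₄ K₅ (On End) × Open K₅ y End × φ (5 + col m) t ∈ C K₅ y) → Swapped
        finish (K₅ , g₅ , _ , q) = record
          { K′ = K₅
          ; evolve = evolve-trans (ready-evolve r) (evolve-trans (grown g₁) (evolve-trans (grown g₂)
                       (evolve-trans (attached A₃ p) (evolve-trans (attached A₄ y∈) (grown g₅)))))
          ; at′ = placed ; ahead′ = far ; touched = touch-mono {Ready.K′ r} {K₅} {x} {y} up₅ (Ready.touched r) }
          where
          up₅ : ∀ {i z} → z ∈ C (Ready.K′ r) i → z ∈ C K₅ i
          up₅ z = C-mono g₅ (Attached.C-up A₄ (Attached.C-up A₃ (C-mono g₂ (C-mono g₁ z))))
          other : ∀ {i σ} → (i , σ) ∈ others → φ (5 + col m) σ ∈ C K₅ i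
          other z = C-mono g₅ (Attached.C-up A₄ (Attached.C-up A₃ (C-mono g₂ (at₁ z))))
          placed : At K₅ (5 + col m) (pre ++ (y , t) ∷ (x , suc t) ∷ post)
          placed z with ∈-++⁻ pre z
          ... | inj₁ z′ = other (∈-++⁺ˡ z′)
          ... | inj₂ (here refl) = q
          ... | inj₂ (there (here refl)) = C-mono g₅ (Attached.C-up A₄ (Attached.into A₃ (here refl)))
          ... | inj₂ (there (there z′)) = other (∈-++⁺ʳ pre z′)
          far : Ahead K₅ (suc m) W₁
          far n σ lt u with news g₅ u
          ... | inj₂ o = ⊥-elim (<-irrefl refl (≤-trans lt (proj₁ (proj₂ (on-track {End} o)))))
          ... | inj₁ u₄ with U₄ u₄
          ...   | inj₂ (inj₁ (here e)) = ⊥-elim (<-irrefl (sym (proj₁ (φ-inj e))) lt)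
          ...   | inj₂ (inj₁ (there z)) = ∈-++⁺ˡ (∈-++⁺ˡ z)
          ...   | inj₂ (inj₂ (here e)) = ⊥-elim (<-irrefl (sym (proj₁ (φ-inj e))) (≤-trans (s≤s (m≤n+m (3 + col m) 2)) lt))
          ...   | inj₂ (inj₂ (there z)) = ∈-++⁺ˡ (∈-++⁺ʳ X₁ z)
          ...   | inj₁ u₂ with news g₂ u₂
          ...     | inj₂ o = ⊥-elim (<-irrefl (sym (proj₁ (on-track {λ n σ → n ≡ 1 + col m × σ ≡ t} o))) (≤-trans (s≤s (s≤s (m≤n+m (col m) 4))) lt))
          ...     | inj₁ u₁ with news g₁ u₁
          ...       | inj₂ o = ⊥-elim (<-irrefl refl (≤-trans lt (proj₁ (proj₂ (on-track {OnRow m others} o)))))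
          ...       | inj₁ u₀ = ready-ahead r n σ (≤-trans (s≤s (m≤n+m (col m) 5)) lt) u₀

        swapped : Swapped
        swapped = finish (follow {End} {3 + col m} {t} {5 + col m} {t} K₄ y (Attached.into A₄ (here refl)) open₄
          (straight 2 (3 + col m) t (s≤s z≤n) λ e lt → s≤s (m≤n+m (3 + col m) e) , s≤s (+-monoˡ-≤ (3 + col m) (≤-pred lt)) , refl))

      end : φ (col m) (suc t) ∈ C K₂ y → Swapped
      end y∈ = Last.swapped first (Attached.C-up first y∈) (second first (Attached.C-up first y∈))

    swapping : Ready Y₁₂ → Swapped
    swapping r with stay (Ready.K′ r) m sorted-others (λ p → Ready.at′ r (others⊆ p)) (others-clear off₁₂ r sorted-others (λ p → bound₁ (others⊆ p)))
    ... | K₁ , g₁ , at₁ with follow-link K₁ x {m = suc (col m)} {t} (C-mono g₁ (Ready.at′ r (∈-++⁺ʳ pre (here refl)))) (track (col m) t (col>0 0 m)) (λ u → ⊥-elim (vacant u))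
      where
      vacant : φ (1 + col m) t ∉ U K₁
      vacant u with news g₁ u
      ... | inj₁ u₀ = unused off₁₂ r ≤-refl (s≤s (m≤n+m (col m) 4)) (<-trans ≤-refl suct<h) u₀
      ... | inj₂ o with on-track {OnRow m others} o
      ...   | _ , _ , _ , q with others-rows q
      ...     | inj₁ lt = <-irrefl refl lt
      ...     | inj₂ lt = <-irrefl refl (<-trans lt ≤-refl)
    ...   | K₂ , g₂ , p = Swap.end r g₁ at₁ g₂ p (C-mono g₂ (C-mono g₁ (Ready.at′ r (∈-++⁺ʳ pre (there (here refl))))))

  steps-mono : ∀ {β P Q lo hs hs′} (f : ∀ {t} → P t → Q t) (ts : Targets β P lo hs hs′) → steps (targets-mono {Q = Q} f ts) ≡ steps ts
  steps-mono f (stop _ _) = refl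
  steps-mono f (_ ∷ ts) = cong suc (steps-mono f ts)

  record Settled (K : Config) (c : ℕ) (W₁ : Vs) (l : ℕ) (hs suf : Heads) (β β′ H : ℕ) : Set where
    field
      hs′     : Heads
      moved   : Moved K (length hs + c) (hs′ ++ suf)
      ids≡    : ids hs′ ≡ ids hs
      ordered : Sorted β (hs′ ++ suf)
      free-rows    : ∀ {i σ} → (i , σ) ∈ hs′ ++ suf → σ < H × FreeRow W₁ l σ
      low     : ∀ {i σ} → (i , σ) ∈ hs′ → σ < β′

  -- Raising costs one column per line, so `k` columns of lanes are enough to spread all lines to
  -- rows that are free of `W₁` for good.
  settle : ∀ {K c W} W₁ l hs suf β₀ β β′ H → Sorted 0 (hs ++ suf) → (∀ {i σ} → (i , σ) ∈ hs → σ < β₀) → β₀ ≤ β →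
           β + length hs * suc (length W₁) ≤ β′ → β′ ≤ H → Sorted β′ suf → (∀ {i σ} → (i , σ) ∈ suf → σ < H × FreeRow W₁ l σ) →
           At K (col c) (hs ++ suf) → Ahead K c W → (∀ σ → σ < H → Clean W c (length hs + c) σ) → Settled K c W₁ l hs suf β β′ H
  settle {K} {c} {W} W₁ l hs suf β₀ β β′ H so lt p room q sos rs at ah cl
    with pick-rows {λ σ → σ < H × FreeRow W₁ l σ} W₁ l β₀ β β′ hs suf p room lt (λ σ z f → ≤-trans z q , f) sos rs
  ... | hs′ , ts , e , i , below = record
    { hs′ = hs′ ; moved = subst (λ d → Moved K (d + c) (hs′ ++ suf)) len
        (fan [] c ts′ so (λ ()) (≤-trans p (≤-trans (≤-trans (m≤m+n β _) room) q)) at ah λ σ z n a b → cl σ z n a (subst (λ d → n ≤ col (d + c)) len b))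
    ; ids≡ = i ; ordered = targets-sorted ts ; free-rows = targets-P ts ; low = below }
    where
    ts′ : Targets β₀ (_< H) β (hs ++ suf) (hs′ ++ suf)
    ts′ = targets-mono proj₁ ts
    len : steps ts′ ≡ length hs
    len = trans (steps-mono proj₁ ts) e

  module Finale {K : Config} {c : ℕ} {W : Vs} {x τ y t : ℕ} {post : Heads} (pre : Heads)
                (st : State K c W (pre ++ (x , τ) ∷ (y , suc t) ∷ post)) (h k : ℕ)
                (k-length : k ≡ suc (length (pre ++ (x , t) ∷ post)))
                (bound : ∀ {i σ} → (i , σ) ∈ pre ++ (x , τ) ∷ (y , suc t) ∷ post → σ < h)
                (pl : Plan K c W t k h) where
    open Plan pl
    open Step pre st h k k-length bound pl public

    ids-hs : ids hs ≡ ids pre ++ x ∷ y ∷ ids post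
    ids-hs = map-++ proj₁ pre _

    ids-rest : ids rest ≡ ids pre ++ x ∷ ids post
    ids-rest = map-++ proj₁ pre _

    s<suc-m : ∀ {n} → col (suc m) < n → col s < n
    s<suc-m = ≤-trans (s≤s (col-mono {s} {suc m} (≤-trans (<⇒≤ s<m) (n≤1+n m))))

    s<l : ∀ {n d} → l ≤ d → col d < n → col s < n
    s<l {d = d} p = ≤-trans (s≤s (col-mono {s} {d} (≤-trans (<⇒≤ s<m) (≤-trans (<⇒≤ m<l) p))))

    β₁≤mid : β₁ + b ≤ mid′
    β₁≤mid = m≤m+n (β₁ + b) (k * suc b)

    room-low : ∀ {n} → n ≤ k → β₁ + n * suc b ≤ mid
    room-low p = ≤-trans (+-mono-≤ (m≤m+n β₁ b) (*-monoˡ-≤ (suc b) p)) (n≤1+n _)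

    room-high : ∀ {n} → n ≤ k → mid + n * suc b ≤ H
    room-high p = ≤-trans (+-mono-≤ (m≤m+n mid b) (*-monoˡ-≤ (suc b) p)) (n≤1+n _)

    mid≤H : mid ≤ H
    mid≤H = ≤-trans (m≤m+n mid b) (≤-trans (m≤m+n _ (k * suc b)) (n≤1+n _))

    h≤β₁ : h ≤ β₁
    h≤β₁ = ≤-trans (m≤m+n h b) (n≤1+n _)

    h≤mid : h ≤ mid
    h≤mid = ≤-trans h≤β₁ (≤-trans (m≤m+n β₁ b) (≤-trans β₁≤mid (n≤1+n _)))

    spare-row : ∃ λ ρ → ρ < β₁ × FreeRow W₁ l ρ
    spare-row with pick-row W₁ l h
    ... | ρ , _ , q , f = ρ , s≤s q , f

    spare-below : ∀ {c′ hs′} → l ≤ c′ → Sorted β₁ hs′ → Spare c′ W₁ hs′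
    spare-below p so with spare-row
    ... | ρ , q , f = ρ , sorted-weaken q so , freeRow-later p f

    lanes : Vs
    lanes = strip (col l) (col e) H

    swapped-heads : Heads
    swapped-heads = pre ++ (y , t) ∷ (x , suc t) ∷ post

    bound₂ : ∀ {i σ} → (i , σ) ∈ swapped-heads → σ < h
    bound₂ p with ∈-++⁻ pre p
    ... | inj₁ q                   = bound (∈-++⁺ˡ q)
    ... | inj₂ (here refl)         = <-trans ≤-refl suct<h
    ... | inj₂ (there (here refl)) = suct<h
    ... | inj₂ (there (there q))   = bound (∈-++⁺ʳ pre (there (there q)))

    length-swapped : length swapped-heads ≡ k
    length-swapped = trans (length-++ pre) (trans (+-suc (length pre) _) (trans (cong suc (sym (length-++ pre))) (sym k-length)))

    sorted₂ : Sorted 0 swapped-heads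
    sorted₂ = swap-sorted pre sorted₁

    module Missed (miss : ∀ {z} → z ∈ Y₁₂ → z ∉ lanes) (sw : Swapped) where
      open Swapped sw

      M₁ : Moved K′ l swapped-heads
      M₁ = travel-to {W = W₁} m<l sorted₂ at′ ahead′
             λ p n a z → off-clean off₁₂ (s<suc-m a) (≤-trans z (col-mono (≤-trans (m≤n+m l k) (m≤n+m l′ k)))) (bound₂ p)

      to-front : Settled (Moved.K′ M₁) l W₁ l swapped-heads [] β₁ mid H
      to-front = settle {W = W₁} W₁ l swapped-heads [] h β₁ mid H (subst (Sorted 0) (sym (++-identityʳ swapped-heads)) sorted₂) bound₂ h≤β₁
        (room-low (≤-reflexive length-swapped)) mid≤H [] (λ ()) (λ p → Moved.at M₁ (subst (_ ∈_) (++-identityʳ swapped-heads) p))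
        (ahead-grow {c = suc m} {c′ = l} m<l (Moved.grow M₁) ahead′) clean
        where
        clean : ∀ σ → σ < H → Clean W₁ l (length swapped-heads + l) σ
        clean σ lt n a z w with ∈-++⁻ Y₁₂ w
        ... | inj₂ q = free-W (s<l ≤-refl a) z′ q
          where
          z′ : n ≤ col e
          z′ = ≤-trans z (col-mono (≤-trans (+-monoˡ-≤ l (≤-reflexive length-swapped)) (m≤n+m l′ k)))
        ... | inj₁ q = miss q (∈-strip⁺ a (≤-trans z (col-mono (≤-trans (+-monoˡ-≤ l (≤-reflexive length-swapped)) (m≤n+m l′ k)))) lt)

      swap-outcome : Outcome K x y hs post
      swap-outcome = record
        { K′ = Moved.K′ M₂ ; c′ = length swapped-heads + l ; W′ = W₁ ; hs′ = Settled.hs′ to-front ++ [] ; state = record { sorted = sorted-weaken z≤n (Settled.ordered to-front) ; at = Moved.at M₂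
                         ; ahead = ahead-grow {c = l} {c′ = length swapped-heads + l} (m≤n+m l (length swapped-heads)) (Moved.grow M₂) (ahead-grow {c = suc m} {c′ = l} m<l (Moved.grow M₁) ahead′)
                         ; free = λ p → freeRow-later (m≤n+m l (length swapped-heads)) (proj₂ (Settled.free-rows to-front p)) }
        ; evolve = evolve-trans evolve (evolve-trans (grown (Moved.grow M₁)) (grown (Moved.grow M₂)))
        ; touched = touch-mono {K′} {Moved.K′ M₂} {x} {y} (λ p → C-mono (Moved.grow M₂) (C-mono (Moved.grow M₁) p)) touched
        ; below = ids pre ++ y ∷ [] ; tail = []
        ; shape = trans ids-final (sym (trans (++-assoc (ids pre) _ _) (cong (λ v → ids pre ++ y ∷ x ∷ v) (++-identityʳ (ids post)))))
        ; perm = ↭-trans (↭-reflexive ids-hs) (↭-trans (++⁺ˡ (ids pre) (↭-swap x y ↭-refl)) (↭-reflexive (sym ids-final)))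
        ; spare = spare-below (m≤n+m l (length swapped-heads)) (Settled.ordered to-front) }
        where
        M₂ = Settled.moved to-front
        ids-final : ids (Settled.hs′ to-front ++ []) ≡ ids pre ++ y ∷ x ∷ ids post
        ids-final = trans (cong ids (++-identityʳ (Settled.hs′ to-front))) (trans (Settled.ids≡ to-front) (map-++ proj₁ pre _))

    -- The exchange hits the lanes: y keeps only the part J of it up to the first vertex q on the lanes.
    record Stranded (q : V G) (J : Vs) : Set where
      field
        K′      : Config
        evolve  : Evolve K K′
        at′     : At K′ (5 + col m) hs₁
        ahead′  : Ahead K′ (suc m) ((q ∷ J) ++ W)
        q∈      : q ∈ C K′ y
        touched : Touch K′ x y

    -- Both walks of the exchange are accessible to `y` along its row: `X₂` starts where `y` enters
    -- the cell, and `X₁`, read backwards, starts where it leaves. Hence a hit on either walk can be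
    -- followed without moving `x`.
    strand : ∀ {a q J} → (∀ {z} → z ∈ q ∷ J → z ∈ Y₁₂) → Walk a J q → a ≡ φ (col m) (suc t) ⊎ a ≡ φ (5 + col m) (suc t) → Stranded q J
    strand {a} {q} {J} sub w end = body (ready (q ∷ J) off)
      where
      off : Off (q ∷ J)
      off p = off₁₂ (sub p)
      y∈ : (y , suc t) ∈ hs₁
      y∈ = ∈-++⁺ʳ pre (there (here refl))
      body : Ready (q ∷ J) → Stranded q J
      body r = body₂ (stay (Ready.K′ r) m sorted₁ (Ready.at′ r) (others-clear off r sorted₁ bound₁))
        where
        body₂ : (Σ Config λ K₁ → Grow (Ready.K′ r) K₁ (On (OnRow m hs₁)) × At K₁ (5 + col m) hs₁) → Stranded q J
        body₂ (K₁ , g₁ , at₁) = body₃ (attach-walk K₁ y (owns end) w (reserved g₀ (λ p → new₁₂ (sub p))))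
          where
          g₀ : Grow (reserve K (q ∷ J)) K₁ (λ _ → ⊤)
          g₀ = grow-trans (grow-weaken (λ _ → tt) (Ready.grow r)) (grow-weaken (λ _ → tt) g₁)
          owns : a ≡ φ (col m) (suc t) ⊎ a ≡ φ (5 + col m) (suc t) → a ∈ C K₁ y
          owns (inj₁ refl) = C-mono g₁ (Ready.at′ r y∈)
          owns (inj₂ refl) = at₁ y∈
          body₃ : Attached K₁ y (q ∷ J) → Stranded q J
          body₃ A = record
            { K′ = Attached.K′ A ; evolve = evolve-trans (ready-evolve r) (evolve-trans (grown g₁) (attached A (owns end)))
            ; at′ = λ p → Attached.C-up A (at₁ p) ; ahead′ = far ; q∈ = Attached.into A (here refl)
            ; touched = touch-mono {Ready.K′ r} {Attached.K′ A} {x} {y} (λ p → Attached.C-up A (C-mono g₁ p)) (Ready.touched r) }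
            where
            far : Ahead (Attached.K′ A) (suc m) ((q ∷ J) ++ W)
            far n σ lt u with Attached.U-inv A u
            ... | inj₂ p = ∈-++⁺ˡ p
            ... | inj₁ u₁ with news g₁ u₁
            ...   | inj₂ o = ⊥-elim (<-irrefl refl (≤-trans lt (proj₁ (proj₂ (on-track {OnRow m hs₁} o)))))
            ...   | inj₁ u₀ = ready-ahead r n σ (≤-trans (s≤s (m≤n+m (col m) 5)) lt) u₀

    rest-bound : ∀ {i σ} → (i , σ) ∈ rest → σ < h
    rest-bound p = bound₁ (rest⊆ p)

    rest-length : length rest ≤ k
    rest-length = ≤-trans (n≤1+n _) (≤-reflexive (sym k-length))

    perm-to : ∀ {us} → us ↭ ids pre ++ x ∷ ids post → ids hs ↭ y ∷ us
    perm-to p = ↭-trans (↭-reflexive ids-hs) (↭-trans (↭-trans (++⁺ˡ (ids pre) (↭-swap x y ↭-refl)) (↭-shift y (ids pre) (x ∷ ids post))) (prep y (↭-sym p)))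

    -- The rest of the exchange is never drawn and `J` misses the lanes, so below `H` the vertex
    -- `φ n r` is the only obstacle on them. It lies in a row `r ≥ h`, since the exchange avoids the
    -- box.
    module Stuck {n r : ℕ} {J : Vs} (S : Stranded (φ n r) J) (sub : ∀ {z} → z ∈ φ n r ∷ J → z ∈ Y₁₂)
                 (missed : ∀ {z} → z ∈ J → z ∉ lanes) {d : ℕ} (l≤d : l ≤ d) (d<e : d < e) (d<n : col d < n) (n≤d : n ≤ 5 + col d) (r<H : r < H) where
      open Stranded S

      W₂ : Vs
      W₂ = (φ n r ∷ J) ++ W

      W₂⊆ : ∀ {z} → z ∈ W₂ → z ∈ W₁
      W₂⊆ p with ∈-++⁻ (φ n r ∷ J) p
      ... | inj₁ q = ∈-++⁺ˡ (sub q)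
      ... | inj₂ q = ∈-++⁺ʳ Y₁₂ q

      n≤e : n ≤ col e
      n≤e = ≤-trans n≤d (col-mono {suc d} {e} d<e)

      h≤r : h ≤ r
      h≤r = ≮⇒≥ λ lt → off₁₂ (sub (here refl)) n r (in-j n≤e) (low-j lt) refl

      lane : ∀ n′ σ → col l < n′ → n′ ≤ col e → σ < H → φ n′ σ ∈ W₂ → φ n′ σ ≡ φ n r
      lane n′ σ a z lt p with ∈-++⁻ (φ n r ∷ J) p
      ... | inj₁ (here e)  = e
      ... | inj₁ (there q) = ⊥-elim (missed q (∈-strip⁺ a z lt))
      ... | inj₂ q         = ⊥-elim (free-W (s<l ≤-refl a) z q)

      clean-low : ∀ {n′ σ} → col s < n′ → n′ ≤ col e → σ < h → φ n′ σ ∉ W₂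
      clean-low = off-clean (λ p → off₁₂ (sub p))

      free-row : ∀ {σ} → FreeRow W₁ l σ → ∀ {n′} → col l < n′ → φ n′ σ ∉ W₂
      free-row f a p = f _ a (W₂⊆ p)

      ahead-W₁ : ∀ {K₁ c₁} → Ahead K₁ c₁ W₂ → Ahead K₁ c₁ W₁
      ahead-W₁ a n′ σ lt u = W₂⊆ (a n′ σ lt u)

      only : ∀ a z → z < H → ∀ n′ σ → Rect d a z n′ σ → φ n′ σ ∈ W₂ → φ n′ σ ≡ φ n r
      only a z z<H n′ σ (p , q , _ , w) = lane n′ σ (≤-trans (s≤s (col-mono l≤d)) p) (≤-trans q (col-mono {suc d} {e} d<e)) (≤-trans (s≤s w) z<H)

      travel-low : ∀ {d′} → suc m ≤ d′ → d′ ≤ e → Moved K′ d′ rest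
      travel-low p q = travel-to {W = W₂} p sorted-rest (λ z → at′ (rest⊆ z)) ahead′ λ z n′ a w → clean-low (s<suc-m a) (≤-trans w (col-mono q)) (rest-bound z)

      -- If `y` re-enters in the first `k` columns of lanes, it goes to the upper band while the
      -- other lines are still below `h`. The last `k` columns serve to spread these over the lower
      -- band.
      module Early (d<l′ : d < l′) where
        ρ : ℕ
        ρ = proj₁ (pick-row W₁ l mid)

        mid≤ρ : mid ≤ ρ
        mid≤ρ = proj₁ (proj₂ (pick-row W₁ l mid))

        ρ<H : ρ < H
        ρ<H = s≤s (≤-trans (proj₁ (proj₂ (proj₂ (pick-row W₁ l mid)))) (m≤m+n (mid + b) (k * suc b)))

        ρ-free : FreeRow W₁ l ρ
        ρ-free = proj₂ (proj₂ (proj₂ (pick-row W₁ l mid)))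

        M₁ : Moved K′ d rest
        M₁ = travel-low (≤-trans m<l l≤d) (<⇒≤ d<e)

        M₂ : Moved K′ (suc d) ((y , ρ) ∷ rest)
        M₂ = then M₁ (n≤1+n d) (board {W = W₂} sorted-rest (Moved.at M₁) (ahead-grow {c = suc m} {c′ = d} (≤-trans m<l l≤d) (Moved.grow M₁) ahead′)
               (λ z n′ a w → clean-low (s<l l≤d a) (≤-trans w (col-mono {suc d} {e} d<e)) (rest-bound z))
               (C-mono (Moved.grow M₁) q∈) d<n n≤d h≤r (≤-pred r<H) (≤-trans h≤mid mid≤ρ) (≤-pred ρ<H) (only h H′ ≤-refl) (λ z → inj₁ (rest-bound z)))

        extended : Heads
        extended = rest ++ (y , ρ) ∷ []

        in-extended : ∀ {i σ} → (i , σ) ∈ extended → (i , σ) ∈ (y , ρ) ∷ rest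
        in-extended p with ∈-++⁻ rest p
        ... | inj₁ z           = there z
        ... | inj₂ (here e)    = here e

        sorted-extended : Sorted 0 extended
        sorted-extended = sorted-snoc sorted-rest z≤n λ z → ≤-trans (rest-bound z) (≤-trans h≤mid mid≤ρ)

        clean-extended : ∀ {i σ} → (i , σ) ∈ (y , ρ) ∷ rest → Clean W₂ (suc d) l′ σ
        clean-extended (here refl) n′ a w = free-row ρ-free (≤-trans (s≤s (col-mono (≤-trans l≤d (n≤1+n d)))) a)
        clean-extended (there z)   n′ a w = clean-low (s<l (≤-trans l≤d (n≤1+n d)) a) (≤-trans w (col-mono (m≤n+m l′ k))) (rest-bound z)

        M₃ : Moved (Moved.K′ M₂) l′ extended
        M₃ = travel-to {W = W₂} d<l′ sorted-extended (λ z → Moved.at M₂ (in-extended z))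
               (ahead-grow {c = suc m} {c′ = suc d} (≤-trans m<l (≤-trans l≤d (n≤1+n d))) (Moved.grow M₂) ahead′) (λ z → clean-extended (in-extended z))

        ahead₃ : Ahead (Moved.K′ M₃) l′ W₂
        ahead₃ = ahead-grow {c = suc d} {c′ = l′} d<l′ (Moved.grow M₃) (ahead-grow {c = suc m} {c′ = suc d} (≤-trans m<l (≤-trans l≤d (n≤1+n d))) (Moved.grow M₂) ahead′)

        to-front′ : Settled (Moved.K′ M₃) l′ W₁ l rest ((y , ρ) ∷ []) β₁ mid H
        to-front′ = settle {W = W₂} W₁ l rest ((y , ρ) ∷ []) h β₁ mid H sorted-extended rest-bound h≤β₁ (room-low rest-length) mid≤H
          ((mid≤ρ , ≤-refl) ∷ []) (λ { (here refl) → ρ<H , ρ-free }) (Moved.at M₃) ahead₃ clean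
          where
          clean : ∀ σ → σ < H → Clean W₂ l′ (length rest + l′) σ
          clean σ lt n′ a w p = <-irrefl (sym (proj₁ (φ-inj (lane n′ σ (≤-trans (s≤s (col-mono {l} {l′} (m≤n+m l k))) a)
            (≤-trans w (col-mono (+-monoˡ-≤ l′ rest-length))) lt p)))) (≤-trans (s≤s n≤d) (≤-trans (s≤s (col-mono {suc d} {l′} d<l′)) a))

        finale : (F : Settled (Moved.K′ M₃) l′ W₁ l rest ((y , ρ) ∷ []) β₁ mid H) → Outcome K x y hs post
        finale F = record
          { K′ = Moved.K′ M₄ ; c′ = length rest + l′ ; W′ = W₁ ; hs′ = hs′ ++ (y , ρ) ∷ []
          ; state = record { sorted = sorted-weaken z≤n ordered ; at = Moved.at M₄
                           ; ahead = ahead-W₁ {Moved.K′ M₄} {length rest + l′} (ahead-grow {c = l′} {c′ = length rest + l′} (m≤n+m l′ (length rest)) (Moved.grow M₄) ahead₃)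
                           ; free = λ p → freeRow-later l≤ (proj₂ (free-rows p)) }
          ; evolve = evolve-trans evolve (evolve-trans (grown (Moved.grow M₂)) (evolve-trans (grown (Moved.grow M₃)) (grown (Moved.grow M₄))))
          ; touched = touch-mono {K′} {Moved.K′ M₄} {x} {y} (λ p → C-mono (Moved.grow M₄) (C-mono (Moved.grow M₃) (C-mono (Moved.grow M₂) p))) touched
          ; below = ids pre ; tail = y ∷ []
          ; shape = trans ids-final (++-assoc (ids pre) (x ∷ ids post) (y ∷ []))
          ; perm = ↭-trans (perm-to ↭-refl) (↭-trans (∷↭∷ʳ y (ids pre ++ x ∷ ids post)) (↭-reflexive (sym ids-final)))
          ; spare = spare-below l≤ ordered }
          where
          open Settled F
          M₄ = moved
          l≤ : l ≤ length rest + l′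
          l≤ = ≤-trans (m≤n+m l k) (m≤n+m l′ (length rest))
          ids-final : ids (hs′ ++ (y , ρ) ∷ []) ≡ (ids pre ++ x ∷ ids post) ++ y ∷ []
          ids-final = trans (map-++ proj₁ hs′ _) (cong (_++ y ∷ []) (trans ids≡ ids-rest))

      -- If `y` re-enters in the last `k` columns, the other lines have spread in the first `k`.
      -- They choose the upper band if `r < mid` and the lower one otherwise, so the detour of `y`
      -- from `r` to its final row meets none of them.
      module Late (l′≤d : l′ ≤ d) where
        record Boarded (ρ β β′ : ℕ) : Set where
          field
            {K₁}    : Config
            hs″     : Heads
            evolve₁ : Evolve K′ K₁
            at₁     : At K₁ (col (suc d)) ((y , ρ) ∷ hs″)
            ahead₁  : Ahead K₁ (suc d) W₂
            sorted″ : Sorted β hs″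
            rows″   : ∀ {i σ} → (i , σ) ∈ hs″ → σ < β′ × FreeRow W₁ l σ
            ids₁    : ids hs″ ≡ ids pre ++ x ∷ ids post

        M₁ : Moved K′ l rest
        M₁ = travel-low m<l (≤-trans (m≤n+m l k) (m≤n+m l′ k))

        settled : ∀ {β β′} → h ≤ β → β + length rest * suc b ≤ β′ → β′ ≤ H → Settled (Moved.K′ M₁) l W₁ l rest [] β β′ H
        settled {β} {β′} p room q = settle {W = W₂} W₁ l rest [] h β β′ H (subst (Sorted 0) (sym (++-identityʳ rest)) sorted-rest) rest-bound p room q [] (λ ())
          (λ z → Moved.at M₁ (subst (_ ∈_) (++-identityʳ rest) z)) (ahead-grow {c = suc m} {c′ = l} m<l (Moved.grow M₁) ahead′) clean
          where
          clean : ∀ σ → σ < H → Clean W₂ l (length rest + l) σ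
          clean σ lt n′ a w p = <-irrefl (proj₁ (φ-inj (lane n′ σ a (≤-trans w (≤-trans (col-mono (+-monoˡ-≤ l rest-length)) (col-mono {l′} {e} (m≤n+m l′ k)))) lt p)))
            (≤-trans (s≤s w) (≤-trans (s≤s (≤-trans (col-mono (+-monoˡ-≤ l rest-length)) (col-mono l′≤d))) d<n))

        boarding : ∀ {ρ β β′ a z} → Settled (Moved.K′ M₁) l W₁ l rest [] β β′ H → z < H → a ≤ r → r ≤ z → a ≤ ρ → ρ ≤ z →
                   (∀ {σ} → β ≤ σ → σ < β′ → σ < a ⊎ z < σ) → Boarded ρ β β′
        boarding {ρ} {β} {β′} {a} {z} F z<H ar rz aρ ρz beside = record
          { hs″ = hs′ ++ [] ; evolve₁ = evolve-trans (grown (Moved.grow M₁)) (evolve-trans (grown (Moved.grow moved)) (evolve-trans (grown (Moved.grow M₃)) (grown (Moved.grow M₄))))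
          ; at₁ = Moved.at M₄
          ; ahead₁ = ahead-grow {c = d} {c′ = suc d} (n≤1+n d) (Moved.grow M₄) ahead₃
          ; sorted″ = ordered ; rows″ = λ p → low (subst (_ ∈_) (++-identityʳ hs′) p) , proj₂ (free-rows p)
          ; ids₁ = trans (cong ids (++-identityʳ hs′)) (trans ids≡ ids-rest) }
          where
          open Settled F
          l≤d′ : length rest + l ≤ d
          l≤d′ = ≤-trans (+-monoˡ-≤ l rest-length) l′≤d
          ahead₂ : Ahead (Moved.K′ moved) (length rest + l) W₂
          ahead₂ = ahead-grow {c = l} {c′ = length rest + l} (m≤n+m l (length rest)) (Moved.grow moved) (ahead-grow {c = suc m} {c′ = l} m<l (Moved.grow M₁) ahead′)
          M₃ : Moved (Moved.K′ moved) d (hs′ ++ [])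
          M₃ = travel-to {W = W₂} l≤d′ ordered (Moved.at moved) ahead₂
                 λ p n′ a w → free-row (proj₂ (free-rows p)) (≤-trans (s≤s (col-mono {l} {length rest + l} (m≤n+m l (length rest)))) a)
          ahead₃ : Ahead (Moved.K′ M₃) d W₂
          ahead₃ = ahead-grow {c = length rest + l} {c′ = d} l≤d′ (Moved.grow M₃) ahead₂
          M₄ : Moved (Moved.K′ M₃) (suc d) ((y , ρ) ∷ hs′ ++ [])
          M₄ = board {W = W₂} ordered (Moved.at M₃) ahead₃ (λ p n′ a w → free-row (proj₂ (free-rows p)) (≤-trans (s≤s (col-mono {l} {d} l≤d)) a))
                 (C-mono (Moved.grow M₃) (C-mono (Moved.grow moved) (C-mono (Moved.grow M₁) q∈))) d<n n≤d ar rz aρ ρz (only a z z<H)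
                 (λ p → beside (sorted-lo ordered p) (low (subst (_ ∈_) (++-identityʳ hs′) p)))

        l≤suc-d : l ≤ suc d
        l≤suc-d = ≤-trans l≤d (n≤1+n d)

        bottom : ∀ {ρ} → β₁ ≤ ρ → ρ < mid → FreeRow W₁ l ρ → Boarded ρ mid H → Outcome K x y hs post
        bottom {ρ} p q f B = record
          { K′ = K₁ ; c′ = suc d ; W′ = W₁ ; hs′ = (y , ρ) ∷ hs″
          ; state = record { sorted = sorted-weaken z≤n so ; at = at₁ ; ahead = ahead-W₁ {K₁} {suc d} ahead₁
                           ; free = λ { (here refl) → freeRow-later l≤suc-d f ; (there z) → freeRow-later l≤suc-d (proj₂ (rows″ z)) } }
          ; evolve = evolve-trans evolve evolve₁ ; touched = touch-mono {K′} {K₁} {x} {y} (λ z → Evolve.up evolve₁ z) touched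
          ; below = y ∷ ids pre ; tail = []
          ; shape = cong (y ∷_) (trans ids₁ (cong (λ v → ids pre ++ x ∷ v) (sym (++-identityʳ (ids post)))))
          ; perm = perm-to (↭-reflexive ids₁)
          ; spare = spare-below l≤suc-d so }
          where
          open Boarded B
          so : Sorted β₁ ((y , ρ) ∷ hs″)
          so = (p , ≤-refl) ∷ sorted-weaken q sorted″

        above : ∀ {ρ} → mid ≤ ρ → FreeRow W₁ l ρ → Boarded ρ β₁ mid → Outcome K x y hs post
        above {ρ} p f B = record
          { K′ = K₁ ; c′ = suc d ; W′ = W₁ ; hs′ = hs″ ++ (y , ρ) ∷ []
          ; state = record { sorted = sorted-weaken z≤n so ; at = λ z → at₁ (back z) ; ahead = ahead-W₁ {K₁} {suc d} ahead₁
                           ; free = λ z → freeRow-later l≤suc-d (free-all (back z)) }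
          ; evolve = evolve-trans evolve evolve₁ ; touched = touch-mono {K′} {K₁} {x} {y} (λ z → Evolve.up evolve₁ z) touched
          ; below = ids pre ; tail = y ∷ []
          ; shape = trans ids-final (++-assoc (ids pre) (x ∷ ids post) (y ∷ []))
          ; perm = ↭-trans (perm-to ↭-refl) (↭-trans (∷↭∷ʳ y (ids pre ++ x ∷ ids post)) (↭-reflexive (sym ids-final)))
          ; spare = spare-below l≤suc-d so }
          where
          open Boarded B
          so : Sorted β₁ (hs″ ++ (y , ρ) ∷ [])
          so = sorted-snoc sorted″ (≤-trans (≤-trans (m≤m+n β₁ b) (≤-trans β₁≤mid (n≤1+n _))) p) λ z → ≤-trans (proj₁ (rows″ z)) p
          back : ∀ {i σ} → (i , σ) ∈ hs″ ++ (y , ρ) ∷ [] → (i , σ) ∈ (y , ρ) ∷ hs″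
          back z with ∈-++⁻ hs″ z
          ... | inj₁ w        = there w
          ... | inj₂ (here e) = here e
          free-all : ∀ {i σ} → (i , σ) ∈ (y , ρ) ∷ hs″ → FreeRow W₁ l σ
          free-all (here refl) = f
          free-all (there z)   = proj₂ (rows″ z)
          ids-final : ids (hs″ ++ (y , ρ) ∷ []) ≡ (ids pre ++ x ∷ ids post) ++ y ∷ []
          ids-final = trans (map-++ proj₁ hs″ _) (cong (_++ y ∷ []) ids₁)

        late : Outcome K x y hs post
        late with r <? mid | pick-row W₁ l β₁ | pick-row W₁ l mid
        ... | yes lt | ρ , p , q , f | _ = bottom p (s≤s ρ≤) f
                (boarding {β = mid} {H} {h} {mid′} (settled h≤mid (room-high rest-length) ≤-refl) mid≤H h≤r (≤-pred lt) (≤-trans h≤β₁ p) ρ≤ (λ z _ → inj₂ z))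
          where
          ρ≤ : ρ ≤ mid′
          ρ≤ = ≤-trans q β₁≤mid
        ... | no ge | _ | ρ , p , q , f = above p f
                (boarding {β = β₁} {mid} {mid} {H′} (settled h≤β₁ (room-low rest-length) mid≤H) ≤-refl (≮⇒≥ ge) (≤-pred r<H) p (≤-trans q (m≤m+n (mid + b) (k * suc b))) (λ _ z → inj₁ z))

  -- Meetings of one line with all others

  module Tournament (cells : ∀ j → Cells j) where

    module Next {K : Config} {c : ℕ} {W : Vs} {x τ y t : ℕ} {post : Heads} (pre : Heads)
                (st : State K c W (pre ++ (x , τ) ∷ (y , suc t) ∷ post)) (h : ℕ)
                (bound : ∀ {i σ} → (i , σ) ∈ pre ++ (x , τ) ∷ (y , suc t) ∷ post → σ < h)
                (pl : Plan K c W t (suc (length (pre ++ (x , t) ∷ post))) h) where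
      open Finale pre st h (suc (length (pre ++ (x , t) ∷ post))) refl bound pl
      open Plan pl

      stuck : ∀ {a m′} → FirstHit a m′ lanes → (∀ {z} → z ∈ m′ → z ∈ Y₁₂) → a ≡ φ (col m) (suc t) ⊎ a ≡ φ (5 + col m) (suc t) → Outcome K x y hs post
      stuck {a} hit sub end = at-lane (∈-strip⁻ {col l} {col e} {H} (FirstHit.hit hit))
        where
        open FirstHit hit using (q; J; walk; missed; J⊆)
        at-lane : (∃ λ n → ∃ λ r → col l < n × n ≤ col e × r < H × q ≡ φ n r) → Outcome K x y hs post
        at-lane (n , r , l<n , n≤e , r<H , eq) = in-column (locate l e n (≤-trans (m≤n+m l (suc (length rest))) (m≤n+m l′ (suc (length rest)))) l<n n≤e)
          where
          sub′ : ∀ {z} → z ∈ φ n r ∷ J → z ∈ Y₁₂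
          sub′ p = sub (J⊆ (subst (λ v → _ ∈ v ∷ J) (sym eq) p))
          S : Stranded (φ n r) J
          S = strand sub′ (subst (Walk a J) eq walk) end
          in-column : (∃ λ d → l ≤ d × d < e × col d < n × n ≤ 5 + col d) → Outcome K x y hs post
          in-column (d , l≤d , d<e , d<n , n≤d) = side (d <? l′)
            where
            side : Dec (d < l′) → Outcome K x y hs post
            side (yes lt) = finale to-front′
              where open Stuck.Early S sub′ missed l≤d d<e d<n n≤d r<H lt
            side (no ge)  = Stuck.Late.late S sub′ missed l≤d d<e d<n n≤d r<H (≮⇒≥ ge)

      next : Outcome K x y hs post
      next = try (first-hit lanes walk₂) (first-hit lanes (walk-reverse walk₁))
        where
        try : FirstHit (φ (col m) (suc t)) X₂ lanes ⊎ (∀ {z} → z ∈ X₂ → z ∉ lanes) →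
              FirstHit (φ (5 + col m) (suc t)) (reverse X₁) lanes ⊎ (∀ {z} → z ∈ reverse X₁ → z ∉ lanes) → Outcome K x y hs post
        try (inj₁ hit) _ = stuck hit (∈-++⁺ʳ X₁) (inj₁ refl)
        try (inj₂ _) (inj₁ hit) = stuck hit (λ p → ∈-++⁺ˡ (∈-reverse⁻ X₁ p)) (inj₂ refl)
        try (inj₂ miss₂) (inj₂ miss₁) = Missed.swap-outcome (λ p → both (∈-++⁻ X₁ p)) (swapping (ready Y₁₂ off₁₂))
          where
          both : ∀ {z} → z ∈ X₁ ⊎ z ∈ X₂ → z ∉ lanes
          both (inj₁ p) = miss₁ (reverse⁺ p)
          both (inj₂ p) = miss₂ p

    touch-next : ∀ {K c W x τ y σ post} pre → State K c W (pre ++ (x , τ) ∷ (y , σ) ∷ post) → Outcome K x y (pre ++ (x , τ) ∷ (y , σ) ∷ post) post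
    touch-next {K} {c} {W} {x} {τ} {y} {zero} {post} pre st with sorted-above pre (State.sorted st)
    ... | (() , _) ∷ _
    touch-next {K} {c} {W} {x} {τ} {y} {suc t} {post} pre st =
      Next.next pre st (top hs) below-top (plan K c W t (suc (length (pre ++ (x , t) ∷ post))) (top hs) cells (below-top {hs} (∈-++⁺ʳ pre (there (here refl)))))
      where
      hs : Heads
      hs = pre ++ (x , τ) ∷ (y , suc t) ∷ post

    record Met (K : Config) (x : ℕ) (todo : List ℕ) (hs : Heads) : Set where
      field
        {K′}    : Config
        {c′}    : ℕ
        {W′}    : Vs
        {hs′}   : Heads
        state   : State K′ c′ W′ hs′
        evolve  : Evolve K K′
        touched : ∀ {i} → i ∈ todo → Touch K′ x i
        perm    : ids hs ↭ ids hs′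
        spare   : Spare c′ W′ hs′

    split-ids : ∀ hs below {x rest} → ids hs ≡ below ++ x ∷ rest → ∃ λ pre → ∃ λ τ → ∃ λ post → hs ≡ pre ++ (x , τ) ∷ post × ids post ≡ rest
    split-ids ((x , τ) ∷ hs) [] refl = [] , τ , hs , refl , refl
    split-ids ((i , σ) ∷ hs) (_ ∷ below) e with ∷-injective e
    ... | refl , e′ with split-ids hs below e′
    ...   | pre , τ , post , refl , q = (i , σ) ∷ pre , τ , post , refl , q

    touch-all : ∀ {K c W x hs} below todo tail → State K c W hs → (todo ≡ [] → Spare c W hs) → ids hs ≡ below ++ x ∷ todo ++ tail → Met K x todo hs
    touch-all below [] tail st sp e = record { state = st ; evolve = record { up = λ p → p ; dull = λ n → n } ; touched = λ () ; perm = ↭-refl ; spare = sp refl }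
    touch-all {hs = hs} below (y ∷ todo) tail st sp e with split-ids hs below e
    ... | pre , τ , [] , refl , ()
    ... | pre , τ , (_ , σ) ∷ post , refl , e′ with ∷-injective e′
    ...   | refl , e″ = continue (touch-next pre st)
      where
      continue : Outcome _ _ y hs post → Met _ _ (y ∷ todo) hs
      continue O = finish (touch-all {x = _} (Outcome.below O) todo (tail ++ Outcome.tail O) (Outcome.state O) (λ _ → Outcome.spare O)
                     (trans (Outcome.shape O) (cong (λ v → Outcome.below O ++ _ ∷ v) (trans (cong (_++ Outcome.tail O) e″) (++-assoc todo tail (Outcome.tail O))))))
        where
        finish : Met (Outcome.K′ O) _ todo (Outcome.hs′ O) → Met _ _ (y ∷ todo) hs
        finish M = record
          { state = Met.state M ; evolve = evolve-trans (Outcome.evolve O) (Met.evolve M)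
          ; touched = λ { (here refl) → touch-mono {Outcome.K′ O} {Met.K′ M} (λ p → Evolve.up (Met.evolve M) p) (Outcome.touched O) ; (there p) → Met.touched M p }
          ; perm = ↭-trans (Outcome.perm O) (Met.perm M) ; spare = Met.spare M }

    record Birth (K : Config) (c i ρ : ℕ) (W : Vs) (hs : Heads) : Set where
      field
        {K′}   : Config
        state  : State K′ (suc c) W ((i , ρ) ∷ hs)
        up     : ∀ {j x} → x ∈ C K j → x ∈ C K′ j
        dull   : ∀ {j} → j ≢ i → (∀ {x} → x ∉ C K j) → ∀ {x} → x ∉ C K′ j
        tail   : φ (1 + col c) ρ ∈ C K′ i
        head   : φ (5 + col c) ρ ∈ C K′ i

    birth : ∀ {K c W hs} i → State K c W hs → (sp : Spare c W hs) → (∀ {x} → x ∉ C K i) → Birth K c i (proj₁ sp) W hs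
    birth {K} {c} {W} {hs} i st (ρ , so , f) none = grown-up (born K i u none u∉)
      where
      open State st
      u : V G
      u = φ (1 + col c) ρ
      u∉ : u ∉ U K
      u∉ p = f (1 + col c) ≤-refl (ahead _ _ ≤-refl p)
      grown-up : Attached K i (u ∷ []) → Birth K c i ρ W hs
      grown-up A = record
        { K′ = Moved.K′ M
        ; state = record { sorted = (z≤n , ≤-refl) ∷ so ; at = Moved.at M ; ahead = far
                         ; free = λ { (here refl) → freeRow-later (n≤1+n c) f ; (there p) → freeRow-later (n≤1+n c) (free p) } }
        ; up = λ p → C-mono (Moved.grow M) (Attached.C-up A p)
        ; dull = λ {j} ne n → idle (Moved.grow M) {j} λ p → still {j} ne n (Attached.C-inv A p)
        ; tail = C-mono (Moved.grow M) (Attached.into A (here refl))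
        ; head = Moved.at M (here refl) }
        where
        ahead₁ : Ahead (Attached.K′ A) c (u ∷ W)
        ahead₁ n t lt p with Attached.U-inv A p
        ... | inj₁ q           = there (ahead n t lt q)
        ... | inj₂ (here e)    = here e
        clean : ∀ {j σ} → (j , σ) ∈ hs → Clean (u ∷ W) c (suc c) σ
        clean p n a b (here e)  = <-irrefl (sym (proj₂ (φ-inj e))) (sorted-lo so p)
        clean p n a b (there q) = free p n a q
        only : ∀ n t → Rect c ρ ρ n t → φ n t ∈ u ∷ W → φ n t ≡ u
        only n t r (here e) = e
        only n t (a , _ , b , d) (there q) = ⊥-elim (f n a (subst (λ σ → φ n σ ∈ W) (≤-antisym d b) q))
        M : Moved (Attached.K′ A) (suc c) ((i , ρ) ∷ hs)
        M = board {W = u ∷ W} so (λ p → Attached.C-up A (at p)) ahead₁ clean (Attached.into A (here refl)) ≤-refl (s≤s (m≤n+m (col c) 4))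
              ≤-refl ≤-refl ≤-refl ≤-refl only (λ p → inj₂ (sorted-lo so p))
        far : Ahead (Moved.K′ M) (suc c) W
        far n t lt p with ahead-grow {c = c} {c′ = suc c} (n≤1+n c) (Moved.grow M) ahead₁ n t lt p
        ... | here e  = ⊥-elim (<-irrefl (sym (proj₁ (φ-inj e))) (≤-trans (s≤s (s≤s (m≤n+m (col c) 4))) lt))
        ... | there q = q
        still : ∀ {j x} → j ≢ i → (∀ {x} → x ∉ C K j) → x ∈ C K j ⊎ (j ≡ i × x ∈ u ∷ []) → ⊥
        still ne n (inj₁ p) = n p
        still ne n (inj₂ (e , _)) = ne e

    touch-sym : ∀ {K i j} → Touch K i j → Touch K j i
    touch-sym (x , y , p , q , a) = y , x , q , p , Graph.sym G a

    record Rivals (K : Config) (L : List ℕ) : Set where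
      field
        {K′}  : Config
        evolve : Evolve K K′
        met    : ∀ {i j} → i ∈ L → j ∈ L → i ≢ j → Touch K′ i j

    -- The lowest line meets all others and is then given up.
    rivals : ∀ {K c W} n hs → length hs ≤ n → State K c W hs → Rivals K (ids hs)
    rivals {K} n [] p st = record { K′ = K ; evolve = record { up = λ p → p ; dull = λ n → n } ; met = λ () }
    rivals {K} n (_ ∷ []) p st = record { K′ = K ; evolve = record { up = λ p → p ; dull = λ n → n } ; met = λ { (here refl) (here refl) ne → ⊥-elim (ne refl) } }
    rivals {K} (suc n) ((x , τ) ∷ hs@(_ ∷ _)) (s≤s len) st = continue (touch-all {x = x} [] (ids hs) [] st (λ ()) (cong (x ∷_) (sym (++-identityʳ (ids hs)))))
      where
      continue : Met K x (ids hs) ((x , τ) ∷ hs) → Rivals K (x ∷ ids hs)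
      continue M = drop-line (∈-∃++ (∈-resp-↭ (Met.perm M) (here refl)))
        where
        open Met M
        drop-line : (∃ λ below → ∃ λ rest → ids hs′ ≡ below ++ x ∷ rest) → Rivals K (x ∷ ids hs)
        drop-line (below , rest , e) with split-ids hs′ below e
        ... | pre , σ , post , refl , _ = finish (rivals {c = c′} n (pre ++ post) short (record
                { sorted = sorted-remove pre (State.sorted state) ; at = λ p → State.at state (keep p) ; ahead = State.ahead state
                ; free = λ p → State.free state (keep p) }))
          where
          keep : ∀ {h} → h ∈ pre ++ post → h ∈ pre ++ (x , σ) ∷ post
          keep p with ∈-++⁻ pre p
          ... | inj₁ q = ∈-++⁺ˡ q
          ... | inj₂ q = ∈-++⁺ʳ pre (there q)
          others : ids hs ↭ ids (pre ++ post)
          others = ↭-trans (drop-mid [] (ids pre) (↭-trans perm (↭-reflexive (map-++ proj₁ pre _)))) (↭-reflexive (sym (map-++ proj₁ pre post)))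
          short : length (pre ++ post) ≤ n
          short = ≤-trans (≤-reflexive (trans (sym (length-map proj₁ (pre ++ post))) (trans (sym (↭-length others)) (length-map proj₁ hs)))) len
          finish : Rivals K′ (ids (pre ++ post)) → Rivals K (x ∷ ids hs)
          finish R = record { evolve = evolve-trans evolve (Rivals.evolve R) ; met = all }
            where
            final : Config
            final = Rivals.K′ R
            first : ∀ {i} → i ∈ ids hs → Touch final x i
            first {i} p = touch-mono {K′} {final} {x} {i} (λ q → Evolve.up (Rivals.evolve R) q) (touched p)
            all : ∀ {i j} → i ∈ x ∷ ids hs → j ∈ x ∷ ids hs → i ≢ j → Touch final i j
            all (here refl) (here refl) ne = ⊥-elim (ne refl)
            all (here refl) (there q)   ne = first q
            all {i} (there p) (here refl) ne = touch-sym {final} {x} {i} (first p)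
            all (there p)   (there q)   ne = Rivals.met R (∈-resp-↭ others p) (∈-resp-↭ others q) ne

    -- The infinite complete minor

    module Infinite where

      record Stage (n : ℕ) : Set where
        field
          cfg   : Config
          c     : ℕ
          W     : Vs
          hs    : Heads
          state : State cfg c W hs
          spare : Spare c W hs
          alive : ∀ {i} → i ≤ n → i ∈ ids hs
          later : ∀ {i} → n < i → ∀ {x} → x ∉ C cfg i
          couple  : ∀ {i} → i ≤ n → ∃ λ x → ∃ λ y → x ≢ y × x ∈ C cfg i × y ∈ C cfg i
      open Stage

      tail≢head : ∀ c ρ → φ (1 + col c) ρ ≢ φ (5 + col c) ρ
      tail≢head c ρ e = <-irrefl (proj₁ (φ-inj e)) (s≤s (s≤s (m≤n+m (col c) 3)))

      empty : Config
      empty = record { C = λ _ → [] ; U = [] ; C⊆U = λ () ; disj = λ () ; conn = λ () }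

      first-stage : Stage 0
      -- The first line starts in row 1, which leaves row 0 as the spare row.
      first-stage = from (birth {empty} {0} {[]} {[]} 0 (record { sorted = [] ; at = λ () ; ahead = λ _ _ _ () ; free = λ () }) (1 , [] , λ _ _ ()) λ ())
        where
        from : Birth empty 0 0 1 [] [] → Stage 0
        from B = record
          { cfg = Birth.K′ B ; c = 1 ; W = [] ; hs = (0 , 1) ∷ [] ; state = Birth.state B
          ; spare = 0 , (≤-refl , ≤-refl) ∷ [] , λ _ _ ()
          ; alive = λ { z≤n → here refl } ; later = λ { (s≤s z≤n) → Birth.dull B (λ ()) λ () }
          ; couple = λ { z≤n → _ , _ , tail≢head 0 1 , Birth.tail B , Birth.head B } }

      record Successor (n : ℕ) (S : Stage n) : Set where
        field
          stage   : Stage (suc n)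
          up      : ∀ {i x} → x ∈ C (cfg S) i → x ∈ C (cfg stage) i
          touched : ∀ {i} → i ≤ n → Touch (cfg stage) (suc n) i

      next : ∀ n (S : Stage n) → Successor n S
      next n S = from (birth (suc n) (state S) (spare S) (later S ≤-refl))
        where
        from : Birth (cfg S) (c S) (suc n) (proj₁ (spare S)) (W S) (hs S) → Successor n S
        from B = meet-all (touch-all {x = suc n} [] (ids (hs S)) [] (Birth.state B) (λ e → ⊥-elim (nonempty (subst (0 ∈_) e (alive S z≤n)))) (cong (suc n ∷_) (sym (++-identityʳ _))))
          where
          nonempty : ¬ 0 ∈ []
          nonempty ()
          meet-all : Met (Birth.K′ B) (suc n) (ids (hs S)) ((suc n , proj₁ (spare S)) ∷ hs S) → Successor n S
          meet-all M = record
            { stage = record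
              { cfg = Met.K′ M ; c = Met.c′ M ; W = Met.W′ M ; hs = Met.hs′ M ; state = Met.state M ; spare = Met.spare M
              ; alive = λ p → ∈-resp-↭ (Met.perm M) (old (m≤n⇒m<n∨m≡n p))
              ; later = λ p → Evolve.dull (Met.evolve M) (Birth.dull B (λ e → <-irrefl (sym e) p) (later S (<-trans ≤-refl p)))
              ; couple = λ p → two (m≤n⇒m<n∨m≡n p) }
            ; up = λ p → Evolve.up (Met.evolve M) (Birth.up B p)
            ; touched = λ p → Met.touched M (alive S p) }
            where
            old : ∀ {i} → i < suc n ⊎ i ≡ suc n → i ∈ suc n ∷ ids (hs S)
            old (inj₁ (s≤s p)) = there (alive S p)
            old (inj₂ refl)    = here refl
            two : ∀ {i} → i < suc n ⊎ i ≡ suc n → ∃ λ x → ∃ λ y → x ≢ y × x ∈ C (Met.K′ M) i × y ∈ C (Met.K′ M) i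
            two (inj₁ (s≤s p)) with couple S p
            ... | x , y , ne , x∈ , y∈ = x , y , ne , Evolve.up (Met.evolve M) (Birth.up B x∈) , Evolve.up (Met.evolve M) (Birth.up B y∈)
            two (inj₂ refl) = _ , _ , tail≢head (c S) (proj₁ (spare S)) , Evolve.up (Met.evolve M) (Birth.tail B) , Evolve.up (Met.evolve M) (Birth.head B)

      stages : ∀ n → Stage n
      stages zero    = first-stage
      stages (suc n) = Successor.stage (next n (stages n))

      K∞ : ℕ → Config
      K∞ n = cfg (stages n)

      K∞-step : ∀ n {i x} → x ∈ C (K∞ n) i → x ∈ C (K∞ (suc n)) i
      K∞-step n = Successor.up (next n (stages n))

      K∞-up : ∀ d n {i x} → x ∈ C (K∞ n) i → x ∈ C (K∞ (d + n)) i
      K∞-up zero    n p = p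
      K∞-up (suc d) n p = K∞-step (d + n) (K∞-up d n p)

      K∞-left : ∀ d n {i x} → x ∈ C (K∞ n) i → x ∈ C (K∞ (n + d)) i
      K∞-left d n {i} {x} p = subst (λ e → x ∈ C (K∞ e) i) (+-comm d n) (K∞-up d n p)

      Branch : ℕ → V G → Set
      Branch i x = ∃ λ n → x ∈ C (K∞ n) i

      -- `Minor` asks for a walk with at least one edge even from a vertex to itself. In that case
      -- the walk goes to a second vertex of the branch set and back; the stages record a `couple`
      -- for this purpose.
      linkage : ∀ i x y → Branch i x → Branch i y → Σ (List (V G)) λ l → All (Branch i) l × Walk x l y
      linkage i x y (n , p) (n′ , q) = choose (x ≟ y)
        where
        n″ : ℕ
        -- The summand `i` guarantees a stage at which line `i` exists and has its `couple`.
        n″ = i + (n + n′)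
        x∈ : x ∈ C (K∞ n″) i
        x∈ = K∞-up i (n + n′) (K∞-left n′ n p)
        y∈ : y ∈ C (K∞ n″) i
        y∈ = K∞-up i (n + n′) (K∞-up n n′ q)
        walk-to : ∀ {z} → z ∈ C (K∞ n″) i → x ≢ z → Σ (List (V G)) λ l → All (Branch i) l × Walk x l z
        walk-to z∈ ne with conn (K∞ n″) x∈ z∈
        ... | inj₁ e           = ⊥-elim (ne e)
        ... | inj₂ (l , w , s) = l , tabulate (λ r → n″ , s r) , w
        loop : ∀ {z} → z ∈ C (K∞ n″) i → x ≢ z → Σ (List (V G)) λ l → All (Branch i) l × Walk x l x
        loop {z} z∈ ne with walk-to z∈ ne
        ... | l , a , w = l ++ z ∷ reverse l , tabulate inside , join w (walk-reverse w)
          where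
          inside : ∀ {v} → v ∈ l ++ z ∷ reverse l → Branch i v
          inside r with ∈-++⁻ l r
          ... | inj₁ r′         = All.lookup a r′
          ... | inj₂ (here refl) = n″ , z∈
          ... | inj₂ (there r′) = All.lookup a (∈-reverse⁻ l r′)
        choose : Dec (x ≡ y) → Σ (List (V G)) λ l → All (Branch i) l × Walk x l y
        choose (no ne) = walk-to y∈ ne
        choose (yes refl) with couple (stages n″) (m≤m+n i (n + n′))
        ... | u , v , u≢v , u∈ , v∈ with x ≟ u
        ...   | no ne    = loop u∈ ne
        ...   | yes refl = loop v∈ u≢v

      minor : Minor Kℵ₀ G
      minor = record
        { B = Branch
        ; disjoint = λ { i j x (n , p) (n′ , q) → disj (K∞ (n + n′)) (K∞-left n′ n p) (K∞-up n n′ q) }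
        ; nonempty = λ i → proj₁ (couple (stages i) ≤-refl) , i , proj₁ (proj₂ (proj₂ (proj₂ (couple (stages i) ≤-refl))))
        ; connected = λ i x y p q → let (l , a , w) = linkage i x y p q in l , a , toLinked w
        ; edges = edges }
        where
        higher : ∀ {i j} → i < j → Touch (K∞ j) j i
        higher {i} {suc j} (s≤s p) = Successor.touched (next j (stages j)) p
        edges : ∀ i j → i ≢ j → ∃ λ x → ∃ λ y → Branch i x × Branch j y × Adj G x y
        edges i j ne with <-cmp i j
        ... | tri≈ _ e _ = ⊥-elim (ne e)
        ... | tri< lt _ _ with higher lt
        ...   | y , x , q , p , a = x , y , (j , p) , (j , q) , Graph.sym G a
        edges i j ne | tri> _ _ gt with higher gt
        ...   | x , y , p , q , a = x , y , (i , p) , (i , q) , a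

    -- The finite complete topological minors

    module Finite (k : ℕ) (hub-link : ∀ t → Link (φ 0 (t / suc k)) (φ 1 t)) where
      open import Data.Fin using (Fin; toℕ)
      open import Data.Fin.Properties using (toℕ-injective; toℕ<n)
      open Erasing G _≟_

      -- The lines are numbered by their tracks; the hubs are further pieces, which are never enlarged.
      lines : ℕ
      lines = k * suc k

      line : ℕ → ℕ → ℕ
      line a b = b + a * suc k

      line-hub : ∀ {a b} → b < k → line a b / suc k ≡ a
      line-hub {a} {b} p = trans (+-distrib-/-∣ʳ b (divides-refl a)) (trans (cong (_+ a * suc k / suc k) (m<n⇒m/n≡0 (m≤n⇒m≤1+n p))) (m*n/n≡m a (suc k)))

      line-injective : ∀ {a b a′ b′} → b < k → b′ < k → line a b ≡ line a′ b′ → a ≡ a′ × b ≡ b′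
      line-injective {a} {b} {a′} {b′} p q e with trans (sym (line-hub {a} p)) (trans (cong (_/ suc k) e) (line-hub {a′} q))
      ... | refl = refl , +-cancelʳ-≡ (a * suc k) b b′ e

      line<lines : ∀ {a b} → a < k → b < k → line a b < lines
      line<lines {a} p q = ≤-trans (+-monoˡ-≤ (a * suc k) (m≤n⇒m≤1+n q)) (*-monoˡ-≤ (suc k) p)

      record Hubs (n : ℕ) : Set where
        field
          cfg  : Config
          used : ∀ {m t} → φ m t ∈ U cfg → m ≡ 0 × t < n
          none : ∀ {i} → i < lines ⊎ lines + n ≤ i → ∀ {x} → x ∉ C cfg i
          hub∈ : ∀ {a} → a < n → φ 0 a ∈ C cfg (lines + a)

      hubs : ∀ n → Hubs n
      hubs zero = record { cfg = record { C = λ _ → [] ; U = [] ; C⊆U = λ () ; disj = λ () ; conn = λ () } ; used = λ () ; none = λ _ () ; hub∈ = λ () }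
      hubs (suc n) = more (hubs n)
        where
        more : Hubs n → Hubs (suc n)
        more B = add-hub (born cfg (lines + n) (φ 0 n) (none (inj₂ ≤-refl)) λ p → <-irrefl refl (proj₂ (used p)))
          where
          open Hubs B
          add-hub : Attached cfg (lines + n) (φ 0 n ∷ []) → Hubs (suc n)
          add-hub A = record { cfg = Attached.K′ A ; used = λ p → use (Attached.U-inv A p) ; none = λ c p → still c (Attached.C-inv A p) ; hub∈ = λ p → hub′ (m≤n⇒m<n∨m≡n p) }
            where
            use : ∀ {m t} → φ m t ∈ U cfg ⊎ φ m t ∈ φ 0 n ∷ [] → m ≡ 0 × t < suc n
            use (inj₁ p) = proj₁ (used p) , m≤n⇒m≤1+n (proj₂ (used p))
            use (inj₂ (here e)) with φ-inj e
            ... | refl , refl = refl , ≤-refl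
            still : ∀ {i x} → i < lines ⊎ lines + suc n ≤ i → x ∈ C cfg i ⊎ (i ≡ lines + n × x ∈ φ 0 n ∷ []) → ⊥
            still (inj₁ lt) (inj₁ p) = none (inj₁ lt) p
            still (inj₂ ge) (inj₁ p) = none (inj₂ (≤-trans (+-monoʳ-≤ lines (n≤1+n n)) ge)) p
            still (inj₁ lt) (inj₂ (refl , _)) = <-irrefl refl (≤-trans lt (m≤m+n lines n))
            still (inj₂ ge) (inj₂ (refl , _)) = <-irrefl refl (≤-trans (≤-reflexive (sym (+-suc lines n))) ge)
            hub′ : ∀ {a} → suc a < suc n ⊎ suc a ≡ suc n → φ 0 a ∈ C (Attached.K′ A) (lines + a)
            hub′ (inj₁ (s≤s p)) = Attached.C-up A (hub∈ p)
            hub′ (inj₂ refl)    = Attached.into A (here refl)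

      heads : ℕ → ℕ → Heads
      heads s zero    = []
      heads s (suc d) = (s , s) ∷ heads (suc s) d

      heads-sorted : ∀ s d → Sorted s (heads s d)
      heads-sorted s zero    = []
      heads-sorted s (suc d) = (≤-refl , ≤-refl) ∷ heads-sorted (suc s) d

      heads-complete : ∀ {s t} d → s ≤ t → t < d + s → t ∈ ids (heads s d)
      heads-complete zero p q = ⊥-elim (<-irrefl refl (≤-trans q p))
      heads-complete {s} {t} (suc d) p q with m≤n⇒m<n∨m≡n p
      ... | inj₁ lt   = there (heads-complete d lt (≤-trans q (≤-reflexive (sym (+-suc d s)))))
      ... | inj₂ refl = here refl

      record Start (s d : ℕ) : Set where
        field
          cfg  : Config
          at₁  : At cfg 1 (heads s d)
          used : ∀ {m t} → φ m t ∈ U cfg → m ≡ 0 ⊎ m ≡ 1 × s ≤ t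
          none : ∀ {i} → i < s → ∀ {x} → x ∉ C cfg i
          root : ∀ {t} → s ≤ t → t < d + s → ∃ λ z → z ∈ C cfg t × Adj G z (φ 0 (t / suc k))
          hub∈ : ∀ {a} → a < k → φ 0 a ∈ C cfg (lines + a)

      -- Lines are begun from the highest track downwards, since each new head is put in front of
      -- the sorted list.
      start : ∀ d s → d + s ≡ lines → Start s d
      start zero s refl = record { cfg = cfg ; at₁ = λ () ; used = λ p → inj₁ (proj₁ (used p)) ; none = λ p → none (inj₁ p)
                                 ; root = λ p q → ⊥-elim (<-irrefl refl (≤-trans q p)) ; hub∈ = hub∈ }
        where open Hubs (hubs k)
      start (suc d) s e = more (start d (suc s) (trans (+-suc d s) e))
        where
        more : Start (suc s) d → Start s (suc d)
        more B = begin-line (born cfg s (φ 1 s) (none ≤-refl) vacant)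
          where
          open Start B
          vacant : φ 1 s ∉ U cfg
          vacant p with used p
          ... | inj₂ (_ , lt) = <-irrefl refl lt
          begin-line : Attached cfg s (φ 1 s ∷ []) → Start s (suc d)
          begin-line A = attach-hub (link-sym (hub-link s) (U (Attached.K′ A)))
            where
            attach-hub : (∃ λ l → Walk (φ 1 s) l (φ 0 (s / suc k)) × (∀ {z} → z ∈ l → z ∉ U (Attached.K′ A)) × (∀ {z} → z ∈ l → OffTrack z)) → Start s (suc d)
            -- The line takes the walk up to the hub but not the hub, which stays in its own piece.
            -- Disjointness of pieces then keeps all lines off all hubs.
            attach-hub (l , walk , new , off) = finish (contact (Attached.K′ A) s (Attached.into A (here refl)) walk new)
              where
              finish : (Σ Config λ K′ → Grow (Attached.K′ A) K′ (_∈ l) × ∃ λ z → z ∈ C K′ s × Adj G z (φ 0 (s / suc k))) → Start s (suc d)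
              finish (K′ , g , z , z∈ , a) = record
                { cfg = K′ ; at₁ = λ { (here refl) → C-mono g (Attached.into A (here refl)) ; (there p) → up (at₁ p) }
                ; used = use ; none = λ lt → idle g λ p → still lt (Attached.C-inv A p)
                ; root = λ p q → root′ (m≤n⇒m<n∨m≡n p) q ; hub∈ = λ p → up (hub∈ p) }
                where
                up : ∀ {i x} → x ∈ C cfg i → x ∈ C K′ i
                up p = C-mono g (Attached.C-up A p)
                use : ∀ {m t} → φ m t ∈ U K′ → m ≡ 0 ⊎ m ≡ 1 × s ≤ t
                use p with news g p
                ... | inj₂ q = ⊥-elim (off q _ _ refl)
                ... | inj₁ q with Attached.U-inv A q
                ...   | inj₂ (here e) = inj₂ (proj₁ (φ-inj e) , ≤-reflexive (sym (proj₂ (φ-inj e))))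
                ...   | inj₁ r with used r
                ...     | inj₁ z≡ = inj₁ z≡
                ...     | inj₂ (o , lt) = inj₂ (o , <⇒≤ lt)
                still : ∀ {i x} → i < s → x ∈ C cfg i ⊎ (i ≡ s × x ∈ φ 1 s ∷ []) → ⊥
                still lt (inj₁ p)          = none (m≤n⇒m≤1+n lt) p
                still lt (inj₂ (refl , _)) = <-irrefl refl lt
                root′ : ∀ {t} → s < t ⊎ s ≡ t → t < suc d + s → ∃ λ z → z ∈ C K′ t × Adj G z (φ 0 (t / suc k))
                root′ (inj₂ refl) q = z , z∈ , a
                root′ (inj₁ lt) q with root lt (≤-trans q (≤-reflexive (sym (+-suc d s))))
                ... | z′ , p , a′ = z′ , up p , a′

      initial : Start 0 lines
      initial = start lines 0 (+-identityʳ lines)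

      initial-state : State (Start.cfg initial) 0 [] (heads 0 lines)
      initial-state = record { sorted = heads-sorted 0 lines ; at = Start.at₁ initial ; free = λ _ _ _ () ; ahead = λ n t lt p → ⊥-elim (far lt (Start.used initial p)) }
        where
        far : ∀ {n t} → 1 < n → n ≡ 0 ⊎ n ≡ 1 × 0 ≤ t → ⊥
        far lt (inj₁ refl) = n≮0 lt
        far lt (inj₂ (refl , _)) = <-irrefl refl lt

      abstract
        outcome : Rivals (Start.cfg initial) (ids (heads 0 lines))
        outcome = rivals (length (heads 0 lines)) (heads 0 lines) ≤-refl initial-state

      final : Config
      final = Rivals.K′ outcome

      final-root : ∀ {a b} → a < k → b < k → ∃ λ z → z ∈ C final (line a b) × Adj G z (φ 0 a)
      final-root {a} {b} p q with Start.root initial {line a b} z≤n (≤-trans (line<lines p q) (≤-reflexive (sym (+-identityʳ lines))))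
      ... | z , z∈ , adj = z , Evolve.up (Rivals.evolve outcome) z∈ , subst (λ h → Adj G z (φ 0 h)) (line-hub {a} q) adj

      final-hub : ∀ {a} → a < k → φ 0 a ∈ C final (lines + a)
      final-hub p = Evolve.up (Rivals.evolve outcome) (Start.hub∈ initial p)

      hub-off : ∀ {a c b} → a < k → b < k → c < k → φ 0 c ∉ C final (line a b)
      hub-off {a} {c} {b} p q r z = <-irrefl (disj final z (final-hub r)) (≤-trans (line<lines p q) (m≤m+n lines c))

      final-met : ∀ {a b} → a < k → b < k → a ≢ b → Touch final (line a b) (line b a)
      final-met {a} {b} p q ne = Rivals.met outcome (present p q) (present q p) λ e → ne (proj₁ (line-injective {a} {b} {b} {a} q p e))
        where
        present : ∀ {a b} → a < k → b < k → line a b ∈ ids (heads 0 lines)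
        present p q = heads-complete lines z≤n (≤-trans (line<lines p q) (≤-reflexive (sym (+-identityʳ lines))))

      record Joined (a b : ℕ) : Set where
        field
          {inner} : List (V G)
          walk    : Walk (φ 0 a) inner (φ 0 b)
          unique  : Unique inner
          inside  : ∀ {z} → z ∈ inner → z ∈ C final (line a b) ⊎ z ∈ C final (line b a)

      hub≢ : ∀ {a b} → a ≢ b → φ 0 a ≢ φ 0 b
      hub≢ ne e = ne (proj₂ (φ-inj e))

      -- A line belongs to an ordered pair and hence to a single edge, so the paths of different
      -- edges are disjoint. Loops are erased because pieces are merely connected.
      joined : ∀ {a b} → a < k → b < k → a ≢ b → Joined a b
      joined {a} {b} p q ne with final-root {a} {b} p q | final-root {b} {a} q p | final-met p q ne
      ... | z , z∈ , adj | z′ , z′∈ , adj′ | x , y , x∈ , y∈ , adj″ = erased route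
        where
        L : List (V G)
        L = C final (line a b) ++ C final (line b a)
        left : ∀ {v} → v ∈ C final (line a b) → v ∈ L
        left = ∈-++⁺ˡ
        right : ∀ {v} → v ∈ C final (line b a) → v ∈ L
        right = ∈-++⁺ʳ (C final (line a b))
        edge : ∀ {u v} → Adj G u v → Reach L u v
        edge e = inj₂ ([] , step e , λ ())
        route : Reach L (φ 0 a) (φ 0 b)
        route = reach-trans (left z∈) (edge (Graph.sym G adj)) (reach-trans (left x∈) (reach-mono left (conn final z∈ x∈))
                  (reach-trans (right y∈) (edge adj″) (reach-trans (right z′∈) (reach-mono right (conn final y∈ z′∈)) (edge adj′))))
        erased : Reach L (φ 0 a) (φ 0 b) → Joined a b
        erased (inj₁ e) = ⊥-elim (hub≢ ne e)
        erased (inj₂ (m , w , sub)) with erase w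
        ... | m′ , w′ , sub′ , _ ∷ un = record { walk = w′ ; unique = un ; inside = λ v → ∈-++⁻ _ (sub (sub′ v)) }

      module _ {a b : ℕ} (p : a < k) (q : b < k) (ne : a ≢ b) where
        open Joined (joined p q ne)

        hub∉inner : ∀ {c} → c < k → φ 0 c ∉ inner
        hub∉inner r z with inside z
        ... | inj₁ v = hub-off p q r v
        ... | inj₂ v = hub-off q p r v

        forth : Path G (φ 0 a) (φ 0 b)
        forth = to-path walk unique (hub∉inner p) (hub∉inner q) (hub≢ ne)

        back : Path G (φ 0 b) (φ 0 a)
        back = to-path (walk-reverse walk) (unique-reverse inner unique) (λ z → hub∉inner q (∈-reverse⁻ inner z)) (λ z → hub∉inner p (∈-reverse⁻ inner z))
                 (λ e → hub≢ ne (sym e))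

      -- A path is chosen only for `u` before `v` and reversed for the other orientation. Coherence
      -- then needs only that proofs of `<` are irrelevant and that reversal is an involution.
      path-by : (u v : Fin k) → u ≢ v → Tri (toℕ u < toℕ v) (toℕ u ≡ toℕ v) (toℕ v < toℕ u) → Path G (φ 0 (toℕ u)) (φ 0 (toℕ v))
      path-by u v _  (tri< lt _ _) = forth (toℕ<n u) (toℕ<n v) (<⇒≢ lt)
      path-by u v ne (tri≈ _ e _)  = ⊥-elim (ne (toℕ-injective e))
      path-by u v _  (tri> _ _ gt) = back (toℕ<n v) (toℕ<n u) (<⇒≢ gt)

      path-inside : ∀ u v e t {x} → x ∈ interior (path-by u v e t) → x ∈ C final (line (toℕ u) (toℕ v)) ⊎ x ∈ C final (line (toℕ v) (toℕ u))
      path-inside u v e (tri< lt _ _) z = Joined.inside (joined (toℕ<n u) (toℕ<n v) (<⇒≢ lt)) z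
      path-inside u v e (tri≈ _ e′ _) z = ⊥-elim (e (toℕ-injective e′))
      path-inside u v e (tri> _ _ gt) z = Sum.swap (Joined.inside (joined (toℕ<n v) (toℕ<n u) (<⇒≢ gt)) (∈-reverse⁻ _ z))

      path-coherent : ∀ u v e e′ t t′ → interior (path-by v u e′ t′) ≡ reverse (interior (path-by u v e t))
      path-coherent u v e e′ (tri≈ _ q _) _ = ⊥-elim (e (toℕ-injective q))
      path-coherent u v e e′ _ (tri≈ _ q _) = ⊥-elim (e′ (toℕ-injective q))
      path-coherent u v e e′ (tri< lt _ _) (tri< gt _ _) = ⊥-elim (<-asym lt gt)
      path-coherent u v e e′ (tri> _ _ lt) (tri> _ _ gt) = ⊥-elim (<-asym lt gt)
      path-coherent u v e e′ (tri< lt _ _) (tri> _ _ lt′) =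
        cong (λ l → reverse (Joined.inner (joined (toℕ<n u) (toℕ<n v) (<⇒≢ l)))) (≤-irrelevant lt′ lt)
      path-coherent u v e e′ (tri> _ _ gt) (tri< gt′ _ _) =
        trans (cong (λ l → Joined.inner (joined (toℕ<n v) (toℕ<n u) (<⇒≢ l))) (≤-irrelevant gt′ gt)) (sym (reverse-involutive _))

      topological-minor : TopMinor (K k) G
      topological-minor = record
        { ι = λ u → φ 0 (toℕ u) ; ι-inj = λ e → toℕ-injective (proj₂ (φ-inj e))
        ; path = λ u v e → path-by u v e (order u v)
        ; coherent = λ u v e e′ → path-coherent u v e e′ (order u v) (order v u)
        ; disjoint = λ u v u′ v′ e e′ n n′ x p q → clash u v u′ v′ n n′ (path-inside u v e (order u v) p) (path-inside u′ v′ e′ (order u′ v′) q)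
        ; avoid = λ u v e w p → avoid-hub u v w (path-inside u v e (order u v) p) }
        where
        order : ∀ (u v : Fin k) → Tri (toℕ u < toℕ v) (toℕ u ≡ toℕ v) (toℕ v < toℕ u)
        order u v = <-cmp (toℕ u) (toℕ v)
        same : ∀ u v u′ v′ {x} → x ∈ C final (line (toℕ u) (toℕ v)) → x ∈ C final (line (toℕ u′) (toℕ v′)) → u ≡ u′ × v ≡ v′
        same u v u′ v′ p q with line-injective {toℕ u} {toℕ v} {toℕ u′} {toℕ v′} (toℕ<n v) (toℕ<n v′) (disj final p q)
        ... | e , e′ = toℕ-injective e , toℕ-injective e′
        clash : ∀ u v u′ v′ {x} → ¬ (u ≡ u′ × v ≡ v′) → ¬ (u ≡ v′ × v ≡ u′) →
                x ∈ C final (line (toℕ u) (toℕ v)) ⊎ x ∈ C final (line (toℕ v) (toℕ u)) →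
                x ∈ C final (line (toℕ u′) (toℕ v′)) ⊎ x ∈ C final (line (toℕ v′) (toℕ u′)) → ⊥
        clash u v u′ v′ n n′ (inj₁ p) (inj₁ q) = n (same u v u′ v′ p q)
        clash u v u′ v′ n n′ (inj₁ p) (inj₂ q) = n′ (same u v v′ u′ p q)
        clash u v u′ v′ n n′ (inj₂ p) (inj₁ q) = n′ (swap (same v u u′ v′ p q))
        clash u v u′ v′ n n′ (inj₂ p) (inj₂ q) = n (swap (same v u v′ u′ p q))
        avoid-hub : ∀ u v w → φ 0 (toℕ w) ∈ C final (line (toℕ u) (toℕ v)) ⊎ φ 0 (toℕ w) ∈ C final (line (toℕ v) (toℕ u)) → ⊥
        avoid-hub u v w (inj₁ p) = hub-off (toℕ<n u) (toℕ<n v) (toℕ<n w) p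
        avoid-hub u v w (inj₂ p) = hub-off (toℕ<n v) (toℕ<n u) (toℕ<n w) p

columnᵘ-range : ∀ k → 1 ≤ Row.columnᵘ (rows k) × Row.columnᵘ (rows k) ≤ 2
columnᵘ-range zero          = s≤s z≤n , s≤s z≤n
columnᵘ-range (suc zero)    = s≤s z≤n , ≤-refl
columnᵘ-range (suc (suc k)) = columnᵘ-range k

columnᵛ-range : ∀ k → 3 ≤ Row.columnᵛ (rows k) × Row.columnᵛ (rows k) ≤ 4
columnᵛ-range zero          = s≤s (s≤s (s≤s z≤n)) , s≤s (s≤s (s≤s z≤n))
columnᵛ-range (suc zero)    = s≤s (s≤s (s≤s z≤n)) , ≤-refl
columnᵛ-range (suc (suc k)) = columnᵛ-range k

height-rows : ∀ i k → Row.height (rows i) ≡ Row.height (rows k) → i ≡ k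
height-rows zero zero e = refl
height-rows zero (suc zero) ()
height-rows zero (suc (suc k)) ()
height-rows (suc zero) zero ()
height-rows (suc (suc i)) zero ()
height-rows (suc zero) (suc (suc k)) ()
height-rows (suc (suc i)) (suc zero) ()
height-rows (suc zero) (suc zero) e = refl
height-rows (suc (suc i)) (suc (suc k)) e = cong (2 +_) (height-rows i k (+-cancelˡ-≡ 8 _ _ e))

cellRow : ℕ → ℕ → Side → ℕ → Vertex
cellRow c t leftward  = CellVertices.u c t
cellRow c t rightward = CellVertices.v c t

cellRow-at : ∀ c t s i → ∃ λ n → cellRow c t s i ≡ big n t (Row.height (rows i)) × col c < n × n ≤ 5 + col c
cellRow-at c t leftward i = Row.columnᵘ (rows i) + col c , refl , +-monoˡ-≤ (col c) (proj₁ (columnᵘ-range i)) ,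
  +-monoˡ-≤ (col c) {y = 5} (≤-trans (proj₂ (columnᵘ-range i)) (s≤s (s≤s z≤n)))
cellRow-at c t rightward i = Row.columnᵛ (rows i) + col c , refl , +-monoˡ-≤ (col c) {x = 1} (≤-trans (s≤s z≤n) (proj₁ (columnᵛ-range i))) ,
  +-monoˡ-≤ (col c) {y = 5} (≤-trans (proj₂ (columnᵛ-range i)) (n≤1+n 4))

big-injective : ∀ {n t e n′ t′ e′} → big n t e ≡ big n′ t′ e′ → n ≡ n′ × t ≡ t′ × e ≡ e′
big-injective refl = refl , refl , refl

-- Crossings in the cells of the host graph

module PageLinks (R : CompleteOrderedField) (G : Graph) (_≟_ : DecidableEquality (V G)) (w : ℕ) {b : Subset} (P : Page G w R b) where
  open Walks G

  φ : ℕ → ℕ → V G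
  φ n t = Page.φ P (big n t 0)

  φ-inj : ∀ {n t n′ t′} → φ n t ≡ φ n′ t′ → n ≡ n′ × t ≡ t′
  φ-inj e with big-injective (Page.φ-inj P e)
  ... | p , q , _ = p , q

  open Lines G _≟_ using (∈-reverse⁻)
  open Grid G _≟_ φ φ-inj using (Link)

  page-link : ∀ {p q} → Host.Edge R w b p q → Link (Page.φ P p) (Page.φ P q)
  page-link e D with Page.link P e D
  ... | l , v , f , o = l , v , (λ p → f p) , λ p n t → o p n t

  track : ∀ n t → 0 < n → Link (φ n t) (φ (suc n) t)
  track (suc n) t p = page-link (CellEdges.track-edge R w b n t)

  rungᵃ : ∀ c t → Link (φ (col c) (suc t)) (φ (1 + col c) t)
  rungᵃ c t = page-link (CellEdges.Cell.A-u R w b c t 0)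

  rungᵈ : ∀ c t → Link (φ (3 + col c) t) (φ (5 + col c) (suc t))
  rungᵈ c t = page-link (CellEdges.Cell.v-D R w b c t 0)

  hub-link : ∀ t → Link (φ 0 (t / suc w)) (φ 1 t)
  hub-link t = page-link (CellEdges.hub-edge R w b t)

  Avoidable : V G → V G → Set
  Avoidable x y = (D : List (V G)) → ∃ λ l → Walk x l y × (∀ {z} → z ∈ l → z ∉ D)

  avoidable-sym : ∀ {x y} → Avoidable x y → Avoidable y x
  avoidable-sym f D with f D
  ... | l , v , free = reverse l , walk-reverse v , λ p → free (∈-reverse⁻ l p)

module Ladders (R : CompleteOrderedField) (G : Graph) (_≟_ : DecidableEquality (V G)) (w : ℕ) {b : Subset} (P : Page G w R b) where
  open PageLinks R G _≟_ w P

  rows-of : ℕ → ℕ → Side → ℕ → V G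
  rows-of c t s i = Page.φ P (cellRow c t s i)

  edge-avoidable : ∀ {p q} → Host.Edge R w b p q → Avoidable (Page.φ P p) (Page.φ P q)
  edge-avoidable e D with Page.link P e D
  ... | l , v , f , _ = l , v , λ p → f p

  near-avoidable : ∀ c t {p q} → CellEdges.Cell.Near R w b c t p q → Avoidable (Page.φ P p) (Page.φ P q)
  near-avoidable c t (inj₁ e) = edge-avoidable e
  near-avoidable c t (inj₂ e) = avoidable-sym (edge-avoidable e)

  cellRow-injective : ∀ {c t s s′ i i′} → cellRow c t s i ≡ cellRow c t s′ i′ → s ≡ s′ × i ≡ i′
  cellRow-injective {c} {t} {s} {s′} {i} {i′} e with height-rows i i′ (same (cellRow-at c t s i) (cellRow-at c t s′ i′))
    where
    same : (∃ λ n → cellRow c t s i ≡ big n t (Row.height (rows i)) × _) → (∃ λ n → cellRow c t s′ i′ ≡ big n t (Row.height (rows i′)) × _) →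
           Row.height (rows i) ≡ Row.height (rows i′)
    same (_ , p , _) (_ , q , _) = proj₂ (proj₂ (big-injective (trans (sym p) (trans e q))))
  ... | refl = side s s′ e , refl
    where
    side : ∀ s s′ → cellRow c t s i ≡ cellRow c t s′ i → s ≡ s′
    side leftward  leftward  _ = refl
    side rightward rightward _ = refl
    side leftward  rightward e = ⊥-elim (<-irrefl (+-cancelʳ-≡ (col c) _ _ (proj₁ (big-injective e))) (≤-trans (s≤s (proj₂ (columnᵘ-range i))) (proj₁ (columnᵛ-range i))))
    side rightward leftward  e = ⊥-elim (<-irrefl (+-cancelʳ-≡ (col c) _ _ (proj₁ (big-injective (sym e)))) (≤-trans (s≤s (proj₂ (columnᵘ-range i))) (proj₁ (columnᵛ-range i))))

  ladder : ∀ c t {A D} → A ≡ φ (col c) (suc t) → D ≡ φ (5 + col c) (suc t) → Ladder Avoidable A D (rows-of c t)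
  ladder c t refl refl = record
    { P-inj = λ e → cellRow-injective {c} {t} (Page.φ-inj P e)
    ; A-u = λ k → edge-avoidable (A-u k) ; v-D = λ k → edge-avoidable (v-D k) ; rung = λ k → edge-avoidable (u-v k)
    ; rise = λ { leftward k → near-avoidable c t (u-u k) ; rightward k → near-avoidable c t (v-v k) } }
    where open CellEdges.Cell R w b c t

module CompanionCells (wlem : (P : Set) → ¬ P ⊎ ¬ ¬ P) (R : CompleteOrderedField) (G : Graph) (_≟_ : DecidableEquality (V G)) (w : ℕ)
                      {b : Subset} (P : Page G w R b) where
  open PageLinks R G _≟_ w P
  open Machine wlem G _≟_ φ φ-inj track rungᵃ rungᵈ using (Cells)
  open Grid G _≟_ φ φ-inj using (OffTrack)

  Inside : ∀ {b} → Page G w R b → ℕ → ℕ → V G → Set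
  Inside Q c t x = ∃ λ s → ∃ λ i → 0 < i × x ≡ Page.φ Q (cellRow c t s i)

  inside-col : ∀ {b} (Q : Page G w R b) {c c′ t x} → Inside Q c t x → Inside Q c′ t x → c ≡ c′
  inside-col Q {c} {c′} {t} (s , i , _ , e) (s′ , i′ , _ , e′) with cellRow-at c t s i | cellRow-at c′ t s′ i′
  ... | n , p , a , z | n′ , p′ , a′ , z′ with big-injective (trans (sym p) (trans (Page.φ-inj Q (trans (sym e) e′)) p′))
  ...   | refl , _ = col-unique {c} {c′} a z a′ z′

  -- Rows other than row 0 have nonzero height, whereas track vertices have height 0.
  inside-off : ∀ {b} (Q : Page G w R b) {c t x} → Inside Q c t x → ∀ n t′ → x ≢ Page.φ Q (big n t′ 0)
  inside-off Q {c} {t} (s , suc i , _ , e) n t′ e′ with cellRow-at c t s (suc i)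
  ... | _ , p , _ with height-rows (suc i) 0 (proj₂ (proj₂ (big-injective (trans (sym p) (Page.φ-inj Q (trans (sym e) e′))))))
  ...   | ()

  cells : ∀ {j} → Companion G w R P j → Cells j
  cells {j} T = record
    { In₁ = Inside P ; In₂ = Inside page ; In₁-col = inside-col P ; In₂-col = inside-col page
    ; In₁-off = inside-off P ; In₂-off = λ z n t′ p q e → inside-off page z n t′ (trans e (agree n t′ p q))
    ; crossing = crossing }
    where
    open Companion T
    crossing : ∀ c t → 5 + col c < j → suc t < j → ∃ λ l₁ → ∃ λ l₂ →
               Route Avoidable (φ (1 + col c) t) l₁ (φ (5 + col c) (suc t)) × Route Avoidable (φ (3 + col c) t) l₂ (φ (col c) (suc t)) ×
               (∀ {x} → x ∈ l₁ → Inside P c t x ⊎ Inside page c t x) × (∀ {x} → x ∈ l₂ → Inside P c t x ⊎ Inside page c t x) ×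
               (∀ {x} → x ∈ l₁ → x ∉ l₂)
    crossing c t p q = unpack (cross (2 · x + 0)
        (subst (λ k → Avoidable (Page.φ P (cellRow c t leftward (2 · x + 0))) (Page.φ P (cellRow c t rightward k))) (sym even≡)
          (Ladders.edge-avoidable R G _≟_ w P (CellEdges.Cell.diagonal-true R w b c t x b-x)))
        (subst (λ k → Avoidable (Page.φ page (cellRow c t leftward k)) (Page.φ page (cellRow c t rightward (2 · x + 0)))) (sym even≡)
          (Ladders.edge-avoidable R G _≟_ w page (CellEdges.Cell.diagonal-false R w bits c t x bits-x))))
      where
      t<j : t < j
      t<j = <-trans ≤-refl q
      c<j : ∀ r → r ≤ 5 → r + col c < j
      c<j r r≤ = ≤-trans (s≤s (+-monoˡ-≤ (col c) r≤)) p
      -- Row 0 lies on a track, within the box on which the two pages agree. The same holds for the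
      -- ports `A` and `D`, so the cells of the two pages form ladders with common ends.
      foot : ∀ s → Page.φ P (cellRow c t s 0) ≡ Page.φ page (cellRow c t s 0)
      foot leftward  = agree (1 + col c) t (c<j 1 (s≤s z≤n)) t<j
      foot rightward = agree (3 + col c) t (c<j 3 (s≤s (s≤s (s≤s z≤n)))) t<j
      open Cross _≟_ Avoidable avoidable-sym (Ladders.ladder R G _≟_ w P c t refl refl)
             (Ladders.ladder R G _≟_ w page c t (agree (col c) (suc t) (c<j 0 z≤n) q) (agree (5 + col c) (suc t) p q)) foot
             using (cross; Crossing; Inner)
      even≡ : suc (2 · x + 0) ≡ 2 · x + 1
      even≡ = sym (+-suc (2 · x) 0)
      inner : ∀ {z} → Inner 0 z → Inside P c t z ⊎ Inside page c t z
      inner (inj₁ (s , i , lt , e)) = inj₁ (s , i , lt , e)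
      inner (inj₂ (s , i , lt , e)) = inj₂ (s , i , lt , e)
      unpack : Crossing 0 → _
      unpack X = l₁ , l₂ , route₁ , route₂ , (λ {z} y → inner (inner₁ y)) , (λ {z} y → inner (inner₂ y)) , λ {z} y y′ → disjoint y y′
        where open Crossing X

-- Both conclusions from a base page and its companions

module Conclusion (R : CompleteOrderedField) (G : Graph) (cnt : Countable G) where
  open OrderedField R using (wlem)

  _≟ᵛ_ : DecidableEquality (V G)
  x ≟ᵛ y = map′ (proj₂ cnt) (cong (proj₁ cnt)) (proj₁ cnt x ℕ.≟ proj₁ cnt y)

  module _ (w : ℕ) {b} (P : Page G w R b) (companions : ∀ j → Companion G w R P j) where
    open PageLinks R G _≟ᵛ_ w P

    infinite-minor : Minor Kℵ₀ G
    infinite-minor = Machine.Tournament.Infinite.minor wlem G _≟ᵛ_ φ φ-inj track rungᵃ rungᵈ (λ j → CompanionCells.cells wlem R G _≟ᵛ_ w P (companions j))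

    finite-topological-minor : TopMinor (K w) G
    finite-topological-minor = Machine.Tournament.Finite.topological-minor wlem G _≟ᵛ_ φ φ-inj track rungᵃ rungᵈ (λ j → CompanionCells.cells wlem R G _≟ᵛ_ w P (companions j)) w hub-link

theorem1p2 : (R : CompleteOrderedField) (G : Graph) → Countable G →
    ((H : Graph) → Countable H → Plane.Planar R H → TopMinor H G) →
    Minor Kℵ₀ G × ((k : ℕ) → TopMinor (K k) G)
theorem1p2 R G cnt universal =
  infinite-minor 0 (Pages.base R G cnt universal 0) (Pages.companion R G cnt universal 0) ,
  λ k → finite-topological-minor k (Pages.base R G cnt universal k) (Pages.companion R G cnt universal k)
  where open Conclusion R G cnt
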